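{- Let $T[0..n-1]$ be a text of length $n$ over an alphabet of size $\sigma$ whose Burrows-Wheeler Transform consists of $r$ runs. Then there is a data structure (a run-length compressed suffix array for $T$) that occupies $O\left(r\log(n/r)+r\log\sigma+\sigma\right)$ bits and supports the following query: given a character $a$ of the alphabet and the suffix-array interval for a pattern $P$ with respect to $T$, it returns the suffix-array interval for $aP$ with respect to $T$ in $O(\log r_a)$ time, where $r_a$ is the number of runs of copies of $a$ in the Burrows-Wheeler Transform of $T$. The constants hidden in the $O$-notation are absolute.
   Context: Model: the word RAM with words of $\Theta(\log n)$ bits, where text positions and characters each fit in $O(1)$ words; space is counted in bits. The text $T[0..n-1]$ is over the totally ordered alphabet $\{0,\ldots,\sigma-1\}$ and ends with a terminator symbol that occurs nowhere else in $T$ and is smaller than all other characters of $T$. The suffix array $\mathrm{SA}[0..n-1]$ of $T$ is the permutation of $\{0,\ldots,n-1\}$ listing the starting positions of the suffixes of $T$ in lexicographic order of the suffixes. The Burrows-Wheeler Transform (BWT) of $T$ is the string $L[0..n-1]$ with $L[i]=T[(\mathrm{SA}[i]-1)\bmod n]$. A run is a maximal block of consecutive equal characters in $L$; $r$ is the total number of runs in $L$, and $r_a$ is the number of runs consisting of copies of $a$. The suffix-array (SA) interval for a string $P$ is the set of indices $i$ such that the suffix $T[\mathrm{SA}[i]..n-1]$ has $P$ as a prefix; it is a (possibly empty) interval $[s..e]$ and is given and returned by its two endpoints (or as "empty"). $aP$ denotes the character $a$ followed by $P$. Convention: a time bound $O(\log r_a)$ is read as $O(1)$ when $r_a\le 1$,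 i.e. as $O(1+\log(\max(r_a,1)))$.
   Formalization: For the one-character text T = a, queries with character a and nonempty P are excluded, since P empty and P = a share an interval but aP does not; words of Θ(log n) bits are taken with a large enough lower constant, and the O-constants may depend on the upper one. -}

module Defs where

open import Data.Bool.Base using (Bool; true; false; if_then_else_; _∧_; _∨_; _xor_)
open import Data.Fin.Base as Fin using (Fin; zero; suc; toℕ; fromℕ; fromℕ<; inject₁)
open import Data.Fin.Permutation using (Permutation′; _⟨$⟩ʳ_)
import Data.Fin.Properties as Fin
open import Data.List.Base using (List; []; _∷_; drop; filter; foldr; length)
open import Data.List.Relation.Binary.Lex.Strict using (Lex-<)
open import Data.List.Relation.Binary.Prefix.Heterogeneous using (Prefix)
open import Data.Maybe.Base using (Maybe; just; nothing)
open import Data.Nat.Base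
open import Data.Nat.Logarithm using (⌊log₂_⌋)
open import Data.Nat.Properties using (m^n≢0)
open import Data.Product.Base using (Σ-syntax; _×_; _,_; proj₁)
open import Data.Vec.Base as Vec using (Vec; lookup; tabulate; toList; _[_]≔_)
open import Function.Bundles using (_⇔_)
open import Relation.Binary.PropositionalEquality using (_≡_; _≢_)
open import Relation.Nullary using (¬_; does)

------------------------------------------------------------------------
-- Total division and remainder

infixl 7 _÷_ _rem_

_÷_ : ℕ → ℕ → ℕ
x ÷ zero      = 0
x ÷ y@(suc _) = x / y

_rem_ : ℕ → ℕ → ℕ
x rem zero      = x
x rem y@(suc _) = x % y

------------------------------------------------------------------------
-- Texts, suffix arrays and the Burrows–Wheeler transform

module _ {σ n : ℕ} where

  -- Strictness of the comparison also says that the terminator occurs only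
  -- at the end.
  Terminated : Vec (Fin σ) n → Set
  Terminated T =
    Σ[ l ∈ Fin n ] suc (toℕ l) ≡ n
                 × (∀ j → j ≢ l → lookup T l Fin.< lookup T j)

  suffix : Vec (Fin σ) n → Fin n → List (Fin σ)
  suffix T i = drop (toℕ i) (toList T)

  IsSuffixArray : Vec (Fin σ) n → Permutation′ n → Set
  IsSuffixArray T SA =
    ∀ i j → i Fin.< j →
    Lex-< _≡_ Fin._<_ (suffix T (SA ⟨$⟩ʳ i)) (suffix T (SA ⟨$⟩ʳ j))

-- (i - 1) mod n
cyclicPred : ∀ {n} → Fin n → Fin n
cyclicPred zero    = fromℕ _
cyclicPred (suc i) = inject₁ i

module _ {σ n : ℕ} where

  bwt : Vec (Fin σ) n → Permutation′ n → Vec (Fin σ) n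
  bwt T SA = tabulate λ i → lookup T (cyclicPred (SA ⟨$⟩ʳ i))

  Occurs : Vec (Fin σ) n → Permutation′ n → List (Fin σ) → Fin n → Set
  Occurs T SA P i = Prefix _≡_ P (suffix T (SA ⟨$⟩ʳ i))

-- A possibly empty interval [s..e], both endpoints included.
Interval : ℕ → Set
Interval n = Maybe (Fin n × Fin n)

IsSAInterval : ∀ {σ n} → Vec (Fin σ) n → Permutation′ n → List (Fin σ) →
               Interval n → Set
IsSAInterval T SA P nothing        = ∀ i → ¬ Occurs T SA P i
IsSAInterval T SA P (just (s , e)) =
  s Fin.≤ e × (∀ i → (s Fin.≤ i × i Fin.≤ e) ⇔ Occurs T SA P i)

------------------------------------------------------------------------
-- Runs: each maximal block of equal characters with its length

Run : ℕ → Set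
Run σ = Fin σ × ℕ

extend : ∀ {σ} → Fin σ → List (Run σ) → List (Run σ)
extend x []             = (x , 1) ∷ []
extend x ((y , k) ∷ rs) =
  if does (x Fin.≟ y) then (y , suc k) ∷ rs else (x , 1) ∷ (y , k) ∷ rs

runs : ∀ {σ} → List (Fin σ) → List (Run σ)
runs = foldr extend []

module _ {σ n : ℕ} (T : Vec (Fin σ) n) (SA : Permutation′ n) where

  bwtRuns : List (Run σ)
  bwtRuns = runs (toList (bwt T SA))

  #runs : ℕ
  #runs = length bwtRuns

  #runsOf : Fin σ → ℕ
  #runsOf a = length (filter (λ b → proj₁ b Fin.≟ a) bwtRuns)

------------------------------------------------------------------------
-- Asymptotic expressions

-- r log (n / r) + r log σ + σ. Since ⌊log₂ ⌊x⌋⌋ = ⌊log₂ x⌋, rounding can only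
-- tighten an upper bound, and by at most 2r, which is O(r ⌊log₂ σ⌋) as σ ≥ 2
-- for every terminated text with n ≥ 2.
spaceBound : (n r σ : ℕ) → ℕ
spaceBound n r σ = r * ⌊log₂ n ÷ r ⌋ + r * ⌊log₂ σ ⌋ + σ

-- 1 + log (max k 1)
timeBound : ℕ → ℕ
timeBound k = 1 + ⌊log₂ k ⊔ 1 ⌋

-- The number of binary digits of x, for x ≥ 1.
bitLength : ℕ → ℕ
bitLength x = 1 + ⌊log₂ x ⌋

------------------------------------------------------------------------
-- Word RAM with w-bit words, represented by the naturals below 2 ^ w

module _ (w : ℕ) where

  trunc : ℕ → ℕ
  trunc x = _%_ x (2 ^ w) {{m^n≢0 2 w}}

toBit : Bool → ℕ
toBit b = if b then 1 else 0

odd : ℕ → Bool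
odd x = x % 2 ≡ᵇ 1

bitwise : (Bool → Bool → Bool) → (w : ℕ) → ℕ → ℕ → ℕ
bitwise f zero    x y = 0
bitwise f (suc w) x y = toBit (f (odd x) (odd y)) + 2 * bitwise f w (x / 2) (y / 2)

data Op : Set where
  add sub mul div mod and or xor shl shr eq lt : Op

⟦_⟧ : Op → (w : ℕ) → ℕ → ℕ → ℕ
⟦ add ⟧ w x y = trunc w (x + y)
⟦ sub ⟧ w x y = trunc w ((x + 2 ^ w) ∸ y)
⟦ mul ⟧ w x y = trunc w (x * y)
⟦ div ⟧ w x y = x ÷ y
⟦ mod ⟧ w x y = x rem y
⟦ and ⟧ w x y = bitwise _∧_ w x y
⟦ or  ⟧ w x y = bitwise _∨_ w x y
⟦ xor ⟧ w x y = bitwise _xor_ w x y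
⟦ shl ⟧ w x y = trunc w (x * 2 ^ y)
⟦ shr ⟧ w x y = _/_ x (2 ^ y) {{m^n≢0 2 y}}
⟦ eq  ⟧ w x y = toBit (x ≡ᵇ y)
⟦ lt  ⟧ w x y = toBit (x <ᵇ y)

-- A program mentions only finitely many registers, so registers account for
-- O(1) words of working space.
Reg : Set
Reg = ℕ

Registers : Set
Registers = Reg → ℕ

infixl 6 _[_↦_]

_[_↦_] : Registers → Reg → ℕ → Registers
(ρ [ d ↦ v ]) x = if x ≡ᵇ d then v else ρ x

infixr 4 _⨾_

data Program : Set where
  skip         : Program
  const        : (d : Reg) (k : ℕ) → Program
  apply        : (d : Reg) (o : Op) (x y : Reg) → Program
  load         : (d x : Reg) → Program
  store        : (x y : Reg) → Program
  _⨾_          : (p q : Program) → Program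
  ifNonZero    : (x : Reg) (p q : Program) → Program
  whileNonZero : (x : Reg) (p : Program) → Program

-- w ⊢ p , ρ , M ⇓[ t ] ρ′ , M′ : started with registers ρ and memory M, the
-- program p halts after t steps with registers ρ′ and memory M′. There is no
-- rule for an access outside the memory, so such an access never halts.
infix 3 _⊢_,_,_⇓[_]_,_

data _⊢_,_,_⇓[_]_,_ (w : ℕ) {m : ℕ} :
     Program → Registers → Vec ℕ m → ℕ → Registers → Vec ℕ m → Set where

  skip   : ∀ {ρ M} → w ⊢ skip , ρ , M ⇓[ 1 ] ρ , M

  const  : ∀ {d k ρ M} →
           w ⊢ const d k , ρ , M ⇓[ 1 ] ρ [ d ↦ trunc w k ] , M

  apply  : ∀ {d o x y ρ M} →
           w ⊢ apply d o x y , ρ , M ⇓[ 1 ] ρ [ d ↦ ⟦ o ⟧ w (ρ x) (ρ y) ] , M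

  load   : ∀ {d x ρ M} (i : Fin m) → toℕ i ≡ ρ x →
           w ⊢ load d x , ρ , M ⇓[ 1 ] ρ [ d ↦ lookup M i ] , M

  store  : ∀ {x y ρ M} (i : Fin m) → toℕ i ≡ ρ x →
           w ⊢ store x y , ρ , M ⇓[ 1 ] ρ , M [ i ]≔ ρ y

  seq    : ∀ {p q ρ ρ′ ρ″ M M′ M″ t u} →
           w ⊢ p , ρ , M ⇓[ t ] ρ′ , M′ →
           w ⊢ q , ρ′ , M′ ⇓[ u ] ρ″ , M″ →
           w ⊢ p ⨾ q , ρ , M ⇓[ t + u ] ρ″ , M″

  if≢0   : ∀ {x p q ρ ρ′ M M′ t} → ρ x ≢ 0 →
           w ⊢ p , ρ , M ⇓[ t ] ρ′ , M′ →
           w ⊢ ifNonZero x p q , ρ , M ⇓[ 1 + t ] ρ′ , M′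

  if≡0   : ∀ {x p q ρ ρ′ M M′ t} → ρ x ≡ 0 →
           w ⊢ q , ρ , M ⇓[ t ] ρ′ , M′ →
           w ⊢ ifNonZero x p q , ρ , M ⇓[ 1 + t ] ρ′ , M′

  while≢0 : ∀ {x p ρ ρ′ ρ″ M M′ M″ t u} → ρ x ≢ 0 →
            w ⊢ p , ρ , M ⇓[ t ] ρ′ , M′ →
            w ⊢ whileNonZero x p , ρ′ , M′ ⇓[ u ] ρ″ , M″ →
            w ⊢ whileNonZero x p , ρ , M ⇓[ 1 + t + u ] ρ″ , M″

  while≡0 : ∀ {x p ρ M} → ρ x ≡ 0 →
            w ⊢ whileNonZero x p , ρ , M ⇓[ 1 ] ρ , M

------------------------------------------------------------------------
-- Calling convention: register 0 holds the query character. Register 1 holds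
-- 0 for an empty interval, and 1 for an interval whose endpoints are in
-- registers 2 and 3. All other registers are initially 0.

input : ∀ {σ n} → Fin σ → Interval n → Registers
input a nothing        = (λ _ → 0) [ 0 ↦ toℕ a ]
input a (just (s , e)) =
  (λ _ → 0) [ 0 ↦ toℕ a ] [ 1 ↦ 1 ] [ 2 ↦ toℕ s ] [ 3 ↦ toℕ e ]

Returns : ∀ {n} → Registers → Interval n → Set
Returns ρ nothing        = ρ 1 ≡ 0
Returns ρ (just (s , e)) = ρ 1 ≡ 1 × ρ 2 ≡ toℕ s × ρ 3 ≡ toℕ e

-- The final memory must equal the initial one, so that the structure can be
-- queried again.
AnswersWithin : ∀ {σ n m} → (w : ℕ) → Program → Vec ℕ m → ℕ →
                Fin σ → Interval n → Interval n → Set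
AnswersWithin w query D limit a I J =
  Σ[ t ∈ ℕ ] Σ[ ρ ∈ Registers ]
    (w ⊢ query , input a I , D ⇓[ t ] ρ , D) × Returns ρ J × t ≤ limit

-- Words have Θ(log n) bits: at most κ times the length of n, and enough to hold
-- κ₀ text positions or characters. Without some slack κ₀ a structure of O(n)
-- words, with a constant above 1, would not be addressable by single words.
record WordSize (κ₀ κ n σ w : ℕ) : Set where
  field
    fitsPositions  : κ₀ * bitLength n ≤ w
    fitsCharacters : κ₀ * bitLength σ ≤ w
    logarithmic    : w ≤ κ * bitLength n

{-# OPTIONS --safe #-}

-- Let B be the bit vector of length σ n whose row a marks the occurrences of a
-- in the BWT. Its rank at a n + i counts the suffixes that are smaller than a
-- followed by the i-th smallest suffix, so a backward search step from [s..e]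
-- amounts to the ranks at a n + s and a n + e + 1 (except that the terminator
-- is only ever prepended to the empty pattern). The ones of B form r runs, r_a
-- of them in row a. Given their starting positions X and the ranks Y there, a
-- binary search for the last start before the key, among those of row a, gives
-- the rank.
--
-- X and Y together are a nondecreasing sequence of 2 r + 3 numbers up to
-- (σ + 1) n. Their low log (n / r) + log σ + 2 bits are stored verbatim. The
-- high parts and the numbers of runs before each row are a nondecreasing
-- sequence of O(r + σ) numbers up to 2 r, encoded in unary in O(r + σ) bits.
-- Constant-time select on this encoding uses blocks of about log (r + σ) / 4
-- bits and lookup tables. The block of an index is found by its rank among the
-- nonempty blocks, which takes a bit vector over the indices; hence there is no
-- distinction between sparse and dense blocks.

module Submission where

open import Defs
open import Data.Bool.Base using (true; false; T)
open import Data.Empty using (⊥-elim)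
open import Data.Fin.Base as Fin using (Fin; zero; suc; toℕ; fromℕ; fromℕ<)
open import Data.Fin.Permutation using (Permutation′; _⟨$⟩ʳ_; _⟨$⟩ˡ_; inverseˡ; inverseʳ)
import Data.Fin.Properties as Fin
open import Data.Fin.Relation.Unary.Top using (view; ‵fromℕ; ‵inject₁; view-fromℕ; view-inject₁)
open import Data.List.Base using (List; []; _∷_; drop; filter; length)
open import Data.List.Relation.Binary.Lex.Core using (this; next)
open import Data.List.Relation.Binary.Lex.Strict using (Lex-<; <-asymmetric)
open import Data.List.Relation.Binary.Prefix.Heterogeneous using (Prefix; []; _∷_)
open import Data.Maybe.Base using (just; nothing)
open import Data.Nat.Base
open import Data.Nat.Divisibility using (n∣m*n; divides-refl)
open import Data.Nat.DivMod hiding (_div_; _mod_)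
open import Data.Nat.Induction using (<-rec)
open import Data.Nat.Logarithm
open import Data.Nat.Properties
open import Data.Nat.Tactic.RingSolver using (solve-∀)
open import Data.Product.Base using (Σ-syntax; ∃-syntax; _×_; _,_; proj₁; proj₂)
open import Data.Sum.Base using (inj₁; inj₂)
open import Data.Vec.Base using (Vec; []; _∷_; lookup; tabulate; toList)
open import Data.Vec.Properties using (lookup∘tabulate; length-toList)
open import Data.Vec.Relation.Unary.All using (All)
open import Data.Vec.Relation.Unary.All.Properties using (tabulate⁺)
open import Function.Base using (case_of_)
open import Function.Bundles using (mk⇔; Equivalence)
open import Relation.Binary.Definitions using (tri<; tri≈; tri>)
open import Relation.Binary.PropositionalEquality hiding (J)
open import Relation.Nullary using (Dec; yes; no; ¬_; does)
open import Relation.Nullary.Decidable using (True; toWitness; _×-dec_; ¬?; decidable-stable)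

-- The bound leaves no room for lower-order terms in `n`. With `r` and `σ` constant it is only about
-- `log n`, so lookup tables for blocks of `log n / 4` bits would be far too large; the block length
-- is therefore tied to `M = σ + r`. A constant number of whole words is affordable nevertheless,
-- because `n < r * 2 ^ (1 + log (n / r))` makes `log n` itself `O(r + log (n / r))`. Laying the
-- rows one after another replaces a predecessor structure per character by one sequence of numbers
-- up to about `σ n`; this is why an entry costs `log (n / r) + log σ` bits. Ranks are shifted by
-- `σ n` and high parts by `r`, so that everything forms one monotone sequence and a single select
-- structure serves for all of it. A query interval does not reveal its pattern. This matters only
-- for the terminator, where the pattern has to be empty; if `n ≥ 2`, the interval is the full one
-- exactly for the empty pattern.

infixl 7 _/2^_ _%2^_

_/2^_ : ℕ → ℕ → ℕ
x /2^ k = _/_ x (2 ^ k) {{m^n≢0 2 k}}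

_%2^_ : ℕ → ℕ → ℕ
x %2^ k = _%_ x (2 ^ k) {{m^n≢0 2 k}}

%2^-< : ∀ x k → x %2^ k < 2 ^ k
%2^-< x k = m%n<n x (2 ^ k) {{m^n≢0 2 k}}

%2^-id : ∀ {x} k → x < 2 ^ k → x %2^ k ≡ x
%2^-id k = m<n⇒m%n≡m {{m^n≢0 2 k}}

-- Sums and counting

Σ< : ℕ → (ℕ → ℕ) → ℕ
Σ< zero    f = 0
Σ< (suc n) f = Σ< n f + f n

χ : {P : Set} → Dec P → ℕ
χ (yes _) = 1
χ (no _)  = 0

χ-yes : ∀ {P : Set} (P? : Dec P) → P → χ P? ≡ 1
χ-yes (yes _) p = refl
χ-yes (no ¬p) p = ⊥-elim (¬p p)

χ-no : ∀ {P : Set} (P? : Dec P) → ¬ P → χ P? ≡ 0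
χ-no (yes p) ¬p = ⊥-elim (¬p p)
χ-no (no _)  ¬p = refl

χ-zero : ∀ {P : Set} (P? : Dec P) → χ P? ≡ 0 → ¬ P
χ-zero (no ¬p) _ = ¬p

χ≤1 : ∀ {P : Set} (P? : Dec P) → χ P? ≤ 1
χ≤1 (yes _) = ≤-refl
χ≤1 (no _)  = z≤n

χ-cong : ∀ {P Q : Set} (P? : Dec P) (Q? : Dec Q) → (P → Q) → (Q → P) → χ P? ≡ χ Q?
χ-cong (yes p) Q? f g = sym (χ-yes Q? (f p))
χ-cong (no ¬p) Q? f g = sym (χ-no Q? (λ q → ¬p (g q)))

Σ-cong : ∀ n {f g} → (∀ i → i < n → f i ≡ g i) → Σ< n f ≡ Σ< n g
Σ-cong zero    f≡g = refl
Σ-cong (suc n) f≡g =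
  cong₂ _+_ (Σ-cong n λ i i< → f≡g i (m<n⇒m<1+n i<)) (f≡g n (n<1+n n))

Σ-+ : ∀ m n f → Σ< (m + n) f ≡ Σ< m f + Σ< n (λ i → f (m + i))
Σ-+ m zero    f = trans (cong (λ k → Σ< k f) (+-identityʳ m)) (sym (+-identityʳ _))
Σ-+ m (suc n) f = begin
  Σ< (m + suc n) f                                    ≡⟨ cong (λ k → Σ< k f) (+-suc m n) ⟩
  Σ< (m + n) f + f (m + n)                            ≡⟨ cong (_+ f (m + n)) (Σ-+ m n f) ⟩
  Σ< m f + Σ< n (λ i → f (m + i)) + f (m + n)         ≡⟨ +-assoc (Σ< m f) _ _ ⟩
  Σ< m f + (Σ< n (λ i → f (m + i)) + f (m + n))       ∎
  where open ≡-Reasoning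

Σ-monoˡ : ∀ {m n} f → m ≤ n → Σ< m f ≤ Σ< n f
Σ-monoˡ {m} {n} f m≤n = begin
  Σ< m f                                  ≤⟨ m≤m+n _ _ ⟩
  Σ< m f + Σ< (n ∸ m) (λ i → f (m + i))   ≡⟨ Σ-+ m (n ∸ m) f ⟨
  Σ< (m + (n ∸ m)) f                      ≡⟨ cong (λ k → Σ< k f) (m+[n∸m]≡n m≤n) ⟩
  Σ< n f                                  ∎
  where open ≤-Reasoning

Σ-ones : ∀ n {f} → (∀ i → i < n → f i ≡ 1) → Σ< n f ≡ n
Σ-ones zero    f≡1 = refl
Σ-ones (suc n) f≡1 = trans
  (cong₂ _+_ (Σ-ones n λ i i< → f≡1 i (m<n⇒m<1+n i<)) (f≡1 n (n<1+n n))) (+-comm n 1)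

Σ-zeros : ∀ n {f} → (∀ i → i < n → f i ≡ 0) → Σ< n f ≡ 0
Σ-zeros zero    f≡0 = refl
Σ-zeros (suc n) f≡0 =
  cong₂ _+_ (Σ-zeros n λ i i< → f≡0 i (m<n⇒m<1+n i<)) (f≡0 n (n<1+n n))

Σ-bound : ∀ n {f} → (∀ i → f i ≤ 1) → Σ< n f ≤ n
Σ-bound zero    f≤1 = z≤n
Σ-bound (suc n) f≤1 = ≤-trans (+-mono-≤ (Σ-bound n f≤1) (f≤1 n)) (≤-reflexive (+-comm n 1))

module _ {P : ℕ → Set} (P? : ∀ i → Dec (P i)) (down : ∀ {i j} → i ≤ j → P j → P i) where

  -- The sum of the indicators of a downward closed predicate is the first index where it fails, or
  -- `n`. `R`, `F`, `selectIn` and `start` below are sums of this kind, each of them a search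
  -- expressed as a count.
  count-sound : ∀ n {i} → i < Σ< n (λ i → χ (P? i)) → i < n × P i
  count-sound (suc n) {i} i< with P? n
  ... | yes p = let i≤n = s≤s⁻¹ (<-≤-trans i< (≤-trans (+-monoˡ-≤ 1 (Σ-bound n λ i → χ≤1 (P? i))) (≤-reflexive (+-comm n 1))))
                in s≤s i≤n , down i≤n p
  ... | no ¬p = let i<n , p = count-sound n (subst (i <_) (+-identityʳ _) i<)
                in m<n⇒m<1+n i<n , p

  count-complete : ∀ n {i} → i < n → P i → i < Σ< n (λ i → χ (P? i))
  count-complete n {i} i<n p = begin-strict
    i                           <⟨ n<1+n i ⟩
    suc i                       ≡⟨ Σ-ones (suc i) (λ j j≤i → χ-yes (P? j) (down (s≤s⁻¹ j≤i) p)) ⟨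
    Σ< (suc i) (λ i → χ (P? i)) ≤⟨ Σ-monoˡ _ i<n ⟩
    Σ< n (λ i → χ (P? i))       ∎
    where open ≤-Reasoning

≤-by : ∀ {m n} → (∀ i → i < m → i < n) → m ≤ n
≤-by {zero}  f = z≤n
≤-by {suc m} f = f m (n<1+n m)

-- Two such counts can be compared through the indices below them, without a recursion on either.
≡-by : ∀ {m n} → (∀ i → i < m → i < n) → (∀ i → i < n → i < m) → m ≡ n
≡-by f g = ≤-antisym (≤-by f) (≤-by g)

-- Fixed-width fields packed into a number

-- Little-endian in base `2 ^ f`. Reducing every digit keeps the bound `pack-<` free of hypotheses.
pack : (width count : ℕ) → (ℕ → ℕ) → ℕ
pack f zero    d = 0
pack f (suc q) d = d 0 %2^ f + 2 ^ f * pack f q (λ i → d (suc i))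

pack-< : ∀ f q d → pack f q d < 2 ^ (q * f)
pack-< f zero    d = s≤s z≤n
pack-< f (suc q) d = begin-strict
  d 0 %2^ f + 2 ^ f * p   <⟨ +-monoˡ-< _ (%2^-< (d 0) f) ⟩
  2 ^ f + 2 ^ f * p         ≡⟨ *-suc (2 ^ f) p ⟨
  2 ^ f * suc p             ≤⟨ *-monoʳ-≤ (2 ^ f) (pack-< f q _) ⟩
  2 ^ f * 2 ^ (q * f)       ≡⟨ ^-distribˡ-+-* 2 f (q * f) ⟨
  2 ^ (f + q * f)           ∎
  where
  open ≤-Reasoning
  p = pack f q (λ i → d (suc i))

pack-digit : ∀ f q d {i} → i < q → pack f q d /2^ (i * f) %2^ f ≡ d i %2^ f
pack-digit f (suc q) d {zero} i< = begin
  (x + 2 ^ f * p) / 1 %2^ f ≡⟨ cong (_%2^ f) (n/1≡n _) ⟩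
  (x + 2 ^ f * p) %2^ f     ≡⟨ cong (λ y → (x + y) %2^ f) (*-comm (2 ^ f) p) ⟩
  (x + p * 2 ^ f) %2^ f     ≡⟨ [m+kn]%n≡m%n x p (2 ^ f) {{m^n≢0 2 f}} ⟩
  x %2^ f                   ≡⟨ m%n%n≡m%n (d 0) (2 ^ f) {{m^n≢0 2 f}} ⟩
  d 0 %2^ f                 ∎
  where
  open ≡-Reasoning
  x = d 0 %2^ f
  p = pack f q (λ i → d (suc i))
pack-digit f (suc q) d {suc i} i< = begin
  (x + 2 ^ f * p) /2^ (f + i * f) %2^ f
    ≡⟨ cong (_%2^ f) (/-congʳ {m = x + 2 ^ f * p} {{m^n≢0 2 (f + i * f)}} {{nz}} (^-distribˡ-+-* 2 f (i * f))) ⟩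
  _/_ (x + 2 ^ f * p) (2 ^ f * 2 ^ (i * f)) {{nz}} %2^ f
    ≡⟨ cong (_%2^ f) (m/n/o≡m/[n*o] (x + 2 ^ f * p) (2 ^ f) (2 ^ (i * f)) {{m^n≢0 2 f}} {{m^n≢0 2 (i * f)}} {{nz}}) ⟨
  (x + 2 ^ f * p) /2^ f /2^ (i * f) %2^ f
    ≡⟨ cong (λ y → y /2^ (i * f) %2^ f) quotient ⟩
  p /2^ (i * f) %2^ f
    ≡⟨ pack-digit f q _ (s≤s⁻¹ i<) ⟩
  d (suc i) %2^ f ∎
  where
  open ≡-Reasoning
  x = d 0 %2^ f
  p = pack f q (λ i → d (suc i))
  nz : NonZero (2 ^ f * 2 ^ (i * f))
  nz = m*n≢0 (2 ^ f) (2 ^ (i * f)) {{m^n≢0 2 f}} {{m^n≢0 2 (i * f)}}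
  quotient : (x + 2 ^ f * p) /2^ f ≡ p
  quotient = begin
    (x + 2 ^ f * p) /2^ f              ≡⟨ cong (λ y → (x + y) /2^ f) (*-comm (2 ^ f) p) ⟩
    (x + p * 2 ^ f) /2^ f              ≡⟨ +-distrib-/-∣ʳ x {{m^n≢0 2 f}} (n∣m*n p) ⟩
    x /2^ f + (p * 2 ^ f) /2^ f        ≡⟨ cong₂ _+_ (m<n⇒m/n≡0 {{m^n≢0 2 f}} (%2^-< (d 0) f)) (m*n/n≡m p (2 ^ f) {{m^n≢0 2 f}}) ⟩
    p                                  ∎

-- Rank and select in short bit strings, the contents of the lookup tables

-- The shift `i * 1` is the offset `i * f` of `pack-digit` for fields of one bit.
popcount : (code o : ℕ) → ℕ
popcount code o = Σ< o (λ i → code /2^ (i * 1) %2^ 1)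

popcount-≤ : ∀ code o → popcount code o ≤ o
popcount-≤ code o = Σ-bound o λ i → s≤s⁻¹ (%2^-< (code /2^ (i * 1)) 1)

popcount-pack : ∀ q d {o} → (∀ i → d i ≤ 1) → o ≤ q → popcount (pack 1 q d) o ≡ Σ< o d
popcount-pack q d {o} d≤1 o≤q = Σ-cong o λ i i< →
  trans (pack-digit 1 q d (<-≤-trans i< o≤q)) (%2^-id 1 (s≤s (d≤1 i)))

-- The position of the one that has `t` ones before it: a position `v` precedes it exactly if the
-- first `v + 1` bits contain at most `t` ones.
selectIn : (width code t : ℕ) → ℕ
selectIn β code t = Σ< β (λ v → χ (popcount code (suc v) ≤? t))

selectIn-≤ : ∀ β code t → selectIn β code t ≤ β
selectIn-≤ β code t = Σ-bound β λ v → χ≤1 (popcount code (suc v) ≤? t)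

-- Elias–Fano access: W is the strictly increasing sequence of positions of
-- the ones of a bit vector, which is cut into blocks of β bits.

module EliasFano (W : ℕ → ℕ) (W-step : ∀ i → W i < W (suc i))
                 (β : ℕ) .{{_ : NonZero β}} (N : ℕ) where

  W-mono : ∀ {i j} → i ≤ j → W i ≤ W j
  W-mono {i} {j} i≤j with m≤n⇒m<n∨m≡n i≤j
  ... | inj₂ refl = ≤-refl
  W-mono {i} {suc j} i≤j | inj₁ i<j = ≤-trans (W-mono (s≤s⁻¹ i<j)) (<⇒≤ (W-step j))

  W-gap : ∀ i k → W i + k ≤ W (i + k)
  W-gap i zero    = ≤-reflexive (trans (+-identityʳ _) (cong W (sym (+-identityʳ i))))
  W-gap i (suc k) = begin
    W i + suc k     ≡⟨ +-suc (W i) k ⟩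
    suc (W i + k)   ≤⟨ s≤s (W-gap i k) ⟩
    suc (W (i + k)) ≤⟨ W-step (i + k) ⟩
    W (suc (i + k)) ≡⟨ cong W (+-suc i k) ⟨
    W (i + suc k)   ∎
    where open ≤-Reasoning

  i≤W : ∀ i → i ≤ W i
  i≤W i = ≤-trans (m≤n+m i (W 0)) (W-gap 0 i)

  -- The number of ones before `p`. The sum may stop at `p`, since `i ≤ W i` excludes all later
  -- indices.
  R : ℕ → ℕ
  R p = Σ< p (λ i → χ (W i <? p))

  R-sound : ∀ {p i} → i < R p → W i < p
  R-sound {p} i< = proj₂ (count-sound (λ i → W i <? p) (λ i≤j → ≤-<-trans (W-mono i≤j)) p i<)

  R-complete : ∀ {p i} → W i < p → i < R p
  R-complete {p} {i} W< =
    count-complete (λ i → W i <? p) (λ i≤j → ≤-<-trans (W-mono i≤j)) p (≤-<-trans (i≤W i) W<) W<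

  R-≤ : ∀ {p i} → p ≤ W i → R p ≤ i
  R-≤ p≤ = ≮⇒≥ λ i< → <⇒≱ (R-sound i<) p≤

  R-≤⁻¹ : ∀ {p i} → R p ≤ i → p ≤ W i
  R-≤⁻¹ R≤ = ≮⇒≥ λ W< → <⇒≱ (R-complete W<) R≤

  R-suc : ∀ p → R (suc p) ≤ suc (R p)
  R-suc p = R-≤ (≤-<-trans (R-≤⁻¹ {p} ≤-refl) (W-step (R p)))

  R-mono : ∀ p → R p ≤ R (suc p)
  R-mono p = R-≤ (≤-trans (n≤1+n p) (R-≤⁻¹ {suc p} ≤-refl))

  bit : ℕ → ℕ
  bit p = R (suc p) ∸ R p

  bit≤1 : ∀ p → bit p ≤ 1
  bit≤1 p = m≤n+o⇒m∸n≤o (R (suc p)) (R p) (≤-trans (R-suc p) (≤-reflexive (+-comm 1 (R p))))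

  Σ-bit : ∀ p v → R p + Σ< v (λ x → bit (p + x)) ≡ R (p + v)
  Σ-bit p zero    = trans (+-identityʳ _) (cong R (sym (+-identityʳ p)))
  Σ-bit p (suc v) = begin
    R p + (Σ< v (λ x → bit (p + x)) + bit (p + v)) ≡⟨ +-assoc (R p) _ _ ⟨
    R p + Σ< v (λ x → bit (p + x)) + bit (p + v)   ≡⟨ cong (_+ bit (p + v)) (Σ-bit p v) ⟩
    R (p + v) + bit (p + v)                        ≡⟨ m+[n∸m]≡n (R-mono (p + v)) ⟩
    R (suc (p + v))                                ≡⟨ cong R (+-suc p v) ⟨
    R (p + suc v)                                  ∎
    where open ≡-Reasoning

  block : ℕ → ℕ
  block i = W i / β

  base : ℕ → ℕ
  base i = block i * β

  bitsFrom : ℕ → ℕ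
  bitsFrom p = pack 1 β (λ x → bit (p + x))

  base≤W : ∀ i → base i ≤ W i
  base≤W i = m/n*n≤m (W i) β

  W∸base<β : ∀ i → W i ∸ base i < β
  W∸base<β i = subst (_< β) (m%n≡m∸m/n*n (W i) β) (m%n<n (W i) β)

  -- The ones before position v of the block number at most t, where i is the
  -- t-th one of the block, exactly if v does not exceed the position of i.
  W-select : ∀ i → W i ≡ base i + selectIn β (bitsFrom (base i)) (i ∸ R (base i))
  W-select i = begin
    W i                                  ≡⟨ m+[n∸m]≡n (base≤W i) ⟨
    base i + (W i ∸ base i)              ≡⟨ cong (base i +_) (≡-by below above) ⟩
    base i + selectIn β (bitsFrom (base i)) (i ∸ R (base i)) ∎
    where
    open ≡-Reasoning
    p = base i
    code = bitsFrom p
    t = i ∸ R p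
    R≤i : R p ≤ i
    R≤i = R-≤ (base≤W i)
    P? : ∀ v → Dec (popcount code (suc v) ≤ t)
    P? v = popcount code (suc v) ≤? t
    down : ∀ {u v} → u ≤ v → popcount code (suc v) ≤ t → popcount code (suc u) ≤ t
    down u≤v = ≤-trans (Σ-monoˡ _ (s≤s u≤v))
    rank : ∀ {v} → v < β → R p + popcount code (suc v) ≡ R (p + suc v)
    rank {v} v<β = trans
      (cong (R p +_) (popcount-pack β _ (λ x → bit≤1 (p + x)) v<β)) (Σ-bit p (suc v))
    below : ∀ v → v < W i ∸ p → v < selectIn β code t
    below v v< = count-complete P? down β v<β (m+n≤o⇒m≤o∸n (popcount code (suc v))
      (≤-trans (≤-reflexive (trans (+-comm _ (R p)) (rank v<β)))
        (R-≤ (≤-trans (+-monoʳ-≤ p v<) (≤-reflexive (m+[n∸m]≡n (base≤W i)))))))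
      where
      v<β = <-trans v< (W∸base<β i)
    above : ∀ v → v < selectIn β code t → v < W i ∸ p
    above v v< =
      let v<β , pop≤ = count-sound P? down β v<
      in m+n≤o⇒m≤o∸n (suc v) (≤-trans (≤-reflexive (+-comm (suc v) p)) (R-≤⁻¹ (≤-trans (≤-reflexive (sym (rank v<β)))
           (≤-trans (+-monoʳ-≤ (R p) pop≤) (≤-reflexive (m+[n∸m]≡n R≤i))))))

  -- Different ones have different positions, so at least `i ∸ R (base i)` positions of the block
  -- precede `W i`. The bound makes this offset a legal column of the table of `selectIn`.
  select-index : ∀ i → i ∸ R (base i) < β
  select-index i = ≤-<-trans (m+n≤o⇒m≤o∸n (i ∸ R p) (begin
    (i ∸ R p) + p         ≤⟨ +-monoʳ-≤ (i ∸ R p) (R-≤⁻¹ {p} ≤-refl) ⟩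
    (i ∸ R p) + W (R p)   ≡⟨ +-comm (i ∸ R p) _ ⟩
    W (R p) + (i ∸ R p)   ≤⟨ W-gap (R p) (i ∸ R p) ⟩
    W (R p + (i ∸ R p))   ≡⟨ cong W (m+[n∸m]≡n (R-≤ (base≤W i))) ⟩
    W i                   ∎)) (W∸base<β i)
    where
    open ≤-Reasoning
    p = base i

  -- Empty blocks are skipped: J i is the number of the block of i among the
  -- non-empty blocks, and F j the first index in the non-empty block j.

  mark : ℕ → ℕ
  mark i = χ (block i <? block (suc i))

  J : ℕ → ℕ
  J i = Σ< i mark

  F : ℕ → ℕ
  F j = Σ< N (λ i → χ (J i <? j))

  marksFrom : ℕ → ℕ
  marksFrom c = pack 1 β (λ x → mark (c * β + x))

  -- One level of blocks suffices for this rank: `J` is stored at the multiples of `β`, and a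
  -- popcount in the table covers the remainder.
  J-rank : ∀ i → J i ≡ J (i / β * β) + popcount (marksFrom (i / β)) (i % β)
  J-rank i = begin
    J i                                                  ≡⟨ cong J (m≡m%n+[m/n]*n i β) ⟩
    J (i % β + i / β * β)                                ≡⟨ cong J (+-comm (i % β) _) ⟩
    J (i / β * β + i % β)                                ≡⟨ Σ-+ (i / β * β) (i % β) mark ⟩
    J (i / β * β) + Σ< (i % β) (λ x → mark (i / β * β + x))
      ≡⟨ cong (J (i / β * β) +_) (popcount-pack β _ (λ x → χ≤1 (block _ <? _)) (<⇒≤ (m%n<n i β))) ⟨
    J (i / β * β) + popcount (marksFrom (i / β)) (i % β) ∎
    where open ≡-Reasoning

  block-step : ∀ i → block i ≤ block (suc i)
  block-step i = /-monoˡ-≤ β (<⇒≤ (W-step i))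

  -- Every mark is a strict increase of `block`. This bounds the length of the arrays that are
  -- indexed by non-empty blocks.
  J≤block : ∀ i → J i ≤ block i
  J≤block zero = z≤n
  J≤block (suc i) with block i <? block (suc i)
  ... | yes b< = ≤-trans (≤-reflexive (+-comm (J i) 1)) (≤-trans (s≤s (J≤block i)) b<)
  ... | no _   = ≤-trans (≤-reflexive (+-identityʳ (J i))) (≤-trans (J≤block i) (block-step i))

  block-constant : ∀ k i → k ≤ i → J k ≡ J i → block k ≡ block i
  block-constant k i k≤i Jk≡ with m≤n⇒m<n∨m≡n k≤i
  ... | inj₂ refl = refl
  block-constant k (suc i) k≤i Jk≡ | inj₁ k<i =
    trans (block-constant k i (s≤s⁻¹ k<i) (trans Jk≡ Ji≡))
          (≤-antisym (block-step i) (≮⇒≥ (χ-zero (block i <? block (suc i)) unmarked)))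
    where
    Jk≤ : J k ≤ J i
    Jk≤ = Σ-monoˡ mark (s≤s⁻¹ k<i)
    unmarked : mark i ≡ 0
    unmarked = n≤0⇒n≡0 (+-cancelˡ-≤ (J i) (mark i) 0
      (≤-trans (≤-reflexive (sym Jk≡)) (≤-trans Jk≤ (≤-reflexive (sym (+-identityʳ (J i)))))))
    Ji≡ : J (suc i) ≡ J i
    Ji≡ = trans (cong (J i +_) unmarked) (+-identityʳ (J i))

  -- Indices with equal `J` share their block, in particular `i` and the first index with the value
  -- `J i`. What is stored for a block depends on an index only through `base`, so it may be
  -- computed at `F j`.
  block-first : ∀ i → i < N → block (F (J i)) ≡ block i
  block-first i i<N = block-constant k i k≤i
    (≤-antisym (Σ-monoˡ mark k≤i) (≮⇒≥ λ Jk< →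
      n≮n k (count-complete P? down N (≤-<-trans k≤i i<N) Jk<)))
    where
    k = F (J i)
    P? : ∀ x → Dec (J x < J i)
    P? x = J x <? J i
    down : ∀ {x y} → x ≤ y → J y < J i → J x < J i
    down x≤y = ≤-<-trans (Σ-monoˡ mark x≤y)
    k≤i : k ≤ i
    k≤i = ≮⇒≥ λ i< → n≮n (J i) (proj₂ (count-sound P? down N i<))

  base-first : ∀ i → i < N → base (F (J i)) ≡ base i
  base-first i i<N = cong (_* β) (block-first i i<N)

-- Rank on a bit vector B whose runs of ones begin at the positions in Start

module RunRank {B Start : ℕ → Set} (B? : ∀ x → Dec (B x)) (Start? : ∀ x → Dec (Start x))
               (continue : ∀ x → B (suc x) → ¬ Start (suc x) → B x) (U : ℕ) where

  rank : ℕ → ℕ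
  rank x = Σ< x (λ z → χ (B? z))

  starts : ℕ → ℕ
  starts x = Σ< x (λ z → χ (Start? z))

  starts-mono : ∀ {x y} → x ≤ y → starts x ≤ starts y
  starts-mono = Σ-monoˡ _

  rank-mono : ∀ {x y} → x ≤ y → rank x ≤ rank y
  rank-mono = Σ-monoˡ _

  -- The k-th start, counted from 1, or U if there are fewer; 0 for k = 0.
  start : ℕ → ℕ
  start k = Σ< U (λ x → χ (starts (suc x) <? k))

  start-sound : ∀ {k x} → x < start k → x < U × starts (suc x) < k
  start-sound {k} = count-sound (λ x → starts (suc x) <? k)
                      (λ x≤y → ≤-<-trans (starts-mono (s≤s x≤y))) U

  start-complete : ∀ {k x} → x < U → starts (suc x) < k → x < start k
  start-complete {k} = count-complete (λ x → starts (suc x) <? k)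
                         (λ x≤y → ≤-<-trans (starts-mono (s≤s x≤y))) U

  start-≤ : ∀ k → start k ≤ U
  start-≤ k = ≤-by λ x x< → proj₁ (start-sound x<)

  start-mono : ∀ {k l} → k ≤ l → start k ≤ start l
  start-mono k≤l = ≤-by λ x x< →
    let x<U , s< = start-sound x< in start-complete x<U (<-≤-trans s< k≤l)

  start-zero : start 0 ≡ 0
  start-zero = n≤0⇒n≡0 (≤-by λ x x< → ⊥-elim (n≮0 (proj₂ (start-sound x<))))

  -- With `start<⇐` this is an adjunction between `start` and `starts`: comparing `x` with a start
  -- tells on which side of `starts x` an index lies, which is what the binary search needs. Starts
  -- are cut off at `U`, hence the bound on `x`.
  start<⇒ : ∀ {k x} → x ≤ U → start (suc k) < x → k < starts x
  start<⇒ {k} {x} x≤U start< = ≰⇒> λ s≤k → <⇒≱ start<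
    (≤-by λ y y< → start-complete (<-≤-trans y< x≤U) (s≤s (≤-trans (starts-mono y<) s≤k)))

  start<⇐ : ∀ {k x} → k < starts x → start (suc k) < x
  start<⇐ {k} {suc x} k< = ≰⇒> λ x< →
    <⇒≱ k< (s≤s⁻¹ (proj₂ (start-sound {suc k} x<)))

  start-starts : ∀ x → start (starts x) ≤ x
  start-starts x = ≤-by λ y y< → ≰⇒> λ x≤y →
    <⇒≱ (proj₂ (start-sound y<)) (starts-mono (m≤n⇒m≤1+n x≤y))

  start-next : ∀ {x} → x ≤ U → x ≤ start (suc (starts x))
  start-next {x} x≤U = ≤-by λ y y< →
    start-complete (<-≤-trans y< x≤U) (s≤s (starts-mono y<))

  no-start : ∀ {x} → starts (suc x) ≤ starts x → ¬ Start x
  no-start {x} s≤ = χ-zero (Start? x) (n≤0⇒n≡0 (+-cancelˡ-≤ (starts x) _ 0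
    (≤-trans s≤ (≤-reflexive (sym (+-identityʳ (starts x)))))))

  -- Between two consecutive starts, B is a block of ones followed by zeros.
  rank-formula : ∀ {x} → x ≤ U → let k = starts x in
                 rank x ≡ rank (start (suc k)) ⊓ (rank (start k) + (x ∸ start k))
  rank-formula {zero}  x≤U = sym (n≤0⇒n≡0 (≤-trans (m⊓n≤n _ (rank (start 0) + (0 ∸ start 0)))
    (≤-reflexive (trans (cong (λ y → rank y + (0 ∸ y)) start-zero) refl))))
  rank-formula {suc y} x≤U with B? y in By
  ... | yes b = begin
    rank y + 1                         ≡⟨ cong (λ d → rank y + χ d) By ⟨
    rank x                             ≡⟨ linear ⟩
    rank p + (x ∸ p)                   ≡⟨ m≥n⇒m⊓n≡n (≤-trans (≤-reflexive (sym linear)) (rank-mono (start-next x≤U))) ⟨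
    rank (start (suc k)) ⊓ (rank p + (x ∸ p)) ∎
    where
    open ≡-Reasoning
    x = suc y
    k = starts x
    p = start k
    -- Downwards from `y`: no position after `p` up to `y` is a start, so the one at `y` propagates
    -- back as far as `p`.
    ones : ∀ j → p ≤ y ∸ j → B (y ∸ j)
    ones zero    p≤ = b
    ones (suc j) p≤ with y ∸ j in y∸j
    -- Truncated subtraction is stuck at 0, so the position does not change.
    ... | zero  = subst B lem (ones j (≤-trans p≤ (∸-monoʳ-≤ y (n≤1+n j))))
      where
      lem : y ∸ j ≡ y ∸ suc j
      lem = trans y∸j (sym (m≤n⇒m∸n≡0 (≤-trans (m∸n≡0⇒m≤n y∸j) (n≤1+n j))))
    ... | suc z = subst B (sym z≡) (continue z (subst B y∸j (ones j p≤′))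
                    (no-start (≤-trans (starts-mono (s≤s sz≤y)) k≤)))
      where
      z≡ : y ∸ suc j ≡ z
      z≡ = trans (sym (pred[m∸n]≡m∸[1+n] y j)) (cong pred y∸j)
      p≤z : p ≤ z
      p≤z = subst (p ≤_) z≡ p≤
      p≤′ : p ≤ y ∸ j
      p≤′ = ≤-trans p≤z (≤-trans (n≤1+n z) (≤-reflexive (sym y∸j)))
      sz≤y : suc z ≤ y
      sz≤y = ≤-trans (≤-reflexive (sym y∸j)) (m∸n≤m y j)
      k≤ : k ≤ starts (suc z)
      k≤ = ≮⇒≥ λ s< → <⇒≱ (start-complete (<-≤-trans sz≤y (≤-trans (n≤1+n y) x≤U)) s<) p≤z
    linear : rank x ≡ rank p + (x ∸ p)
    linear = begin
      rank x               ≡⟨ cong rank (m+[n∸m]≡n (start-starts x)) ⟨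
      rank (p + (x ∸ p))   ≡⟨ Σ-+ p (x ∸ p) _ ⟩
      rank p + Σ< (x ∸ p) (λ i → χ (B? (p + i))) ≡⟨ cong (rank p +_) (Σ-ones (x ∸ p) λ i i< → χ-yes (B? (p + i)) (one i i<)) ⟩
      rank p + (x ∸ p)     ∎
      where
      one : ∀ i → i < x ∸ p → B (p + i)
      one i i< = subst B (m∸[m∸n]≡n p+i≤y) (ones (y ∸ (p + i)) (≤-trans (m≤m+n p i) (≤-reflexive (sym (m∸[m∸n]≡n p+i≤y)))))
        where
        p+i≤y : p + i ≤ y
        p+i≤y = s≤s⁻¹ (≤-trans (≤-reflexive (sym (+-suc p i))) (≤-trans (+-monoʳ-≤ p i<) (≤-reflexive (m+[n∸m]≡n (start-starts x)))))
  ... | no ¬b = begin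
    rank y + 0                                ≡⟨ cong (λ d → rank y + χ d) By ⟨
    rank x                                    ≡⟨ constant ⟨
    rank (start (suc k))                      ≡⟨ m≤n⇒m⊓n≡m (≤-trans (≤-reflexive constant) lipschitz) ⟨
    rank (start (suc k)) ⊓ (rank p + (x ∸ p)) ∎
    where
    open ≡-Reasoning
    x = suc y
    k = starts x
    p = start k
    q = start (suc k)
    zeros : ∀ i → y + i < q → ¬ B (y + i)
    zeros zero    _ = subst (λ z → ¬ B z) (sym (+-identityʳ y)) ¬b
    zeros (suc i) i<q Bz = zeros i (<-trans (n<1+n (y + i)) si<q)
      (continue (y + i) (subst B (+-suc y i) Bz)
        (no-start (≤-trans (s≤s⁻¹ (proj₂ (start-sound {suc k} si<q))) (starts-mono (s≤s (m≤m+n y i))))))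
      where
      si<q : suc (y + i) < q
      si<q = subst (_< q) (+-suc y i) i<q
    constant : rank q ≡ rank x
    constant = begin
      rank q             ≡⟨ cong rank (m+[n∸m]≡n (start-next x≤U)) ⟨
      rank (x + (q ∸ x)) ≡⟨ Σ-+ x (q ∸ x) _ ⟩
      rank x + Σ< (q ∸ x) (λ i → χ (B? (x + i))) ≡⟨ cong (rank x +_) (Σ-zeros (q ∸ x) λ i i< → χ-no (B? (x + i)) (zero′ i i<)) ⟩
      rank x + 0         ≡⟨ +-identityʳ _ ⟩
      rank x             ∎
      where
      zero′ : ∀ i → i < q ∸ x → ¬ B (x + i)
      zero′ i i< = subst (λ z → ¬ B z) (+-suc y i) (zeros (suc i)
        (≤-trans (≤-reflexive (trans (cong suc (+-suc y i)) (sym (+-suc x i)))) (≤-trans (+-monoʳ-≤ x i<) (≤-reflexive (m+[n∸m]≡n (start-next x≤U))))))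
    -- The rank grows by at most one per position, which makes the first argument of the minimum the
    -- smaller one.
    lipschitz : rank x ≤ rank p + (x ∸ p)
    lipschitz = ≤-trans (≤-reflexive (trans (cong rank (sym (m+[n∸m]≡n (start-starts x)))) (Σ-+ p (x ∸ p) _)))
      (+-monoʳ-≤ (rank p) (Σ-bound (x ∸ p) λ i → χ≤1 (B? (p + i))))

-- The rows of the bit vector of length σ n are the indicators of the
-- characters in L; a run of L starts at i in row a if RowStart L a i.

RowStart : (ℕ → ℕ) → ℕ → ℕ → Set
RowStart L a zero    = L 0 ≡ a
RowStart L a (suc i) = L (suc i) ≡ a × L i ≢ a

rowStart? : ∀ L a i → Dec (RowStart L a i)
rowStart? L a zero    = L 0 ≟ a
rowStart? L a (suc i) = L (suc i) ≟ a ×-dec ¬? (L i ≟ a)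

row-% : ∀ {n i} a .{{_ : NonZero n}} → i < n → (a * n + i) % n ≡ i
row-% {n} {i} a i<n = trans (cong (_% n) (+-comm (a * n) i)) (trans ([m+kn]%n≡m%n i a n) (m<n⇒m%n≡m i<n))

row-/ : ∀ {n i} a .{{_ : NonZero n}} → i < n → (a * n + i) / n ≡ a
row-/ {n} {i} a i<n = trans (+-distrib-/-∣ˡ i (divides-refl a))
  (trans (cong₂ _+_ (m*n/n≡m a n) (m<n⇒m/n≡0 i<n)) (+-identityʳ a))
  where open import Data.Nat.Divisibility using (divides-refl)

module Rows (L : ℕ → ℕ) (n : ℕ) .{{_ : NonZero n}} where

  B : ℕ → Set
  B x = L (x % n) ≡ x / n

  B? : ∀ x → Dec (B x)
  B? x = L (x % n) ≟ x / n

  Start : ℕ → Set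
  Start x = RowStart L (x / n) (x % n)

  Start? : ∀ x → Dec (Start x)
  Start? x = rowStart? L (x / n) (x % n)

  pred-row : ∀ {x i} → suc x % n ≡ suc i → x % n ≡ i × x / n ≡ suc x / n
  pred-row {x} {i} x% = trans (cong (_% n) x≡) (row-% q i<n) , trans (cong (_/ n) x≡) (row-/ q i<n)
    where
    q = suc x / n
    i<n : i < n
    i<n = <-trans (n<1+n i) (subst (_< n) x% (m%n<n (suc x) n))
    x≡ : x ≡ q * n + i
    x≡ = trans (suc-injective (trans (m≡m%n+[m/n]*n (suc x) n) (cong (_+ q * n) x%))) (+-comm i _)

  -- In column 0 every one counts as a start, even if the preceding row ends in a one. So runs of
  -- different rows never merge, and row `a` has exactly the runs of `a` in the BWT.
  continue : ∀ x → B (suc x) → ¬ Start (suc x) → B x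
  continue x Bx ¬start with suc x % n in x%
  ... | zero  = ⊥-elim (¬start Bx)
  ... | suc i = let i≡ , q≡ = pred-row x% in
    trans (cong L i≡) (trans (decidable-stable (L i ≟ suc x / n) λ ≢ → ¬start (Bx , ≢)) (sym q≡))

  starts-row : ∀ a → Σ< (suc a * n) (λ x → χ (Start? x))
                   ≡ Σ< (a * n) (λ x → χ (Start? x)) + Σ< n (λ i → χ (rowStart? L a i))
  starts-row a = trans (cong (λ m → Σ< m (λ x → χ (Start? x))) (+-comm n (a * n)))
    (trans (Σ-+ (a * n) n _) (cong (Σ< (a * n) (λ x → χ (Start? x)) +_) (Σ-cong n λ i i<n →
      cong₂ (λ b j → χ (rowStart? L b j)) (row-/ a i<n) (row-% a i<n))))

-- Out of range positions read as 0.
at : ∀ {σ} → List (Fin σ) → ℕ → ℕ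
at []       i       = 0
at (x ∷ xs) zero    = toℕ x
at (x ∷ xs) (suc i) = at xs i

-- Run starts in a row against the list of runs

Σ-front : ∀ n f → Σ< (suc n) f ≡ f 0 + Σ< n (λ i → f (suc i))
Σ-front n f = Σ-+ 1 n f

countRuns : ∀ {σ} → ℕ → List (Run σ) → ℕ
countRuns c []             = 0
countRuns c ((x , _) ∷ rs) = χ (toℕ x ≟ c) + countRuns c rs

countRuns-filter : ∀ {σ} (a : Fin σ) rs →
  countRuns (toℕ a) rs ≡ length (filter (λ b → proj₁ b Fin.≟ a) rs)
countRuns-filter a [] = refl
countRuns-filter a ((x , k) ∷ rs) with x Fin.≟ a
... | yes refl = cong₂ _+_ (χ-yes (toℕ x ≟ toℕ a) refl) (countRuns-filter a rs)
... | no x≢a   = cong₂ _+_ (χ-no (toℕ x ≟ toℕ a) λ e → x≢a (Fin.toℕ-injective e)) (countRuns-filter a rs)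

runs-head : ∀ {σ} (y : Fin σ) ys → ∃[ k ] ∃[ rs ] runs (y ∷ ys) ≡ (y , k) ∷ rs
runs-head y ys with runs ys
... | [] = _ , _ , refl
... | (z , k) ∷ rs with y Fin.≟ z
...   | yes refl = _ , _ , refl
...   | no _     = _ , _ , refl

-- Position 0 always counts as a start if its character is `c`. Prepending `x` turns it into
-- position 1, where its start survives exactly if `x` differs from `y`, just as `extend` opens a
-- new run.
count-runs : ∀ {σ} c (xs : List (Fin σ)) →
  Σ< (length xs) (λ i → χ (rowStart? (at xs) c i)) ≡ countRuns c (runs xs)
count-runs c [] = refl
count-runs c (x ∷ []) = +-comm 0 _
count-runs {σ} c (x ∷ y ∷ ys) = begin
  Σ< (2 + length ys) f                                  ≡⟨ Σ-front (1 + length ys) f ⟩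
  f 0 + Σ< (1 + length ys) (λ i → f (suc i))            ≡⟨ cong (f 0 +_) (Σ-front (length ys) _) ⟩
  f 0 + (f 1 + rest)                                    ≡⟨ step k rs (trans (sym (Σ-front (length ys) _)) (trans (count-runs c (y ∷ ys)) (cong (countRuns c) runs≡))) ⟩
  countRuns c (extend x ((y , k) ∷ rs))                 ≡⟨ cong (λ l → countRuns c (extend x l)) runs≡ ⟨
  countRuns c (runs (x ∷ y ∷ ys))                       ∎
  where
  open ≡-Reasoning
  f : ℕ → ℕ
  f i = χ (rowStart? (at (x ∷ y ∷ ys)) c i)
  rest = Σ< (length ys) (λ i → f (2 + i))
  k = proj₁ (runs-head y ys)
  rs = proj₁ (proj₂ (runs-head y ys))
  runs≡ = proj₂ (proj₂ (runs-head y ys))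
  step : ∀ k rs → χ (toℕ y ≟ c) + rest ≡ countRuns c ((y , k) ∷ rs) →
         f 0 + (f 1 + rest) ≡ countRuns c (extend x ((y , k) ∷ rs))
  step k rs ih with x Fin.≟ y
  ... | no x≢y = cong (f 0 +_) (trans (cong (_+ rest) (χ-cong (rowStart? (at (x ∷ y ∷ ys)) c 1) (toℕ y ≟ c) proj₁
                   λ y≡c → y≡c , λ x≡c → x≢y (Fin.toℕ-injective (trans x≡c (sym y≡c))))) ih)
  ... | yes refl = trans (sym (+-assoc (f 0) (f 1) rest))
                     (trans (cong (_+ rest) (trans (cong (f 0 +_) (χ-no (rowStart? (at (x ∷ y ∷ ys)) c 1) λ (e , ne) → ne e)) (+-identityʳ (f 0)))) ih)

Σ-countRuns : ∀ {σ} m (rs : List (Run σ)) → Σ< m (λ c → countRuns c rs) ≤ length rs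
Σ-countRuns m [] = ≤-reflexive (Σ-zeros m λ _ _ → refl)
Σ-countRuns m ((x , k) ∷ rs) = begin
  Σ< m (λ c → χ (toℕ x ≟ c) + countRuns c rs)             ≡⟨ Σ-add m _ _ ⟩
  Σ< m (λ c → χ (toℕ x ≟ c)) + Σ< m (λ c → countRuns c rs) ≤⟨ +-mono-≤ (≤-trans (≤-reflexive (single m)) (χ≤1 (toℕ x <? m))) (Σ-countRuns m rs) ⟩
  suc (length rs)                                         ∎
  where
  open ≤-Reasoning
  Σ-add : ∀ m f g → Σ< m (λ c → f c + g c) ≡ Σ< m f + Σ< m g
  Σ-add zero    f g = refl
  Σ-add (suc m) f g = trans (cong (_+ (f m + g m)) (Σ-add m f g)) (+-interchange (Σ< m f) (Σ< m g) (f m) (g m))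
    where open import Algebra.Properties.CommutativeSemigroup +-commutativeSemigroup renaming (interchange to +-interchange)
  single : ∀ m → Σ< m (λ c → χ (toℕ x ≟ c)) ≡ χ (toℕ x <? m)
  single zero = refl
  single (suc m) with toℕ x ≟ m
  ... | yes refl = trans (cong (_+ 1) (trans (single m) (χ-no (toℕ x <? toℕ x) (n≮n _)))) (sym (χ-yes (toℕ x <? suc (toℕ x)) (n<1+n _)))
  ... | no x≢m   = trans (+-identityʳ _) (trans (single m) (χ-cong (toℕ x <? m) (toℕ x <? suc m) m<n⇒m<1+n (λ x< → ≤∧≢⇒< (s≤s⁻¹ x<) x≢m)))

length-runs : ∀ {σ} (xs : List (Fin σ)) → length (runs xs) ≤ length xs
length-runs [] = z≤n
length-runs (x ∷ xs) with runs xs | length-runs xs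
... | []          | ih = s≤s z≤n
... | (y , k) ∷ rs | ih with does (x Fin.≟ y)
...   | true  = m≤n⇒m≤1+n ih
...   | false = s≤s ih

-- Cyclic successor of text positions, and suffixes as lists

cyclicSucc : ∀ {n} → Fin n → Fin n
cyclicSucc {suc n} p with view p
... | ‵fromℕ     = zero
... | ‵inject₁ i = suc i

cyclicPred∘cyclicSucc : ∀ {n} (p : Fin n) → cyclicPred (cyclicSucc p) ≡ p
cyclicPred∘cyclicSucc {suc n} p with view p
... | ‵fromℕ     = refl
... | ‵inject₁ i = refl

cyclicSucc∘cyclicPred : ∀ {n} (p : Fin n) → cyclicSucc (cyclicPred p) ≡ p
cyclicSucc∘cyclicPred {suc n} zero    rewrite view-fromℕ n = refl
cyclicSucc∘cyclicPred {suc n} (suc i) rewrite view-inject₁ i = refl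

drop-lookup : ∀ {A : Set} {n} (xs : Vec A n) p →
              drop (toℕ p) (toList xs) ≡ lookup xs p ∷ drop (suc (toℕ p)) (toList xs)
drop-lookup (x ∷ xs) zero    = refl
drop-lookup (x ∷ xs) (suc p) = drop-lookup xs p

drop-all : ∀ {A : Set} {n} (xs : Vec A n) → drop n (toList xs) ≡ []
drop-all []       = refl
drop-all (x ∷ xs) = drop-all xs

toList-single : ∀ {A : Set} {m} (xs : Vec A (suc m)) → m ≡ 0 → toList xs ≡ lookup xs zero ∷ []
toList-single (x ∷ []) refl = refl

at-lookup : ∀ {σ n} (xs : Vec (Fin σ) n) i → at (toList xs) (toℕ i) ≡ toℕ (lookup xs i)
at-lookup (x ∷ xs) zero    = refl
at-lookup (x ∷ xs) (suc i) = at-lookup xs i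

-- If key is strictly increasing and its values are the ones of B, then
-- key j < x holds for exactly the first rank x indices j.
module RankOfKey {n} (key : Fin n → ℕ) (key-mono : ∀ {i j} → i Fin.< j → key i < key j)
                 {B : ℕ → Set} (B? : ∀ x → Dec (B x))
                 (B⇒key : ∀ x → B x → ∃[ j ] key j ≡ x) (key⇒B : ∀ j → B (key j)) where

  rank : ℕ → ℕ
  rank x = Σ< x (λ z → χ (B? z))

  key-mono⁻¹ : ∀ {i j} → key i < key j → i Fin.< j
  key-mono⁻¹ {i} {j} k< with Fin.<-cmp i j
  ... | tri< i<j _ _  = i<j
  ... | tri≈ _ refl _ = ⊥-elim (n≮n _ k<)
  ... | tri> _ _ i>j  = ⊥-elim (<-asym k< (key-mono i>j))

  Threshold : ℕ → ℕ → Set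
  Threshold x y = y ≤ n × (∀ j → toℕ j < y → key j < x) × (∀ j → key j < x → toℕ j < y)

  rank-threshold : ∀ x → Threshold x (rank x)
  rank-threshold zero = z≤n , (λ _ ()) , λ _ ()
  rank-threshold (suc x) with B? x | rank-threshold x
  ... | no ¬b | ≤n , to , from =
    subst (Threshold (suc x)) (sym (+-identityʳ (rank x)))
      (≤n , (λ j j< → m<n⇒m<1+n (to j j<)) ,
       λ j k< → from j (≤∧≢⇒< (s≤s⁻¹ k<) λ k≡ → ¬b (subst B k≡ (key⇒B j))))
  ... | yes b | ≤n , to , from = subst (Threshold (suc x)) (+-comm 1 (rank x))
      ( subst (_< n) (sym rank≡) (Fin.toℕ<n j₀)
      , (λ j j≤ → s≤s (sound j (subst (toℕ j ≤_) rank≡ (s≤s⁻¹ j≤))))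
      , λ j k≤ → s≤s (subst (toℕ j ≤_) (sym rank≡) (complete j (s≤s⁻¹ k≤))))
    where
    j₀ = proj₁ (B⇒key x b)
    key≡ = proj₂ (B⇒key x b)
    -- The keys below `key j₀` are those of the indices below `j₀`, so the one at `x` raises the
    -- threshold from `toℕ j₀` to its successor.
    rank≡ : rank x ≡ toℕ j₀
    rank≡ = ≡-by
      (λ i i< → let i<n = <-≤-trans i< ≤n
                    k< = to (fromℕ< i<n) (subst (_< rank x) (sym (Fin.toℕ-fromℕ< i<n)) i<)
                in subst (_< toℕ j₀) (Fin.toℕ-fromℕ< i<n) (key-mono⁻¹ (subst (key (fromℕ< i<n) <_) (sym key≡) k<)))
      (λ i i< → let i<n = <-trans i< (Fin.toℕ<n j₀)
                    j< = subst (_< toℕ j₀) (sym (Fin.toℕ-fromℕ< i<n)) i<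
                in subst (_< rank x) (Fin.toℕ-fromℕ< i<n) (from (fromℕ< i<n) (subst (key (fromℕ< i<n) <_) key≡ (key-mono j<))))
    sound : ∀ j → toℕ j ≤ toℕ j₀ → key j ≤ x
    sound j j≤ = ≮⇒≥ λ x< → <⇒≱ (key-mono⁻¹ (subst (_< key j) (sym key≡) x<)) j≤
    complete : ∀ j → key j ≤ x → toℕ j ≤ toℕ j₀
    complete j k≤ = ≮⇒≥ λ j₀< → <⇒≱ (key-mono j₀<) (subst (key j ≤_) (sym key≡) k≤)

-- Backward search as a pair of ranks

module BackwardSearch {σ m : ℕ} (T : Vec (Fin σ) (suc m)) (term : Terminated T)
                      (SA : Permutation′ (suc m)) (isSA : IsSuffixArray T SA) where

  n : ℕ
  n = suc m

  last : Fin n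
  last = proj₁ term

  last≡ : last ≡ fromℕ m
  last≡ = Fin.toℕ-injective (trans (suc-injective (proj₁ (proj₂ term))) (sym (Fin.toℕ-fromℕ m)))

  $ : Fin σ
  $ = lookup T last

  $-unique : ∀ {p} → lookup T p ≡ $ → p ≡ last
  $-unique {p} Tp≡ with p Fin.≟ last
  ... | yes p≡ = p≡
  ... | no  p≢ = ⊥-elim (n≮n _ (subst (toℕ $ <_) (cong toℕ Tp≡) (proj₂ (proj₂ term) p p≢)))

  rest : Fin n → List (Fin σ)
  rest p = drop (suc (toℕ p)) (toList T)

  rest-last : rest last ≡ []
  rest-last = trans (cong (λ k → drop k (toList T)) (proj₁ (proj₂ term))) (drop-all T)

  rest-suffix : ∀ {p} → p ≢ last → rest p ≡ suffix T (cyclicSucc p)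
  rest-suffix {p} p≢ with view p
  ... | ‵fromℕ     = ⊥-elim (p≢ (sym last≡))
  ... | ‵inject₁ i = cong (λ k → drop (suc k) (toList T)) (Fin.toℕ-inject₁ i)

  char : Fin n → Fin σ
  char j = lookup T (SA ⟨$⟩ʳ j)

  -- The suffix at position Ψ j of the suffix array starts one character after
  -- the one at j, cyclically.
  Ψ : Fin n → Fin n
  Ψ j = SA ⟨$⟩ˡ cyclicSucc (SA ⟨$⟩ʳ j)

  SA-Ψ : ∀ j → SA ⟨$⟩ʳ Ψ j ≡ cyclicSucc (SA ⟨$⟩ʳ j)
  SA-Ψ j = inverseʳ SA

  -- A suffix is ordered by its first character and then by the rank of what follows it. Read as a
  -- two-digit number in base `n`, this pair is a position in the concatenated rows.
  key : Fin n → ℕ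
  key j = toℕ (char j) * n + toℕ (Ψ j)

  SA-injective : ∀ {i j} → SA ⟨$⟩ʳ i ≡ SA ⟨$⟩ʳ j → i ≡ j
  SA-injective e = trans (sym (inverseˡ SA)) (trans (cong (SA ⟨$⟩ˡ_) e) (inverseˡ SA))

  cyclicSucc-injective : ∀ {p q : Fin n} → cyclicSucc p ≡ cyclicSucc q → p ≡ q
  cyclicSucc-injective e =
    trans (sym (cyclicPred∘cyclicSucc _)) (trans (cong cyclicPred e) (cyclicPred∘cyclicSucc _))

  Ψ-injective : ∀ {i j} → Ψ i ≡ Ψ j → i ≡ j
  Ψ-injective {i} {j} e = SA-injective (cyclicSucc-injective
    (trans (sym (SA-Ψ i)) (trans (cong (SA ⟨$⟩ʳ_) e) (SA-Ψ j))))

  Lex-asym : ∀ {xs ys : List (Fin σ)} → Lex-< _≡_ Fin._<_ xs ys → ¬ Lex-< _≡_ Fin._<_ ys xs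
  Lex-asym = <-asymmetric sym (resp₂ Fin._<_) <-asym

  -- If the first characters agree, they are not the terminator, which occurs only once. So neither
  -- suffix is the last one, `Ψ` does not wrap around, and the two remainders are suffixes that are
  -- ordered by their ranks.
  key-mono : ∀ {i j} → i Fin.< j → key i < key j
  key-mono {i} {j} i<j with subst₂ (Lex-< _≡_ Fin._<_) (drop-lookup T (SA ⟨$⟩ʳ i)) (drop-lookup T (SA ⟨$⟩ʳ j)) (isSA i j i<j)
  ... | this x<y = begin-strict
    key i                            <⟨ +-monoʳ-< (toℕ (char i) * n) (Fin.toℕ<n (Ψ i)) ⟩
    toℕ (char i) * n + n             ≡⟨ +-comm (toℕ (char i) * n) n ⟩
    suc (toℕ (char i)) * n           ≤⟨ *-monoˡ-≤ n x<y ⟩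
    toℕ (char j) * n                 ≤⟨ m≤m+n _ _ ⟩
    key j                            ∎
    where open ≤-Reasoning
  ... | next x≡y lex = subst (λ c → toℕ c * n + toℕ (Ψ i) < key j) (sym x≡y) (+-monoʳ-< (toℕ (char j) * n) next<)
    where
    i≢j : i ≢ j
    i≢j e = n≮n _ (subst (Fin._< j) e i<j)
    SAi≢ : SA ⟨$⟩ʳ i ≢ last
    SAi≢ e = i≢j (SA-injective (trans e (sym ($-unique (trans (sym x≡y) (cong (lookup T) e))))))
    SAj≢ : SA ⟨$⟩ʳ j ≢ last
    SAj≢ e = i≢j (SA-injective (trans ($-unique (trans x≡y (cong (lookup T) e))) (sym e)))
    suffix≡ : ∀ k → SA ⟨$⟩ʳ k ≢ last → rest (SA ⟨$⟩ʳ k) ≡ suffix T (SA ⟨$⟩ʳ Ψ k)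
    suffix≡ k k≢ = trans (rest-suffix k≢) (cong (suffix T) (sym (SA-Ψ k)))
    next< : Ψ i Fin.< Ψ j
    next< with Fin.<-cmp (Ψ i) (Ψ j)
    ... | tri< <-case _ _ = <-case
    ... | tri≈ _ e _  = ⊥-elim (i≢j (Ψ-injective e))
    ... | tri> _ _ >-case = ⊥-elim (Lex-asym (isSA _ _ >-case)
                          (subst₂ (Lex-< _≡_ Fin._<_) (suffix≡ i SAi≢) (suffix≡ j SAj≢) lex))

  L : ℕ → ℕ
  L = at (toList (bwt T SA))

  L-char : ∀ i → L (toℕ i) ≡ toℕ (lookup T (cyclicPred (SA ⟨$⟩ʳ i)))
  L-char i = trans (at-lookup (bwt T SA) i) (cong toℕ (lookup∘tabulate (λ k → lookup T (cyclicPred (SA ⟨$⟩ʳ k))) i))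

  open Rows L n public

  key⇒B : ∀ j → B (key j)
  key⇒B j = begin
    L (key j % n)                                      ≡⟨ cong L (row-% (toℕ (char j)) (Fin.toℕ<n (Ψ j))) ⟩
    L (toℕ (Ψ j))                                  ≡⟨ L-char (Ψ j) ⟩
    toℕ (lookup T (cyclicPred (SA ⟨$⟩ʳ Ψ j)))      ≡⟨ cong (λ p → toℕ (lookup T (cyclicPred p))) (SA-Ψ j) ⟩
    toℕ (lookup T (cyclicPred (cyclicSucc (SA ⟨$⟩ʳ j)))) ≡⟨ cong (λ p → toℕ (lookup T p)) (cyclicPred∘cyclicSucc _) ⟩
    toℕ (char j)                                       ≡⟨ row-/ (toℕ (char j)) (Fin.toℕ<n (Ψ j)) ⟨
    key j / n                                          ∎
    where open ≡-Reasoning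

  -- The witness is the LF mapping: from the suffix of rank `x % n` one step back in the text.
  B⇒key : ∀ x → B x → ∃[ j ] key j ≡ x
  B⇒key x Bx = j , (begin
    toℕ (char j) * n + toℕ (Ψ j)  ≡⟨ cong₂ (λ c k → c * n + k) char≡ next≡ ⟩
    x / n * n + x % n                 ≡⟨ +-comm (x / n * n) _ ⟩
    x % n + x / n * n                 ≡⟨ m≡m%n+[m/n]*n x n ⟨
    x                                 ∎)
    where
    open ≡-Reasoning
    i = fromℕ< (m%n<n x n)
    i≡ : toℕ i ≡ x % n
    i≡ = Fin.toℕ-fromℕ< (m%n<n x n)
    j = SA ⟨$⟩ˡ cyclicPred (SA ⟨$⟩ʳ i)
    SAj : SA ⟨$⟩ʳ j ≡ cyclicPred (SA ⟨$⟩ʳ i)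
    SAj = inverseʳ SA
    char≡ : toℕ (char j) ≡ x / n
    char≡ = trans (cong (λ p → toℕ (lookup T p)) SAj) (trans (sym (L-char i)) (trans (cong L i≡) Bx))
    next≡ : toℕ (Ψ j) ≡ x % n
    next≡ = trans (cong toℕ (trans (cong (λ p → SA ⟨$⟩ˡ cyclicSucc p) SAj)
              (trans (cong (SA ⟨$⟩ˡ_) (cyclicSucc∘cyclicPred _)) (inverseˡ SA)))) i≡

  open RankOfKey key key-mono B? B⇒key key⇒B public

  occurs-char : ∀ {a P j} → Occurs T SA (a ∷ P) j → char j ≡ a
  occurs-char {j = j} occ with subst (Prefix _≡_ _) (drop-lookup T (SA ⟨$⟩ʳ j)) occ
  ... | a≡ ∷ _ = sym a≡

  occurs-tail : ∀ {a P j} → Occurs T SA (a ∷ P) j → Prefix _≡_ P (rest (SA ⟨$⟩ʳ j))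
  occurs-tail {j = j} occ with subst (Prefix _≡_ _) (drop-lookup T (SA ⟨$⟩ʳ j)) occ
  ... | _ ∷ pre = pre

  occurs-cons : ∀ {a P j} → char j ≡ a → Prefix _≡_ P (rest (SA ⟨$⟩ʳ j)) → Occurs T SA (a ∷ P) j
  occurs-cons {j = j} c≡ pre = subst (Prefix _≡_ _) (sym (drop-lookup T (SA ⟨$⟩ʳ j))) (sym c≡ ∷ pre)

  rest-Ψ : ∀ {j} → SA ⟨$⟩ʳ j ≢ last → rest (SA ⟨$⟩ʳ j) ≡ suffix T (SA ⟨$⟩ʳ Ψ j)
  rest-Ψ {j} j≢ = trans (rest-suffix j≢) (cong (suffix T) (sym (SA-Ψ j)))

  occurs-Ψ : ∀ {a P j} → Occurs T SA (a ∷ P) j → Occurs T SA P (Ψ j)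
  occurs-Ψ {P = []} occ = []
  occurs-Ψ {P = c ∷ P} {j} occ with SA ⟨$⟩ʳ j Fin.≟ last
  ... | no j≢ = subst (Prefix _≡_ _) (rest-Ψ j≢) (occurs-tail occ)
  ... | yes j≡ with subst (Prefix _≡_ _) (trans (cong rest j≡) rest-last) (occurs-tail occ)
  ...   | ()

  -- At the last position `Ψ` wraps around to the whole text, and an occurrence of `P` there says
  -- nothing about the empty remainder. The hypothesis on `$` covers this case.
  occurs-prev : ∀ {a P j} → (a ≡ $ → P ≡ []) → char j ≡ a → Occurs T SA P (Ψ j) → Occurs T SA (a ∷ P) j
  occurs-prev {j = j} a≡$⇒ c≡ occ with SA ⟨$⟩ʳ j Fin.≟ last
  ... | no j≢ = occurs-cons c≡ (subst (Prefix _≡_ _) (sym (rest-Ψ j≢)) occ)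
  ... | yes j≡ = subst (λ P → Occurs T SA (_ ∷ P) j) (sym (a≡$⇒ (trans (sym c≡) (cong (lookup T) j≡)))) (occurs-cons c≡ [])

  absent : ∀ {a P} → IsSAInterval T SA P nothing → IsSAInterval T SA (a ∷ P) nothing
  absent none j occ = none (Ψ j) (occurs-Ψ occ)

  -- As `e < n`, the opposite bound `n + s ≤ e + 1` forces `s = 0` and `e = n - 1`. One comparison
  -- thus separates the full interval, which the empty pattern has, from all others.
  absent-$ : ∀ {P s e} → IsSAInterval T SA P (just (s , e)) → suc (toℕ e) < n + toℕ s →
             IsSAInterval T SA ($ ∷ P) nothing
  absent-$ {c ∷ P} _ _ j occ with subst (Prefix _≡_ _) (trans (cong rest ($-unique (occurs-char occ))) rest-last) (occurs-tail occ)
  ... | ()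
  absent-$ {[]} {s} {e} (_ , iff) e< j occ =
    ⊥-elim (<⇒≱ e< (≤-trans (≤-reflexive (cong (n +_) (n≤0⇒n≡0 (proj₁ (Equivalence.from (iff zero) [])))))
      (≤-trans (≤-reflexive (trans (+-identityʳ n) (cong suc (sym (Fin.toℕ-fromℕ m)))))
        (s≤s (proj₂ (Equivalence.from (iff (fromℕ m)) []))))))

  -- A character that begins every suffix fills the whole text, so a terminated text has only one
  -- position. There `[0..0]` is the interval of the empty pattern and also of `$` itself, and no
  -- query could tell them apart; `single` settles this case.
  full⇒empty : ∀ {P s e} → IsSAInterval T SA P (just (s , e)) → n + toℕ s ≤ suc (toℕ e) →
               (toList T ≡ $ ∷ [] → P ≡ []) → P ≡ []
  full⇒empty {[]} _ _ _ = refl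
  full⇒empty {c ∷ P} {s} {e} (_ , iff) n+s≤ single =
    ⊥-elim (case single (trans (toList-single T m≡0) (cong (λ p → lookup T p ∷ []) zero≡last)) of λ ())
    where
    s≡0 : toℕ s ≡ 0
    s≡0 = n≤0⇒n≡0 (+-cancelˡ-≤ n _ 0 (≤-trans n+s≤ (≤-trans (Fin.toℕ<n e) (≤-reflexive (sym (+-identityʳ n))))))
    everywhere : ∀ p → lookup T p ≡ c
    everywhere p = subst (λ q → lookup T q ≡ c) (inverseʳ SA) (occurs-char (Equivalence.to (iff i)
      ( ≤-trans (≤-reflexive s≡0) z≤n
      , ≤-trans (s≤s⁻¹ (Fin.toℕ<n i)) (s≤s⁻¹ (≤-trans (m≤m+n n (toℕ s)) n+s≤)))))
      where i = SA ⟨$⟩ˡ p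
    zero≡last : zero ≡ last
    zero≡last = $-unique (trans (everywhere zero) (sym (everywhere last)))
    m≡0 : m ≡ 0
    m≡0 = trans (suc-injective (sym (proj₁ (proj₂ term)))) (cong toℕ (sym zero≡last))

  module _ {a : Fin σ} {P : List (Fin σ)} {s e : Fin n} (int : IsSAInterval T SA P (just (s , e)))
           (ok : a ≡ $ → P ≡ []) where

    lo hi : ℕ
    lo = toℕ a * n + toℕ s
    hi = toℕ a * n + suc (toℕ e)

    between⇒occurs : ∀ j → rank lo ≤ toℕ j → toℕ j < rank hi → Occurs T SA (a ∷ P) j
    between⇒occurs j ≤j j< = occurs-prev ok (Fin.toℕ-injective char≡)
        (Equivalence.to (proj₂ int (Ψ j)) (+-cancelˡ-≤ (toℕ a * n) _ _ (subst (λ c → lo ≤ c * n + k) char≡ ≤key)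
          , s≤s⁻¹ (+-cancelˡ-< (toℕ a * n) _ _ (subst (λ c → c * n + k < hi) char≡ key<))))
      where
      k = toℕ (Ψ j)
      ≤key : lo ≤ key j
      ≤key = ≮⇒≥ λ k< → <⇒≱ (proj₂ (proj₂ (rank-threshold lo)) j k<) ≤j
      key< : key j < hi
      key< = proj₁ (proj₂ (rank-threshold hi)) j j<
      -- Both `lo` and `hi` lie between `a n` and `(a + 1) n`, which leaves only row `a` for a key
      -- from `lo` up to below `hi`.
      char≡ : toℕ (char j) ≡ toℕ a
      char≡ = ≤-antisym
        (s≤s⁻¹ (*-cancelʳ-< n _ (suc (toℕ a)) (≤-<-trans (m≤m+n _ k) (<-≤-trans key<
          (≤-trans (+-monoʳ-≤ (toℕ a * n) (Fin.toℕ<n e)) (≤-reflexive (+-comm (toℕ a * n) n)))))))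
        (s≤s⁻¹ (*-cancelʳ-< n _ (suc (toℕ (char j))) (≤-<-trans (≤-trans (m≤m+n _ (toℕ s)) ≤key)
          (<-≤-trans (+-monoʳ-< (toℕ (char j) * n) (Fin.toℕ<n (Ψ j))) (≤-reflexive (+-comm (toℕ (char j) * n) n))))))

    occurs⇒between : ∀ j → Occurs T SA (a ∷ P) j → rank lo ≤ toℕ j × toℕ j < rank hi
    occurs⇒between j occ =
        ≮⇒≥ (λ j< → <⇒≱ (proj₁ (proj₂ (rank-threshold lo)) j j<) ≤key)
      , proj₂ (proj₂ (rank-threshold hi)) j key<
      where
      char≡ : toℕ (char j) ≡ toℕ a
      char≡ = cong toℕ (occurs-char occ)
      inside = Equivalence.from (proj₂ int (Ψ j)) (occurs-Ψ occ)
      ≤key : lo ≤ key j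
      ≤key = subst (λ c → lo ≤ c * n + toℕ (Ψ j)) (sym char≡) (+-monoʳ-≤ (toℕ a * n) (proj₁ inside))
      key< : key j < hi
      key< = subst (λ c → c * n + toℕ (Ψ j) < hi) (sym char≡) (+-monoʳ-< (toℕ a * n) (s≤s (proj₂ inside)))

    present : rank lo < rank hi → Σ[ s′ ∈ Fin n ] Σ[ e′ ∈ Fin n ]
              toℕ s′ ≡ rank lo × toℕ e′ ≡ rank hi ∸ 1 × IsSAInterval T SA (a ∷ P) (just (s′ , e′))
    present lo<hi = fromℕ< s<n , fromℕ< e<n , Fin.toℕ-fromℕ< s<n , Fin.toℕ-fromℕ< e<n
        , subst₂ _≤_ (sym (Fin.toℕ-fromℕ< s<n)) (sym (Fin.toℕ-fromℕ< e<n)) (∸-monoˡ-≤ 1 lo<hi)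
        , λ j → mk⇔
            (λ (s≤ , ≤e) → between⇒occurs j (subst (_≤ toℕ j) (Fin.toℕ-fromℕ< s<n) s≤)
              (≤-trans (s≤s (subst (toℕ j ≤_) (Fin.toℕ-fromℕ< e<n) ≤e)) (≤-reflexive hi≡)))
            (λ occ → let ≤j , j< = occurs⇒between j occ in
               subst (_≤ toℕ j) (sym (Fin.toℕ-fromℕ< s<n)) ≤j
             , subst (toℕ j ≤_) (sym (Fin.toℕ-fromℕ< e<n)) (∸-monoˡ-≤ 1 j<))
      where
      s<n : rank lo < n
      s<n = <-≤-trans lo<hi (proj₁ (rank-threshold hi))
      hi≡ : suc (rank hi ∸ 1) ≡ rank hi
      hi≡ = m+[n∸m]≡n (≤-trans (s≤s z≤n) lo<hi)
      e<n : rank hi ∸ 1 < n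
      e<n = ≤-trans (≤-reflexive hi≡) (proj₁ (rank-threshold hi))

    none : rank hi ≤ rank lo → IsSAInterval T SA (a ∷ P) nothing
    none hi≤lo j occ = let ≤j , j< = occurs⇒between j occ in <⇒≱ (<-≤-trans j< hi≤lo) ≤j

-- Expressions and structured programs on the word RAM

data Expr : Set where
  var : Reg → Expr
  lit : ℕ → Expr
  op  : Op → Expr → Expr → Expr
  mem : Expr → Expr

-- Registers below this bound hold program variables; expressions are
-- evaluated on a stack growing upwards from it.
stack : Reg
stack = 16

-- A register is copied by a right shift by 0. Unlike the addition of 0, this does not truncate, so
-- copying needs no bound on the value.
compile : Expr → Reg → Program
compile (var x)    d = const d 0 ⨾ apply d shr x d
compile (lit k)    d = const d k
compile (op o e f) d = compile e d ⨾ compile f (suc d) ⨾ apply d o d (suc d)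
compile (mem e)    d = compile e d ⨾ load d d

cost : Expr → ℕ
cost (var x)    = 2
cost (lit k)    = 1
cost (op o e f) = cost e + (cost f + 1)
cost (mem e)    = cost e + 1

infix 5 _≔_

opaque

  _≔_ : Reg → Expr → Program
  x ≔ e = compile e stack ⨾ const (suc stack) 0 ⨾ apply x shr stack (suc stack)

  ifThenElse : Expr → Program → Program → Program
  ifThenElse e p q = compile e stack ⨾ ifNonZero stack p q

  -- The guard is evaluated again at the end of the body; on entry its value is expected in the
  -- register `stack`.
  loop : Expr → Program → Program
  loop e p = whileNonZero stack (p ⨾ compile e stack)

  whileDo : Expr → Program → Program
  whileDo e p = compile e stack ⨾ loop e p

update-same : ∀ ρ d v → (ρ [ d ↦ v ]) d ≡ v
update-same ρ d v with d ≡ᵇ d in same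
... | true  = refl
... | false = ⊥-elim (subst T same (≡⇒≡ᵇ d d refl))

update-other : ∀ ρ {d} v {x} → x ≢ d → (ρ [ d ↦ v ]) x ≡ ρ x
update-other ρ {d} v {x} x≢d with x ≡ᵇ d in same
... | true  = ⊥-elim (x≢d (≡ᵇ⇒≡ x d (subst T (sym same) _)))
... | false = refl

shr-zero : ∀ w x → ⟦ shr ⟧ w x 0 ≡ x
shr-zero w x = n/1≡n x

trunc-zero : ∀ w → trunc w 0 ≡ 0
trunc-zero w = m<n⇒m%n≡m {{m^n≢0 2 w}} (m^n>0 2 w)

module Semantics (w : ℕ) {m : ℕ} (D : Vec ℕ m) where

  data Eval (s : Registers) : Expr → ℕ → Set where
    var : ∀ {x} → x < stack → Eval s (var x) (s x)
    lit : ∀ {k} → Eval s (lit k) (trunc w k)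
    op  : ∀ {o e f u v} → Eval s e u → Eval s f v →
          Eval s (op o e f) (⟦ o ⟧ w u v)
    mem : ∀ {e} (i : Fin m) → Eval s e (toℕ i) → Eval s (mem e) (lookup D i)

  -- Only program variables are compared, because the evaluation of expressions overwrites the
  -- registers from `stack` on.
  Agree : Registers → Registers → Set
  Agree s ρ = ∀ x → x < stack → ρ x ≡ s x

  move : ∀ ρ {d x z} → x ≢ z →
         Σ[ ρ′ ∈ Registers ] (w ⊢ const z 0 ⨾ apply d shr x z , ρ , D ⇓[ 2 ] ρ′ , D)
           × ρ′ d ≡ ρ x × (∀ y → y ≢ d → y ≢ z → ρ′ y ≡ ρ y)
  move ρ {d} {x} {z} x≢z = _ , seq const apply , same , frame
    where
    ρ₁ : Registers
    ρ₁ = ρ [ z ↦ trunc w 0 ]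
    same : (ρ₁ [ d ↦ ⟦ shr ⟧ w (ρ₁ x) (ρ₁ z) ]) d ≡ ρ x
    same = begin
      _                         ≡⟨ update-same ρ₁ d _ ⟩
      ⟦ shr ⟧ w (ρ₁ x) (ρ₁ z)   ≡⟨ cong (⟦ shr ⟧ w (ρ₁ x)) (trans (update-same ρ z _) (trunc-zero w)) ⟩
      ⟦ shr ⟧ w (ρ₁ x) 0        ≡⟨ shr-zero w _ ⟩
      ρ₁ x                      ≡⟨ update-other ρ _ x≢z ⟩
      ρ x                       ∎
      where open ≡-Reasoning
    frame : ∀ y → y ≢ d → y ≢ z → (ρ₁ [ d ↦ _ ]) y ≡ ρ y
    frame y y≢d y≢z = trans (update-other ρ₁ _ y≢d) (update-other ρ _ y≢z)

  Evaluates : Expr → Reg → ℕ → Registers → Set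
  Evaluates e d v ρ =
    Σ[ ρ′ ∈ Registers ] (w ⊢ compile e d , ρ , D ⇓[ cost e ] ρ′ , D)
      × ρ′ d ≡ v × (∀ x → x < d → ρ′ x ≡ ρ x)

  -- That the registers below `d` survive protects the variables, and also the left operand while
  -- the right one is evaluated one place higher.
  compile-correct : ∀ {s e v} → Eval s e v → ∀ d → stack ≤ d →
                    ∀ ρ → Agree s ρ → Evaluates e d v ρ
  compile-correct (var {x} x<) d st≤ ρ ag =
    let ρ′ , run , same , frame = move ρ {d} {x} {d} (<⇒≢ (<-≤-trans x< st≤))
    in ρ′ , run , trans same (ag x x<) , λ y y< → frame y (<⇒≢ y<) (<⇒≢ y<)
  compile-correct lit d st≤ ρ ag =
    _ , const , update-same ρ d _ , λ y y< → update-other ρ _ (<⇒≢ y<)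
  compile-correct (op {o} ev ev′) d st≤ ρ ag =
    let ρ₁ , run₁ , eq₁ , frame₁ = compile-correct ev d st≤ ρ ag
        ρ₂ , run₂ , eq₂ , frame₂ = compile-correct ev′ (suc d) (m≤n⇒m≤1+n st≤) ρ₁
          λ x x< → trans (frame₁ x (<-≤-trans x< st≤)) (ag x x<)
    in _ , seq run₁ (seq run₂ apply)
       , trans (update-same ρ₂ d _)
           (cong₂ (⟦ o ⟧ w) (trans (frame₂ d (n<1+n d)) eq₁) eq₂)
       , λ y y< → trans (update-other ρ₂ _ (<⇒≢ y<))
           (trans (frame₂ y (m<n⇒m<1+n y<)) (frame₁ y y<))
  compile-correct (mem i ev) d st≤ ρ ag =
    let ρ₁ , run₁ , eq₁ , frame₁ = compile-correct ev d st≤ ρ ag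
    in _ , seq run₁ (load i (sym eq₁)) , update-same ρ₁ d _
       , λ y y< → trans (update-other ρ₁ _ (<⇒≢ y<)) (frame₁ y y<)

  Exec : Program → Registers → ℕ → Registers → Set
  Exec p s limit s′ = ∀ ρ → Agree s ρ →
    Σ[ t ∈ ℕ ] Σ[ ρ′ ∈ Registers ]
      t ≤ limit × (w ⊢ p , ρ , D ⇓[ t ] ρ′ , D) × Agree s′ ρ′

  exec-skip : ∀ {s} → Exec skip s 1 s
  exec-skip ρ ag = 1 , ρ , ≤-refl , skip , ag

  exec-weaken : ∀ {p s T T′ s′ s″} → T ≤ T′ → (∀ x → x < stack → s′ x ≡ s″ x) →
                Exec p s T s′ → Exec p s T′ s″
  exec-weaken T≤ same ex ρ ag =
    let t , ρ′ , t≤ , run , ag′ = ex ρ ag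
    in t , ρ′ , ≤-trans t≤ T≤ , run , λ x x< → trans (ag′ x x<) (same x x<)

  infixr 4 _then_

  _then_ : ∀ {p q s s′ s″ T U} → Exec p s T s′ → Exec q s′ U s″ →
           Exec (p ⨾ q) s (T + U) s″
  (ex then ex′) ρ ag =
    let t , ρ₁ , t≤ , run , ag₁ = ex ρ ag
        u , ρ₂ , u≤ , run′ , ag₂ = ex′ ρ₁ ag₁
    in t + u , ρ₂ , +-mono-≤ t≤ u≤ , seq run run′ , ag₂

  opaque
    unfolding _≔_

    exec-assign : ∀ {s x e v} → x < stack → Eval s e v →
                  Exec (x ≔ e) s (cost e + 2) (s [ x ↦ v ])
    exec-assign {s} {x} {e} {v} x< ev ρ ag =
      let ρ₁ , run₁ , eq₁ , frame₁ = compile-correct ev stack ≤-refl ρ ag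
          ρ₂ , run₂ , eq₂ , frame₂ = move ρ₁ {x} {stack} {suc stack} (λ ())
      in _ , ρ₂ , ≤-refl , seq run₁ run₂ , λ y y< → helper ρ₁ ρ₂ y y< (trans eq₂ eq₁) frame₁ frame₂
      where
      helper : ∀ (ρ₁ ρ₂ : Registers) y → y < stack → ρ₂ x ≡ v → (∀ z → z < stack → ρ₁ z ≡ ρ z) →
               (∀ y → y ≢ x → y ≢ suc stack → ρ₂ y ≡ ρ₁ y) → ρ₂ y ≡ (s [ x ↦ v ]) y
      helper ρ₁ ρ₂ y y< same frame₁ frame₂ with y ≟ x
      ... | yes refl = trans same (sym (update-same s x v))
      ... | no y≢x   = trans (frame₂ y y≢x (<⇒≢ (m<n⇒m<1+n y<)))
                         (trans (frame₁ y y<) (trans (ag y y<) (sym (update-other s v y≢x))))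

    exec-if≢0 : ∀ {s e v p q T s′} → v ≢ 0 → Eval s e v → Exec p s T s′ →
                Exec (ifThenElse e p q) s (cost e + (1 + T)) s′
    exec-if≢0 v≢0 ev ex ρ ag =
      let ρ₁ , run₁ , eq₁ , frame₁ = compile-correct ev stack ≤-refl ρ ag
          t , ρ₂ , t≤ , run₂ , ag₂ = ex ρ₁ λ x x< → trans (frame₁ x x<) (ag x x<)
      in _ , ρ₂ , +-monoʳ-≤ _ (s≤s t≤) , seq run₁ (if≢0 (λ same → v≢0 (trans (sym eq₁) same)) run₂) , ag₂

    exec-if≡0 : ∀ {s e v p q T s′} → v ≡ 0 → Eval s e v → Exec q s T s′ →
                Exec (ifThenElse e p q) s (cost e + (1 + T)) s′
    exec-if≡0 v≡0 ev ex ρ ag =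
      let ρ₁ , run₁ , eq₁ , frame₁ = compile-correct ev stack ≤-refl ρ ag
          t , ρ₂ , t≤ , run₂ , ag₂ = ex ρ₁ λ x x< → trans (frame₁ x x<) (ag x x<)
      in _ , ρ₂ , +-monoʳ-≤ _ (s≤s t≤) , seq run₁ (if≡0 (trans eq₁ v≡0) run₂) , ag₂

  ExecLoop : Expr → Program → Registers → ℕ → ℕ → Registers → Set
  ExecLoop e p s v limit s′ = ∀ ρ → Agree s ρ → ρ stack ≡ v →
    Σ[ t ∈ ℕ ] Σ[ ρ′ ∈ Registers ]
      t ≤ limit × (w ⊢ loop e p , ρ , D ⇓[ t ] ρ′ , D) × Agree s′ ρ′

  opaque
    unfolding _≔_

    loop-stop : ∀ {e p s v} → v ≡ 0 → ExecLoop e p s v 1 s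
    loop-stop v≡0 ρ ag same = 1 , ρ , ≤-refl , while≡0 (trans same v≡0) , ag

    loop-step : ∀ {e p s v T s₁ v₁ U s₂} → v ≢ 0 → Exec p s T s₁ → Eval s₁ e v₁ →
                ExecLoop e p s₁ v₁ U s₂ →
                ExecLoop e p s v (1 + (T + cost e) + U) s₂
    loop-step v≢0 ex ev rest ρ ag same =
      let t , ρ₁ , t≤ , run₁ , ag₁ = ex ρ ag
          ρ₂ , run₂ , eq₂ , frame₂ = compile-correct ev stack ≤-refl ρ₁ ag₁
          u , ρ₃ , u≤ , run₃ , ag₃ = rest ρ₂ (λ x x< → trans (frame₂ x x<) (ag₁ x x<)) eq₂
      in _ , ρ₃ , s≤s (+-mono-≤ (+-monoˡ-≤ _ t≤) u≤)
         , while≢0 (λ z → v≢0 (trans (sym same) z)) (seq run₁ run₂) run₃ , ag₃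

    exec-while : ∀ {s e p v T s′} → Eval s e v → ExecLoop e p s v T s′ →
                 Exec (whileDo e p) s (cost e + T) s′
    exec-while ev rest ρ ag =
      let ρ₁ , run₁ , eq₁ , frame₁ = compile-correct ev stack ≤-refl ρ ag
          t , ρ₂ , t≤ , run₂ , ag₂ = rest ρ₁ (λ x x< → trans (frame₁ x x<) (ag x x<)) eq₁
      in _ , ρ₂ , +-monoʳ-≤ _ t≤ , seq run₁ run₂ , ag₂

-- Logarithms and total division

n<2^[1+log] : ∀ n → n < 2 ^ (1 + ⌊log₂ n ⌋)
n<2^[1+log] n = ≰⇒> λ 2^≤n → n≮n ⌊log₂ n ⌋
  (≤-trans (≤-reflexive (sym (⌊log₂[2^n]⌋≡n (1 + ⌊log₂ n ⌋)))) (⌊log₂⌋-mono-≤ 2^≤n))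

n<2^n : ∀ n → n < 2 ^ n
n<2^n zero    = s≤s z≤n
n<2^n (suc n) = ≤-trans (+-mono-≤ (≤-trans (s≤s z≤n) (n<2^n n)) (n<2^n n)) (≤-reflexive (cong (2 ^ n +_) (sym (+-identityʳ _))))

2*⌊n/2⌋≤n : ∀ n → 2 * ⌊ n /2⌋ ≤ n
2*⌊n/2⌋≤n n = begin
  ⌊ n /2⌋ + (⌊ n /2⌋ + 0) ≡⟨ cong (⌊ n /2⌋ +_) (+-identityʳ _) ⟩
  ⌊ n /2⌋ + ⌊ n /2⌋       ≤⟨ +-monoʳ-≤ ⌊ n /2⌋ (⌊n/2⌋≤⌈n/2⌉ n) ⟩
  ⌊ n /2⌋ + ⌈ n /2⌉       ≡⟨ ⌊n/2⌋+⌈n/2⌉≡n n ⟩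
  n                       ∎
  where open ≤-Reasoning

2^log≤n : ∀ n → 1 ≤ n → 2 ^ ⌊log₂ n ⌋ ≤ n
2^log≤n = <-rec _ step
  where
  open ≤-Reasoning
  step : ∀ n → (∀ {k} → k < n → 1 ≤ k → 2 ^ ⌊log₂ k ⌋ ≤ k) → 1 ≤ n → 2 ^ ⌊log₂ n ⌋ ≤ n
  step (suc zero)      rec _ = ≤-refl
  step n@(suc (suc k)) rec _ = begin
    2 ^ ⌊log₂ n ⌋             ≤⟨ ^-monoʳ-≤ 2 (m≤n+m∸n ⌊log₂ n ⌋ 1) ⟩
    2 * 2 ^ (⌊log₂ n ⌋ ∸ 1)   ≡⟨ cong (λ l → 2 * 2 ^ l) (⌊log₂⌊n/2⌋⌋≡⌊log₂n⌋∸1 n) ⟨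
    2 * 2 ^ ⌊log₂ ⌊ n /2⌋ ⌋   ≤⟨ *-monoʳ-≤ 2 (rec (⌊n/2⌋<n (suc k)) (s≤s z≤n)) ⟩
    2 * ⌊ n /2⌋               ≤⟨ 2*⌊n/2⌋≤n n ⟩
    n                         ∎

log< : ∀ {n b} → 1 ≤ n → n < 2 ^ b → ⌊log₂ n ⌋ < b
log< {n} 1≤n n< = ≰⇒> λ b≤ → <⇒≱ (≤-<-trans (2^log≤n n 1≤n) n<) (^-monoʳ-≤ 2 b≤)

rem≡% : ∀ x y .{{_ : NonZero y}} → x rem y ≡ x % y
rem≡% x (suc y) = refl

÷≤ : ∀ x y → x ÷ y ≤ x
÷≤ x zero    = z≤n
÷≤ x (suc y) = m/n≤m x (suc y)

rem≤ : ∀ x y → x rem y ≤ x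
rem≤ x zero    = ≤-refl
rem≤ x (suc y) = m%n≤m x (suc y)

÷-rem : ∀ x y → (x ÷ y) * y + x rem y ≡ x
÷-rem x zero    = refl
÷-rem x (suc y) = trans (+-comm (x / suc y * suc y) _) (sym (m≡m%n+[m/n]*n x (suc y)))

÷-* : ∀ x y → (x ÷ y) * y ≤ x
÷-* x zero    = z≤n
÷-* x (suc y) = m/n*n≤m x (suc y)

rem< : ∀ x {y} → 0 < y → x rem y < y
rem< x {suc y} _ = m%n<n x (suc y)

÷-monoˡ : ∀ {x x′} y → x ≤ x′ → x ÷ y ≤ x′ ÷ y
÷-monoˡ zero    _ = z≤n
÷-monoˡ (suc y) x≤ = /-monoˡ-≤ (suc y) x≤

÷>0 : ∀ {x y} → 0 < y → y ≤ x → 0 < x ÷ y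
÷>0 {x} {suc y} _ y≤x = m≥n⇒m/n>0 y≤x

-- Values are bounded by powers of 2 ^ b. As a word has room for 64 of these,
-- arithmetic on them does not overflow.

module Values (w b : ℕ) (2≤b : 2 ≤ b) (wide : 64 * b ≤ w) {m : ℕ} (D : Vec ℕ m) where

  open Semantics w D public

  record Val (k : ℕ) (s : Registers) (e : Expr) (v : ℕ) : Set where
    constructor _within_
    field
      eval  : Eval s e v
      bound : v < 2 ^ (k * b)

  open Val public

  fits : ∀ {k v} → k ≤ 64 → v < 2 ^ (k * b) → v < 2 ^ w
  fits k≤ v< = <-≤-trans v< (^-monoʳ-≤ 2 (≤-trans (*-monoˡ-≤ b k≤) wide))

  raise-< : ∀ {j k v} → j ≤ k → v < 2 ^ (j * b) → v < 2 ^ (k * b)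
  raise-< j≤k v< = <-≤-trans v< (^-monoʳ-≤ 2 (*-monoˡ-≤ b j≤k))

  raise : ∀ {j k s e v} {_ : True (j ≤? k)} → Val j s e v → Val k s e v
  raise {_} {_} {s} {e} {v} {j≤k} (ev within v<) = ev within raise-< {v = v} (toWitness j≤k) v<

  -- As `b` is a variable, numerals are compared with `4 ^ k` instead, which is decided by
  -- computation.
  small : ∀ {k v} → v < 4 ^ k → v < 2 ^ (k * b)
  small {k} {v} v< = <-≤-trans v< (begin
    4 ^ k           ≡⟨ ^-*-assoc 2 2 k ⟩
    2 ^ (2 * k)     ≡⟨ cong (2 ^_) (*-comm 2 k) ⟩
    2 ^ (k * 2)     ≤⟨ ^-monoʳ-≤ 2 (*-monoʳ-≤ k 2≤b) ⟩
    2 ^ (k * b)     ∎)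
    where open ≤-Reasoning

  val-cast : ∀ {k s e u v} → u ≡ v → Val k s e u → Val k s e v
  val-cast refl x = x

  val-var : ∀ {k s x v} {_ : True (x <? stack)} → s x ≡ v → v < 2 ^ (k * b) → Val k s (var x) v
  val-var {_} {s} {x} {_} {x<} s≡ v< = subst (Eval s (var x)) s≡ (var (toWitness x<)) within v<

  val-lit : ∀ k {s v} {_ : True (v <? 4 ^ k)} {_ : True (k ≤? 64)} → Val k s (lit v) v
  val-lit k {s} {v} {v<} {k≤} =
    subst (Eval s (lit v)) (%2^-id w (fits {k} (toWitness k≤) v<′)) lit within v<′
    where v<′ = small {k} (toWitness v<)

  -- A sum needs one more bit. It is charged a whole `b`, so that all exponents remain multiples of
  -- `b`.
  val-add : ∀ {j k s e f u v} {_ : True (suc (j ⊔ k) ≤? 64)} →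
            Val j s e u → Val k s f v → Val (suc (j ⊔ k)) s (op add e f) (u + v)
  val-add {j} {k} {s} {e} {f} {u} {v} {≤64} (ev within u<) (ev′ within v<) =
    subst (Eval s (op add e f)) (%2^-id w (fits {suc (j ⊔ k)} (toWitness ≤64) sum<)) (op ev ev′) within sum<
    where
    l = j ⊔ k
    sum< : u + v < 2 ^ (suc l * b)
    sum< = begin-strict
      u + v                      <⟨ +-mono-< (raise-< {v = u} (m≤m⊔n j k) u<) (raise-< {v = v} (m≤n⊔m j k) v<) ⟩
      2 ^ (l * b) + 2 ^ (l * b)  ≡⟨ cong (2 ^ (l * b) +_) (+-identityʳ _) ⟨
      2 ^ (1 + l * b)            ≤⟨ ^-monoʳ-≤ 2 (+-monoˡ-≤ (l * b) (≤-trans (n≤1+n 1) 2≤b)) ⟩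
      2 ^ (b + l * b)            ∎
      where open ≤-Reasoning

  val-mul : ∀ {j k s e f u v} {_ : True (j + k ≤? 64)} →
            Val j s e u → Val k s f v → Val (j + k) s (op mul e f) (u * v)
  val-mul {j} {k} {s} {e} {f} {u} {v} {≤64} (ev within u<) (ev′ within v<) =
    subst (Eval s (op mul e f)) (%2^-id w (fits {j + k} (toWitness ≤64) product<)) (op ev ev′) within product<
    where
    product< : u * v < 2 ^ ((j + k) * b)
    product< = <-≤-trans (*-mono-< u< v<) (≤-reflexive
      (trans (sym (^-distribˡ-+-* 2 (j * b) (k * b))) (cong (2 ^_) (sym (*-distribʳ-+ b j k)))))

  val-sub : ∀ {k s e f u v} {_ : True (k ≤? 64)} → v ≤ u →
            Val k s e u → Eval s f v → Val k s (op sub e f) (u ∸ v)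
  val-sub {k} {s} {e} {f} {u} {v} {≤64} v≤u (ev within u<) ev′ =
    subst (Eval s (op sub e f)) difference (op ev ev′) within <-diff
    where
    <-diff : u ∸ v < 2 ^ (k * b)
    <-diff = ≤-<-trans (m∸n≤m u v) u<
    difference : trunc w ((u + 2 ^ w) ∸ v) ≡ u ∸ v
    difference = begin
      ((u + 2 ^ w) ∸ v) %2^ w        ≡⟨ cong (λ x → (x ∸ v) %2^ w) (+-comm u (2 ^ w)) ⟩
      ((2 ^ w + u) ∸ v) %2^ w        ≡⟨ cong (_%2^ w) (+-∸-assoc (2 ^ w) v≤u) ⟩
      (2 ^ w + (u ∸ v)) %2^ w        ≡⟨ cong (_%2^ w) (+-comm (2 ^ w) (u ∸ v)) ⟩
      ((u ∸ v) + 2 ^ w) %2^ w        ≡⟨ [m+n]%n≡m%n (u ∸ v) (2 ^ w) {{m^n≢0 2 w}} ⟩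
      (u ∸ v) %2^ w                  ≡⟨ %2^-id w (fits {k} (toWitness ≤64) <-diff) ⟩
      u ∸ v                          ∎
      where open ≡-Reasoning

  val-div : ∀ {k s e f u v} → Val k s e u → Eval s f v → Val k s (op div e f) (u ÷ v)
  val-div {u = u} {v} (ev within u<) ev′ = op ev ev′ within ≤-<-trans (÷≤ u v) u<

  val-mod : ∀ {k s e f u v} → Val k s e u → Eval s f v → Val k s (op mod e f) (u rem v)
  val-mod {u = u} {v} (ev within u<) ev′ = op ev ev′ within ≤-<-trans (rem≤ u v) u<

  toBit-< : ∀ x → toBit x < 2 ^ (1 * b)
  toBit-< true  = small {1} (s≤s (s≤s z≤n))
  toBit-< false = small {1} (s≤s z≤n)

  val-lt : ∀ {s e f u v} → Eval s e u → Eval s f v → Val 1 s (op lt e f) (toBit (u <ᵇ v))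
  val-lt {u = u} {v} ev ev′ = op ev ev′ within toBit-< (u <ᵇ v)

  val-eq : ∀ {s e f u v} → Eval s e u → Eval s f v → Val 1 s (op eq e f) (toBit (u ≡ᵇ v))
  val-eq {u = u} {v} ev ev′ = op ev ev′ within toBit-< (u ≡ᵇ v)

-- The memory is interleaved from 16 streams: the k-th word of stream t is at
-- address 16 k + t. Streams 0 to 7 hold packed arrays, stream 8 parameters.

parameter : ℕ → Expr
parameter k = mem (lit (k * 16 + 8))

-- Three consecutive parameters from p onwards: the number of fields per word,
-- their width f, and 2 ^ f.
fieldE : (t p : ℕ) → Expr → Expr
fieldE t p e =
  op mod (op shr (mem (op add (op mul (op div e (parameter p)) (lit 16)) (lit t)))
                 (op mul (op mod e (parameter p)) (parameter (1 + p))))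
         (parameter (2 + p))

header : ℕ → Expr → Expr
header t = fieldE t 0

βE nE σE rE $E : Expr
βE = parameter 6
nE = parameter 7
σE = parameter 8
rE = parameter 9
$E = parameter 10

-- The decomposition `J-rank`: stream 0 has the values of `J` at multiples of `β`, stream 1 the
-- marks in between, stream 5 the popcount table.
blockE : Expr → Expr
blockE e = op add (header 0 (op div e βE))
  (header 5 (op add (op mul (header 1 (op div e βE)) βE) (op mod e βE)))

opaque

  -- The formula `W-select`: streams 2, 3 and 4 describe the block by its first position, the rank
  -- there and its bits, and stream 6 is the select table. Subtracting the index turns `W` into `H`.
  highE : Expr → Expr
  highE e = op sub
    (op add (header 2 (blockE e))
            (header 6 (op add (op mul (header 4 (blockE e)) βE) (op sub e (header 3 (blockE e))))))
    e

  entryE : Expr → Expr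
  entryE e = op add
    (op mul (op sub (highE (op add e (op add σE (lit 1)))) rE) (parameter 5))
    (fieldE 7 3 e)

-- Sizes of blocks, fields and streams

blockBits : ℕ → ℕ
blockBits M = suc (bitLength M / 4)

-- The largest stored positions are about `N + 2 r`, which is at most `8 M`; hence three bits more
-- than `M` has.
headerWidth : ℕ → ℕ
headerWidth M = bitLength M + 3

-- The 2 makes up for rounding down both logarithms: it ensures `(σ + 1) n ≤ r * 2 ^ ℓ`, so that
-- high parts are at most `r`.
lowWidth : (n σ r : ℕ) → ℕ
lowWidth n σ r = ⌊log₂ n ÷ r ⌋ + ⌊log₂ σ ⌋ + 2

record Sizes (w b n σ r : ℕ) : Set where
  field
    2≤b      : 2 ≤ b
    wide     : 64 * b ≤ w
    n<       : n < 2 ^ b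
    M<       : σ + r < 2 ^ b
    1≤r      : 1 ≤ r
    1≤σ      : 1 ≤ σ
    low≤b    : lowWidth n σ r ≤ b
    universe : σ * n + n ≤ r * 2 ^ lowWidth n σ r

-- There are `σ + 1` row counts, `r + 1` starts and `r + 2` ranks; a rank is also needed at the
-- start after the last.
indices : (σ r : ℕ) → ℕ
indices σ r = suc σ + (2 * r + 3)

headerCount : (σ r : ℕ) → ℕ
headerCount σ r = (indices σ r + 2 * r) / β + 1 + 2 ^ β * β
  where β = blockBits (σ + r)

-- All streams have the same length. The final 16 covers the partly filled last words and the eleven
-- parameters.
streamLength : (w n σ r : ℕ) → ℕ
streamLength w n σ r =
  headerCount σ r ÷ (w ÷ headerWidth (σ + r)) + (2 * r + 3) ÷ (w ÷ lowWidth n σ r) + 16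

N+2r≤8M : ∀ {σ} r → 1 ≤ σ → indices σ r + 2 * r ≤ 8 * (σ + r)
N+2r≤8M {σ} r 1≤σ = begin
  suc σ + (2 * r + 3) + 2 * r ≡⟨ solve₁ σ r ⟩
  σ + 4 * r + 4 * 1           ≤⟨ +-monoʳ-≤ (σ + 4 * r) (*-monoʳ-≤ 4 1≤σ) ⟩
  σ + 4 * r + 4 * σ           ≤⟨ m≤m+n _ (3 * σ + 4 * r) ⟩
  σ + 4 * r + 4 * σ + (3 * σ + 4 * r) ≡⟨ solve₂ σ r ⟩
  8 * (σ + r)                 ∎
  where
  open ≤-Reasoning
  solve₁ : ∀ σ r → suc σ + (2 * r + 3) + 2 * r ≡ σ + 4 * r + 4 * 1
  solve₁ = solve-∀
  solve₂ : ∀ σ r → σ + 4 * r + 4 * σ + (3 * σ + 4 * r) ≡ 8 * (σ + r)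
  solve₂ = solve-∀

-- The sequence H consists of C and of the high parts of Z, offset by r so that
-- it is nondecreasing; the low ℓ bits of Z are stored separately.
module Structure {w b n σ r : ℕ} (sizes : Sizes w b n σ r) ($ : ℕ) ($<σ : $ < σ)
                 (C Z : ℕ → ℕ) (C-step : ∀ a → C a ≤ C (suc a)) (C≤r : ∀ a → C a ≤ r)
                 (Z-step : ∀ j → Z j ≤ Z (suc j)) (Z≤ : ∀ j → Z j ≤ σ * n + n) where

  open Sizes sizes

  ℓ f β N : ℕ
  ℓ = lowWidth n σ r
  f = headerWidth (σ + r)
  β = blockBits (σ + r)
  N = indices σ r

  H : ℕ → ℕ
  H i with i ≤? σ
  ... | yes _ = C i
  ... | no _  = r + Z (i ∸ suc σ) /2^ ℓ

  H-step : ∀ i → H i ≤ H (suc i)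
  H-step i with i ≤? σ | suc i ≤? σ
  ... | yes _  | yes _   = C-step i
  ... | yes _  | no _    = ≤-trans (C≤r i) (m≤m+n r _)
  ... | no i≰  | yes si≤ = ⊥-elim (i≰ (<⇒≤ si≤))
  ... | no i≰  | no _    = +-monoʳ-≤ r (/-monoˡ-≤ (2 ^ ℓ) {{m^n≢0 2 ℓ}}
    (subst (λ k → Z (i ∸ suc σ) ≤ Z k) (sym (+-∸-assoc 1 (≰⇒> i≰))) (Z-step (i ∸ suc σ))))

  H-char : ∀ {a} → a ≤ σ → H a ≡ C a
  H-char {a} a≤ with a ≤? σ
  ... | yes _ = refl
  ... | no a≰ = ⊥-elim (a≰ a≤)

  H-entry : ∀ j → H (j + (σ + 1)) ≡ r + Z j /2^ ℓ
  H-entry j with j + (σ + 1) ≤? σ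
  ... | yes ≤σ = ⊥-elim (m+1+n≰m σ (≤-trans (≤-reflexive (+-comm σ (1 + j))) (≤-trans (≤-reflexive (trans (sym (+-suc j σ)) (cong (j +_) (+-comm 1 σ)))) ≤σ)))
  ... | no _   = cong (λ k → r + Z k /2^ ℓ) (trans (cong (j + (σ + 1) ∸_) (+-comm 1 σ)) (m+n∸n≡m j (σ + 1)))

  H≤ : ∀ i → H i ≤ 2 * r
  H≤ i with i ≤? σ
  ... | yes _ = ≤-trans (C≤r i) (m≤m+n r _)
  ... | no _  = +-monoʳ-≤ r (≤-trans (/-monoˡ-≤ (2 ^ ℓ) {{m^n≢0 2 ℓ}} (≤-trans (Z≤ _) universe))
                  (≤-reflexive (trans (m*n/n≡m r (2 ^ ℓ) {{m^n≢0 2 ℓ}}) (sym (+-identityʳ r)))))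

  -- The unary encoding writes a zero for each unit by which `H` grows and a one for each index.
  -- Before the one of `i` there are `H i` zeros and `i` ones.
  W : ℕ → ℕ
  W i = H i + i

  W-step : ∀ i → W i < W (suc i)
  W-step i = ≤-trans (s≤s (+-monoˡ-≤ i (H-step i))) (≤-reflexive (sym (+-suc (H (suc i)) i)))

  W≤ : ∀ {i} → i < N → W i < N + 2 * r
  W≤ {i} i<N = ≤-trans (+-mono-≤-< (H≤ i) i<N) (≤-reflexive (+-comm (2 * r) N))

  open EliasFano W W-step β N

  array : ℕ → ℕ → ℕ
  array 0 c = J (c * β)
  array 1 c = marksFrom c
  array 2 j = base (F j)
  array 3 j = R (base (F j))
  array 4 j = bitsFrom (base (F j))
  array 5 k = popcount (k / β) (k % β)
  array _ k = selectIn β (k / β) (k % β)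

  param : ℕ → ℕ
  param 0 = w ÷ f
  param 1 = f
  param 2 = 2 ^ f
  param 3 = w ÷ ℓ
  param 4 = ℓ
  param 5 = 2 ^ ℓ
  param 6 = β
  param 7 = n
  param 8 = σ
  param 9 = r
  param _ = $

  -- Reducing the parameters makes every word fit outright; `eval-param` undoes the reduction under
  -- a bound.
  word : ℕ → ℕ → ℕ
  word 7 k = pack ℓ (w ÷ ℓ) (λ o → Z (k * (w ÷ ℓ) + o))
  word 8 k = param k %2^ w
  word t k = pack f (w ÷ f) (λ o → array t (k * (w ÷ f) + o))

  words : ℕ
  words = streamLength w n σ r

  memory : Vec ℕ (words * 16)
  memory = tabulate λ i → word (toℕ i % 16) (toℕ i / 16)

  packed-<2^w : ∀ v d → pack v (w ÷ v) d < 2 ^ w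
  packed-<2^w v d = <-≤-trans (pack-< v (w ÷ v) d) (^-monoʳ-≤ 2 (÷-* w v))

  word-<2^w : ∀ t k → word t k < 2 ^ w
  word-<2^w 0 k = packed-<2^w f _
  word-<2^w 1 k = packed-<2^w f _
  word-<2^w 2 k = packed-<2^w f _
  word-<2^w 3 k = packed-<2^w f _
  word-<2^w 4 k = packed-<2^w f _
  word-<2^w 5 k = packed-<2^w f _
  word-<2^w 6 k = packed-<2^w f _
  word-<2^w 7 k = packed-<2^w ℓ _
  word-<2^w 8 k = %2^-< (param k) w
  word-<2^w (suc (suc (suc (suc (suc (suc (suc (suc (suc t))))))))) k = packed-<2^w f _

  memory-<2^w : All (_< 2 ^ w) memory
  memory-<2^w = tabulate⁺ λ i → word-<2^w (toℕ i % 16) (toℕ i / 16)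

  open Values w b 2≤b wide memory public

  eval-word : ∀ {s e k t} → t < 16 → k < words → Eval s e (k * 16 + t) → Eval s (mem e) (word t k)
  eval-word {s} {e} {k} {t} t< k< ev = subst (Eval s (mem e)) content (mem (fromℕ< addr<) (subst (Eval s e) (sym addr≡) ev))
    where
    addr< : k * 16 + t < words * 16
    addr< = ≤-trans (+-monoʳ-< (k * 16) t<) (≤-trans (≤-reflexive (+-comm (k * 16) 16)) (*-monoˡ-≤ 16 k<))
    addr≡ : toℕ (fromℕ< addr<) ≡ k * 16 + t
    addr≡ = Fin.toℕ-fromℕ< addr<
    content : lookup memory (fromℕ< addr<) ≡ word t k
    content = trans (lookup∘tabulate _ (fromℕ< addr<))
      (trans (cong (λ x → word (x % 16) (x / 16)) addr≡) (cong₂ word (row-% k t<) (row-/ k t<)))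

  eval-param : ∀ k {s} {_ : True (k <? 16)} {_ : True (k * 16 + 8 <? 4 ^ 4)} → param k < 2 ^ w → Eval s (parameter k) (param k)
  eval-param k {s} {k<} {lit<} p< = subst (Eval s (parameter k)) (%2^-id w p<)
    (eval-word {k = k} {t = 8} (toWitness {a? = 8 <? 16} _) (≤-trans (toWitness k<) (m≤n+m 16 _)) (eval (val-lit 4 {v = k * 16 + 8} {lit<})))

  b≤w : b ≤ w
  b≤w = ≤-trans (m≤m+n b _) wide

  class : ∀ {k x} → x ≤ k * b → 2 ^ x ≤ 2 ^ (k * b)
  class = ^-monoʳ-≤ 2

  1≤M : 1 ≤ σ + r
  1≤M = ≤-trans 1≤σ (m≤m+n σ r)

  λ≤b : bitLength (σ + r) ≤ b
  λ≤b = log< 1≤M M<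

  f≤3b : f ≤ 3 * b
  f≤3b = +-mono-≤ λ≤b (≤-trans (n≤1+n 3) (≤-trans (+-mono-≤ 2≤b 2≤b) (≤-reflexive (cong (b +_) (sym (+-identityʳ b))))))

  f≤w : f ≤ w
  f≤w = ≤-trans f≤3b (≤-trans (*-monoˡ-≤ b (toWitness {a? = 3 ≤? 64} _)) wide)

  ℓ≤w : ℓ ≤ w
  ℓ≤w = ≤-trans low≤b b≤w

  -- Shared by the header fields of width `f` and the low parts of width `ℓ`. The reduction modulo
  -- `2 ^ v` vanishes for the former by their bound and is the intended value for the latter.
  read : ∀ t p v {s e k} (d : ℕ → ℕ) → 0 < v → v ≤ w → v ≤ 3 * b → t < 16 → t < 4 ^ 2 →
         (∀ i → word t i ≡ pack v (w ÷ v) (λ o → d (i * (w ÷ v) + o))) →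
         Eval s (parameter p) (w ÷ v) → Eval s (parameter (1 + p)) v →
         Eval s (parameter (2 + p)) (2 ^ v) →
         k ÷ (w ÷ v) < words → Val 10 s e k → Val 3 s (fieldE t p e) (d k %2^ v)
  read t p v {s} {e} {k} d v>0 v≤w v≤3b t< t<4² word≡ q-ev v-ev 2^v-ev k< val =
      subst (Eval s (fieldE t p e)) extracted (op (op word-ev shift) 2^v-ev)
    within <-≤-trans (%2^-< (d k) v) (class {3} v≤3b)
    where
    q = w ÷ v
    q>0 : 0 < q
    q>0 = ÷>0 v>0 v≤w
    i = k ÷ q
    o = k rem q
    lit-t : Val 2 s (lit t) t
    lit-t = subst (Eval s (lit t)) (%2^-id w (fits {2} (toWitness {a? = 2 ≤? 64} _) (small {2} t<4²))) lit within small {2} t<4²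
    word-ev : Eval s _ (pack v q (λ o → d (i * q + o)))
    word-ev = subst (Eval s _) (word≡ i) (eval-word t< k<
      (eval (val-add (val-mul (val-div val q-ev) (val-lit 3)) lit-t)))
    shift : Eval s _ (o * v)
    shift = eval (val-mul {k = 3} (val-mod val q-ev) (v-ev within <-≤-trans (n<2^n v) (class {3} v≤3b)))
    extracted : (pack v q (λ o → d (i * q + o)) /2^ (o * v)) rem (2 ^ v) ≡ d k %2^ v
    extracted = trans (rem≡% _ (2 ^ v) {{m^n≢0 2 v}})
      (trans (pack-digit v q (λ o → d (i * q + o)) (rem< k q>0)) (cong (λ x → d x %2^ v) (÷-rem k q)))

  β≤1+λ : β ≤ suc (bitLength (σ + r))
  β≤1+λ = s≤s (m/n≤m (bitLength (σ + r)) 4)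

  β≤f : β ≤ f
  β≤f = ≤-trans β≤1+λ (≤-trans (≤-reflexive (+-comm 1 _)) (+-monoʳ-≤ (bitLength (σ + r)) (s≤s z≤n)))

  β<2^f : β < 2 ^ f
  β<2^f = ≤-<-trans β≤f (n<2^n f)

  2^f<2^w : 2 ^ f < 2 ^ w
  2^f<2^w = fits {4} {2 ^ f} (toWitness {a? = 4 ≤? 64} _) (^-monoʳ-< 2 (s≤s (s≤s z≤n))
    (≤-<-trans f≤3b (+-monoˡ-< (3 * b) (≤-trans (n≤1+n 1) 2≤b))))

  2^ℓ<2^2b : 2 ^ ℓ < 2 ^ (2 * b)
  2^ℓ<2^2b = ^-monoʳ-< 2 (s≤s (s≤s z≤n)) (≤-<-trans low≤b (m<m+n b (≤-trans (≤-trans (n≤1+n 1) 2≤b) (≤-reflexive (sym (+-identityʳ b))))))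

  w<2^w : w < 2 ^ w
  w<2^w = n<2^n w

  N+2r<2^f : N + 2 * r < 2 ^ f
  N+2r<2^f = begin-strict
    N + 2 * r                           ≤⟨ N+2r≤8M r 1≤σ ⟩
    8 * (σ + r)                         <⟨ *-monoʳ-< 8 (n<2^[1+log] (σ + r)) ⟩
    2 ^ 3 * 2 ^ bitLength (σ + r)       ≡⟨ *-comm (2 ^ 3) (2 ^ bitLength (σ + r)) ⟩
    2 ^ bitLength (σ + r) * 2 ^ 3       ≡⟨ ^-distribˡ-+-* 2 (bitLength (σ + r)) 3 ⟨
    2 ^ f                               ∎
    where open ≤-Reasoning

  val-β : ∀ {s} → Val 2 s βE β
  val-β = eval-param 6 (<-trans β<2^f 2^f<2^w) within
    ≤-<-trans β≤1+λ (≤-<-trans (s≤s λ≤b) (≤-<-trans (≤-trans (+-monoˡ-≤ b (≤-trans (n≤1+n 1) 2≤b)) (≤-reflexive (cong (b +_) (sym (+-identityʳ b))))) (n<2^n (2 * b))))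

  val-n : ∀ {s} → Val 1 s nE n
  val-n = eval-param 7 (fits {1} (toWitness {a? = 1 ≤? 64} _) n<′) within n<′
    where n<′ = <-≤-trans n< (≤-reflexive (cong (2 ^_) (sym (+-identityʳ b))))

  σ+r<2^1b : σ + r < 2 ^ (1 * b)
  σ+r<2^1b = <-≤-trans M< (≤-reflexive (cong (2 ^_) (sym (+-identityʳ b))))

  val-σ : ∀ {s} → Val 1 s σE σ
  val-σ = eval-param 8 (fits {1} (toWitness {a? = 1 ≤? 64} _) σ<) within σ<
    where σ< = ≤-<-trans (m≤m+n σ r) σ+r<2^1b

  val-r : ∀ {s} → Val 1 s rE r
  val-r = eval-param 9 (fits {1} (toWitness {a? = 1 ≤? 64} _) r<) within r<
    where r< = ≤-<-trans (m≤n+m r σ) σ+r<2^1b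

  val-$ : ∀ {s} → Val 1 s $E $
  val-$ = eval-param 10 (fits {1} (toWitness {a? = 1 ≤? 64} _) $<) within $<
    where $< = <-trans $<σ (≤-<-trans (m≤m+n σ r) σ+r<2^1b)

  val-header : ∀ t {s e k} {_ : True (t <? 7)} → k < headerCount σ r → array t k < 2 ^ f →
               Val 10 s e k → Val 3 s (header t e) (array t k)
  val-header t {s} {e} {k} {t<7} k< a< val = val-cast (%2^-id f a<)
    (read t 0 f (array t) (≤-trans (s≤s z≤n) β≤f) f≤w f≤3b (≤-trans (toWitness t<7) (toWitness {a? = 7 ≤? 16} _))
      (≤-trans (toWitness t<7) (toWitness {a? = 7 ≤? 16} _)) (packed t (toWitness t<7))
      (eval-param 0 (≤-<-trans (÷≤ w f) w<2^w)) (eval-param 1 (≤-<-trans f≤w w<2^w)) (eval-param 2 2^f<2^w)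
      (≤-<-trans (÷-monoˡ (w ÷ f) (<⇒≤ k<)) (≤-trans (m<m+n _ (s≤s z≤n)) (+-monoˡ-≤ 16 (m≤m+n _ _)))) val)
    where
    packed : ∀ t → t < 7 → ∀ i → word t i ≡ pack f (w ÷ f) (λ o → array t (i * (w ÷ f) + o))
    packed 0 _ i = refl
    packed 1 _ i = refl
    packed 2 _ i = refl
    packed 3 _ i = refl
    packed 4 _ i = refl
    packed 5 _ i = refl
    packed 6 _ i = refl
    packed (suc (suc (suc (suc (suc (suc (suc t))))))) t< i = ⊥-elim (<⇒≱ t< (m≤m+n 7 t))

  val-low : ∀ {s e j} → j ≤ 2 * r + 3 → Val 10 s e j → Val 3 s (fieldE 7 3 e) (Z j %2^ ℓ)
  val-low j≤ val = read 7 3 ℓ Z (m≤n⇒m≤o+n _ (s≤s z≤n)) ℓ≤w (≤-trans low≤b (m≤m+n b _)) (toWitness {a? = 8 ≤? 16} _)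
      (toWitness {a? = 8 ≤? 16} _) (λ i → refl)
      (eval-param 3 (≤-<-trans (÷≤ w ℓ) w<2^w)) (eval-param 4 (≤-<-trans ℓ≤w w<2^w))
      (eval-param 5 (fits {2} {2 ^ ℓ} (toWitness {a? = 2 ≤? 64} _) 2^ℓ<2^2b))
      (≤-<-trans (÷-monoˡ (w ÷ ℓ) j≤) (≤-trans (m<m+n _ (s≤s z≤n)) (+-monoˡ-≤ 16 (m≤n+m _ _)))) val

  blocks : ℕ
  blocks = (N + 2 * r) / β

  index<blocks : ∀ {k} → k ≤ blocks → k < headerCount σ r
  index<blocks k≤ = ≤-trans (s≤s k≤) (≤-trans (≤-reflexive (+-comm 1 blocks)) (m≤m+n _ _))

  index<tables : ∀ {code o} → code < 2 ^ β → o < β → code * β + o < headerCount σ r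
  index<tables {code} {o} code< o< = ≤-trans (+-monoʳ-< (code * β) o<)
    (≤-trans (≤-reflexive (+-comm (code * β) β)) (≤-trans (*-monoˡ-≤ β code<) (m≤n+m _ (blocks + 1))))

  code<2^β : ∀ d → pack 1 β d < 2 ^ β
  code<2^β d = <-≤-trans (pack-< 1 β d) (≤-reflexive (cong (2 ^_) (*-identityʳ β)))

  marks< : ∀ c → marksFrom c < 2 ^ β
  marks< c = code<2^β (λ x → mark (c * β + x))

  bits< : ∀ p → bitsFrom p < 2 ^ β
  bits< p = code<2^β (λ x → bit (p + x))

  module _ {s : Registers} {e : Expr} {i : ℕ} (val : Val 10 s e i) (i<N : i < N) where

    J<2^f : J i < 2 ^ f
    J<2^f = ≤-<-trans (≤-trans (J≤block i) (≤-trans (m/n≤m (W i) β) (<⇒≤ (W≤ i<N)))) N+2r<2^f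

    i<2^f : i < 2 ^ f
    i<2^f = <-trans i<N (≤-<-trans (m≤m+n N _) N+2r<2^f)

    val-quotient : Val 10 s (op div e βE) (i / β)
    val-quotient = val-div val (eval val-β)

    val-code : Val 3 s (header 1 (op div e βE)) (marksFrom (i / β))
    val-code = val-header 1 (index<blocks (/-monoˡ-≤ β (≤-trans (<⇒≤ i<N) (m≤m+n N _))))
      (<-≤-trans (marks< (i / β)) (^-monoʳ-≤ 2 β≤f)) val-quotient

    val-base-rank : Val 3 s (header 0 (op div e βE)) (J (i / β * β))
    val-base-rank = val-header 0 (index<blocks (/-monoˡ-≤ β (≤-trans (<⇒≤ i<N) (m≤m+n N _))))
      (≤-<-trans (Σ-monoˡ mark (m/n*n≤m i β)) J<2^f) val-quotient

    val-block : Val 4 s (blockE e) (J i)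
    val-block = val-cast (sym (J-rank i)) (val-add val-base-rank (val-cast array≡
        (val-header 5 (index<tables {code} (marks< (i / β)) (m%n<n i β)) (≤-<-trans (≤-reflexive array≡) (≤-<-trans popcount≤β β<2^f))
          (raise {6} (val-add {k = 2} (val-mul val-code val-β) (eval (val-mod val (eval val-β)) within <-trans (m%n<n i β) (bound (val-β {s}))))))))
      where
      code = marksFrom (i / β)
      array≡ : array 5 (code * β + i % β) ≡ popcount code (i % β)
      array≡ = cong₂ popcount (row-/ code (m%n<n i β)) (row-% code (m%n<n i β))
      popcount≤β : popcount code (i % β) ≤ β
      popcount≤β = ≤-trans (popcount-≤ code (i % β)) (<⇒≤ (m%n<n i β))

    J<count : J i < headerCount σ r
    J<count = index<blocks (≤-trans (J≤block i) (/-monoˡ-≤ β (<⇒≤ (W≤ i<N))))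

    base< : base i < 2 ^ f
    base< = ≤-<-trans (≤-trans (base≤W i) (<⇒≤ (W≤ i<N))) N+2r<2^f

    val-base : Val 3 s (header 2 (blockE e)) (base i)
    val-base = val-cast (base-first i i<N) (val-header 2 J<count
      (subst (_< 2 ^ f) (sym (base-first i i<N)) base<) (raise val-block))

    val-first : Val 3 s (header 3 (blockE e)) (R (base i))
    val-first = val-cast (cong R (base-first i i<N)) (val-header 3 J<count
      (subst (λ p → R p < 2 ^ f) (sym (base-first i i<N)) (≤-<-trans (R-≤ (base≤W i)) i<2^f)) (raise val-block))

    val-bits : Val 3 s (header 4 (blockE e)) (bitsFrom (base i))
    val-bits = val-cast (cong bitsFrom (base-first i i<N)) (val-header 4 J<count
      (<-≤-trans (bits< (base (F (J i)))) (^-monoʳ-≤ 2 β≤f)) (raise val-block))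

    val-W : Val 4 s (op add (header 2 (blockE e)) (header 6 (op add (op mul (header 4 (blockE e)) βE) (op sub e (header 3 (blockE e)))))) (W i)
    val-W = val-cast (sym (W-select i)) (val-add val-base (val-cast array≡
        (val-header 6 (index<tables {code} (bits< (base i)) (select-index i)) (≤-<-trans (≤-reflexive array≡) (≤-<-trans (selectIn-≤ β code t) β<2^f))
          (raise {6} (val-add {k = 2} (val-mul val-bits val-β)
            (eval (val-sub (R-≤ (base≤W i)) val (eval val-first)) within <-trans (select-index i) (bound (val-β {s}))))))))
      where
      code = bitsFrom (base i)
      t = i ∸ R (base i)
      array≡ : array 6 (code * β + t) ≡ selectIn β code t
      array≡ = cong₂ (selectIn β) (row-/ code (select-index i)) (row-% code (select-index i))

    opaque
      unfolding highE

      val-high : Val 4 s (highE e) (H i)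
      val-high = val-cast (m+n∸n≡m (H i) i) (val-sub (m≤n+m i (H i)) val-W (eval val))

  val-char : ∀ {s e a} → a ≤ σ → Val 10 s e a → Val 4 s (highE e) (C a)
  val-char {a = a} a≤ val = val-cast (H-char a≤) (val-high val (≤-trans (s≤s a≤) (m≤m+n (suc σ) _)))

  opaque
    unfolding highE

    val-entry : ∀ {s e j} → j < 2 * r + 3 → Val 8 s e j → Val 8 s (entryE e) (Z j)
    val-entry {s} {e} {j} j< val = raise {7} (val-cast Z≡ (val-add
        (val-mul (val-sub (≤-trans (m≤m+n r _) (≤-reflexive (sym (H-entry j)))) (val-high index index<) (eval val-r))
          (eval-param 5 (fits {2} {2 ^ ℓ} (toWitness {a? = 2 ≤? 64} _) 2^ℓ<2^2b) within 2^ℓ<2^2b))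
        (val-low (<⇒≤ j<) (raise val))))
      where
      index : Val 10 s (op add e (op add σE (lit 1))) (j + (σ + 1))
      index = raise {9} (val-add val (val-add val-σ (val-lit 1)))
      index< : j + (σ + 1) < N
      index< = ≤-trans (+-monoˡ-< (σ + 1) j<) (≤-reflexive (trans (+-comm (2 * r + 3) (σ + 1)) (cong (_+ (2 * r + 3)) (+-comm σ 1))))
      Z≡ : (H (j + (σ + 1)) ∸ r) * 2 ^ ℓ + Z j %2^ ℓ ≡ Z j
      Z≡ = trans (cong (λ h → (h ∸ r) * 2 ^ ℓ + Z j %2^ ℓ) (H-entry j))
        (trans (cong (λ h → h * 2 ^ ℓ + Z j %2^ ℓ) (m+n∸m≡n r _))
          (trans (+-comm _ (Z j %2^ ℓ)) (sym (m≡m%n+[m/n]*n (Z j) (2 ^ ℓ) {{m^n≢0 2 ℓ}}))))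

-- The space bound

packed-space : ∀ k {v w} → 0 < v → v ≤ w → k ÷ (w ÷ v) * w ≤ 2 * v * k
packed-space k {v} {w} v>0 v≤w = begin
  k ÷ q * w             ≤⟨ *-monoʳ-≤ (k ÷ q) w≤ ⟩
  k ÷ q * (2 * v * q)   ≡⟨ solve (k ÷ q) v q ⟩
  2 * v * (k ÷ q * q)   ≤⟨ *-monoʳ-≤ (2 * v) (÷-* k q) ⟩
  2 * v * k             ∎
  where
  open ≤-Reasoning
  q = w ÷ v
  solve : ∀ x v q → x * (2 * v * q) ≡ 2 * v * (x * q)
  solve = solve-∀
  solve′ : ∀ v q → q * v + q * v ≡ 2 * v * q
  solve′ = solve-∀
  -- A word holds at least one field, so rounding wastes less than half of it.
  w≤ : w ≤ 2 * v * q
  w≤ = begin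
    w                     ≡⟨ ÷-rem w v ⟨
    q * v + w rem v       ≤⟨ +-monoʳ-≤ (q * v) (<⇒≤ (rem< w v>0)) ⟩
    q * v + v             ≡⟨ cong (q * v +_) (*-identityˡ v) ⟨
    q * v + 1 * v         ≤⟨ +-monoʳ-≤ (q * v) (*-monoˡ-≤ v (÷>0 v>0 v≤w)) ⟩
    q * v + q * v         ≡⟨ solve′ v q ⟩
    2 * v * q             ∎

-- The lookup tables are indexed by a quarter of the bits of M, so they are
-- smaller than M by a polynomial factor.
header-space : ∀ σ r → 1 ≤ σ → (let M = σ + r) → indices σ r + 2 * r ≤ 8 * M →
               headerWidth M * headerCount σ r ≤ 432 * M
header-space σ r 1≤σ N≤ = begin
  f * (P / β + 1 + 2 ^ β * β)                     ≤⟨ *-monoˡ-≤ (P / β + 1 + 2 ^ β * β) f≤6β ⟩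
  6 * β * (P / β + 1 + 2 ^ β * β)                 ≡⟨ solve β (P / β) (2 ^ β) ⟩
  6 * (P / β * β) + 6 * β + 6 * (β * (2 ^ β * β)) ≤⟨ +-mono-≤ (+-mono-≤ (*-monoʳ-≤ 6 (≤-trans (m/n*n≤m P β) N≤)) (*-monoʳ-≤ 6 β≤32M)) (*-monoʳ-≤ 6 β²2^β≤32M) ⟩
  6 * (8 * M) + 6 * (32 * M) + 6 * (32 * M)       ≡⟨ solve′ M ⟩
  432 * M                                         ∎
  where
  open ≤-Reasoning
  M = σ + r
  f = headerWidth M
  β = blockBits M
  l = ⌊log₂ M ⌋
  P = indices σ r + 2 * r
  solve : ∀ β x y → 6 * β * (x + 1 + y * β) ≡ 6 * (x * β) + 6 * β + 6 * (β * (y * β))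
  solve = solve-∀
  solve′ : ∀ M → 6 * (8 * M) + 6 * (32 * M) + 6 * (32 * M) ≡ 432 * M
  solve′ = solve-∀
  -- This turns `P / β` fields of `f` bits into `O(P)` bits.
  f≤6β : f ≤ 6 * β
  f≤6β = begin
    suc l + 3                          ≡⟨ cong (_+ 3) (m≡m%n+[m/n]*n (suc l) 4) ⟩
    suc l % 4 + suc l / 4 * 4 + 3      ≤⟨ +-monoˡ-≤ 3 (+-monoˡ-≤ _ (s≤s⁻¹ (m%n<n (suc l) 4))) ⟩
    3 + suc l / 4 * 4 + 3              ≤⟨ m≤m+n _ (2 * (suc l / 4)) ⟩
    3 + suc l / 4 * 4 + 3 + 2 * (suc l / 4) ≡⟨ solve″ (suc l / 4) ⟩
    6 * suc (suc l / 4)                ∎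
    where
    solve″ : ∀ x → 3 + x * 4 + 3 + 2 * x ≡ 6 * suc x
    solve″ = solve-∀
  2^4β≤32M : 2 ^ (4 * β) ≤ 32 * M
  2^4β≤32M = begin
    2 ^ (4 * β)           ≤⟨ ^-monoʳ-≤ 2 4β≤ ⟩
    2 ^ (5 + l)           ≡⟨ ^-distribˡ-+-* 2 5 l ⟩
    32 * 2 ^ l            ≤⟨ *-monoʳ-≤ 32 (2^log≤n M (≤-trans 1≤σ (m≤m+n σ r))) ⟩
    32 * M                ∎
    where
    4β≤ : 4 * β ≤ 5 + l
    4β≤ = ≤-trans (≤-reflexive (trans (*-suc 4 (suc l / 4)) (cong (4 +_) (*-comm 4 (suc l / 4))))) (+-monoʳ-≤ 4 (m/n*n≤m (suc l) 4))
  -- A table has `2 ^ β * β` fields of `O(β)` bits, at most three factors `2 ^ β` in all. With a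
  -- quarter of the bits of `M`, even four of them stay within `32 * M`.
  β²2^β≤32M : β * (2 ^ β * β) ≤ 32 * M
  β²2^β≤32M = begin
    β * (2 ^ β * β)           ≤⟨ *-mono-≤ (<⇒≤ (n<2^n β)) (*-monoʳ-≤ (2 ^ β) (<⇒≤ (n<2^n β))) ⟩
    2 ^ β * (2 ^ β * 2 ^ β)   ≡⟨ cong (2 ^ β *_) (^-distribˡ-+-* 2 β β) ⟨
    2 ^ β * 2 ^ (β + β)       ≡⟨ ^-distribˡ-+-* 2 β (β + β) ⟨
    2 ^ (β + (β + β))         ≤⟨ ^-monoʳ-≤ 2 (≤-trans (m≤m+n _ β) (≤-reflexive (solve‴ β))) ⟩
    2 ^ (4 * β)               ≤⟨ 2^4β≤32M ⟩
    32 * M                    ∎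
    where
    solve‴ : ∀ x → x + (x + x) + x ≡ 4 * x
    solve‴ = solve-∀
  β≤32M : β ≤ 32 * M
  β≤32M = ≤-trans (m≤n*m β (2 ^ β * β) {{m*n≢0 (2 ^ β) β {{m^n≢0 2 β}}}}) (≤-trans (≤-reflexive (*-comm (2 ^ β * β) β)) β²2^β≤32M)

n<r*2^ : ∀ n r → 1 ≤ r → n < r * 2 ^ suc ⌊log₂ n ÷ r ⌋
n<r*2^ n r 1≤r = begin-strict
  n                              ≡⟨ ÷-rem n r ⟨
  n ÷ r * r + n rem r            <⟨ +-monoʳ-< (n ÷ r * r) (rem< n 1≤r) ⟩
  n ÷ r * r + r                  ≡⟨ +-comm _ r ⟩
  suc (n ÷ r) * r                ≤⟨ *-monoˡ-≤ r (n<2^[1+log] (n ÷ r)) ⟩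
  2 ^ suc ⌊log₂ n ÷ r ⌋ * r      ≡⟨ *-comm _ r ⟩
  r * 2 ^ suc ⌊log₂ n ÷ r ⌋      ∎
  where open ≤-Reasoning

module Space {κ n σ r w : ℕ} (ws : WordSize 128 κ n σ w)
             (1≤n : 1 ≤ n) (1≤r : 1 ≤ r) (r≤n : r ≤ n) (1≤σ : 1 ≤ σ)
             (r≤S : r ≤ spaceBound n r σ) where

  open WordSize ws

  b : ℕ
  b = bitLength n + bitLength σ

  sizes : Sizes w b n σ r
  sizes = record
    { 2≤b      = +-mono-≤ {1} {bitLength n} {1} (s≤s z≤n) (s≤s z≤n)
    -- Adding the conditions for positions and for characters yields `128 * b ≤ 2 * w`, which is why
    -- 128 is twice 64.
    ; wide     = *-cancelˡ-≤ 2 (begin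
        2 * (64 * b)                               ≡⟨ solve (bitLength n) (bitLength σ) ⟩
        128 * bitLength n + 128 * bitLength σ      ≤⟨ +-mono-≤ fitsPositions fitsCharacters ⟩
        w + w                                      ≡⟨ cong (w +_) (+-identityʳ w) ⟨
        2 * w                                      ∎)
    ; n<       = <-≤-trans (n<2^[1+log] n) (^-monoʳ-≤ 2 (m≤m+n (bitLength n) (bitLength σ)))
    ; M<       = begin-strict
        σ + r                                ≤⟨ +-monoʳ-≤ σ r≤n ⟩
        σ + n                                <⟨ +-mono-< (n<2^[1+log] σ) (n<2^[1+log] n) ⟩
        2 * 2 ^ ⌊log₂ σ ⌋ + 2 * 2 ^ ⌊log₂ n ⌋ ≤⟨ +≤* (2 ^ ⌊log₂ σ ⌋) (2 ^ ⌊log₂ n ⌋) (m^n>0 2 ⌊log₂ σ ⌋) (m^n>0 2 ⌊log₂ n ⌋) ⟩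
        2 ^ bitLength n * 2 ^ bitLength σ    ≡⟨ ^-distribˡ-+-* 2 (bitLength n) (bitLength σ) ⟨
        2 ^ b                                ∎
    ; 1≤r      = 1≤r
    ; 1≤σ      = 1≤σ
    ; low≤b    = begin
        ⌊log₂ n ÷ r ⌋ + ⌊log₂ σ ⌋ + 2   ≤⟨ +-monoˡ-≤ 2 (+-monoˡ-≤ ⌊log₂ σ ⌋ (⌊log₂⌋-mono-≤ (÷≤ n r))) ⟩
        ⌊log₂ n ⌋ + ⌊log₂ σ ⌋ + 2       ≡⟨ solve₁ ⌊log₂ n ⌋ ⌊log₂ σ ⌋ ⟩
        bitLength n + bitLength σ       ∎
    ; universe = begin
        σ * n + n                               ≡⟨ +-comm (σ * n) n ⟩
        suc σ * n                               ≤⟨ *-mono-≤ (n<2^[1+log] σ) (<⇒≤ (n<r*2^ n r 1≤r)) ⟩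
        2 ^ bitLength σ * (r * 2 ^ suc A)       ≡⟨ solve₂ (2 ^ bitLength σ) r (2 ^ suc A) ⟩
        r * (2 ^ suc A * 2 ^ bitLength σ)       ≡⟨ cong (r *_) (^-distribˡ-+-* 2 (suc A) (bitLength σ)) ⟨
        r * 2 ^ (suc A + bitLength σ)           ≡⟨ cong (λ k → r * 2 ^ k) (solve₁ A ⌊log₂ σ ⌋) ⟨
        r * 2 ^ lowWidth n σ r                  ∎
    }
    where
    open ≤-Reasoning
    A = ⌊log₂ n ÷ r ⌋
    solve : ∀ x y → 2 * (64 * (x + y)) ≡ 128 * x + 128 * y
    solve = solve-∀
    solve₁ : ∀ x y → x + y + 2 ≡ suc x + suc y
    solve₁ = solve-∀
    solve₂ : ∀ x y z → x * (y * z) ≡ y * (z * x)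
    solve₂ = solve-∀
    +≤* : ∀ x y → 1 ≤ x → 1 ≤ y → 2 * x + 2 * y ≤ 2 * y * (2 * x)
    +≤* (suc x) (suc y) _ _ = ≤-trans (m≤m+n _ (2 * x + 2 * y + 4 * (x * y))) (≤-reflexive (solve₃ x y))
      where
      solve₃ : ∀ x y → 2 * suc x + 2 * suc y + (2 * x + 2 * y + 4 * (x * y)) ≡ 2 * suc y * (2 * suc x)
      solve₃ = solve-∀

  space : streamLength w n σ r * 16 * w ≤ 16 * (1758 + 48 * κ) * spaceBound n r σ
  space = begin
    streamLength w n σ r * 16 * w
      ≡⟨ solve₀ (headerCount σ r ÷ (w ÷ f)) ((2 * r + 3) ÷ (w ÷ ℓ)) w ⟩
    16 * (headerCount σ r ÷ (w ÷ f) * w + (2 * r + 3) ÷ (w ÷ ℓ) * w + 16 * w)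
      ≤⟨ *-monoʳ-≤ 16 (+-mono-≤ (+-mono-≤ (packed-space (headerCount σ r) (s≤s z≤n) f≤w) (packed-space (2 * r + 3) 0<ℓ ℓ≤w)) (*-monoʳ-≤ 16 w≤)) ⟩
    16 * (2 * f * headerCount σ r + 2 * ℓ * (2 * r + 3) + 16 * (κ * (3 * S)))
      ≤⟨ *-monoʳ-≤ 16 (+-monoˡ-≤ (16 * (κ * (3 * S))) (+-mono-≤ header≤ low≤)) ⟩
    16 * (1728 * S + 30 * S + 16 * (κ * (3 * S)))
      ≡⟨ solve₁ S κ ⟩
    16 * (1758 + 48 * κ) * S ∎
    where
    open ≤-Reasoning
    open Sizes sizes using (M<; 2≤b; wide; low≤b)
    S = spaceBound n r σ
    A = ⌊log₂ n ÷ r ⌋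
    B = ⌊log₂ σ ⌋
    f = headerWidth (σ + r)
    ℓ = lowWidth n σ r
    solve₀ : ∀ x y w → (x + y + 16) * 16 * w ≡ 16 * (x * w + y * w + 16 * w)
    solve₀ = solve-∀
    solve₁ : ∀ S κ → 16 * (1728 * S + 30 * S + 16 * (κ * (3 * S))) ≡ 16 * (1758 + 48 * κ) * S
    solve₁ = solve-∀
    0<ℓ : 0 < ℓ
    0<ℓ = m≤n⇒m≤o+n _ (s≤s z≤n)
    b≤w : 3 * b ≤ w
    b≤w = ≤-trans (*-monoˡ-≤ b (m≤m+n 3 61)) wide
    ℓ≤w : ℓ ≤ w
    ℓ≤w = ≤-trans low≤b (≤-trans (m≤m+n b _) b≤w)
    f≤w : f ≤ w
    f≤w = ≤-trans (≤-trans (+-mono-≤ (log< (≤-trans 1≤σ (m≤m+n σ r)) M<) (≤-trans (n≤1+n 3) (≤-trans (+-mono-≤ 2≤b 2≤b) (≤-reflexive (cong (b +_) (sym (+-identityʳ b))))))) ≤-refl) b≤w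
    σ≤S : σ ≤ S
    σ≤S = m≤n+m σ _
    rA≤S : r * A ≤ S
    rA≤S = ≤-trans (m≤m+n (r * A) (r * B)) (m≤m+n _ σ)
    -- The whole words must be paid for even if `r` is tiny. As `n < r * 2 ^ suc A` and `r < 2 ^ r`,
    -- the length of `n` is at most `r + suc A`.
    w≤ : w ≤ κ * (3 * S)
    w≤ = ≤-trans logarithmic (*-monoʳ-≤ κ (begin
      bitLength n             ≤⟨ log< 1≤n n<2^ ⟩
      r + suc A               ≡⟨ +-suc r A ⟩
      suc (r + A)             ≤⟨ +-mono-≤ 1≤r (+-monoʳ-≤ r (m≤n*m A r {{>-nonZero 1≤r}})) ⟩
      r + (r + r * A)         ≤⟨ +-mono-≤ r≤S (+-mono-≤ r≤S rA≤S) ⟩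
      S + (S + S)             ≡⟨ cong (λ x → S + (S + x)) (+-identityʳ S) ⟨
      3 * S                   ∎))
      where
      n<2^ : n < 2 ^ (r + suc A)
      n<2^ = <-≤-trans (n<r*2^ n r 1≤r) (≤-trans (*-monoˡ-≤ (2 ^ suc A) (<⇒≤ (n<2^n r))) (≤-reflexive (sym (^-distribˡ-+-* 2 r (suc A)))))
    header≤ : 2 * f * headerCount σ r ≤ 1728 * S
    header≤ = begin
      2 * f * headerCount σ r     ≡⟨ *-assoc 2 f _ ⟩
      2 * (f * headerCount σ r)   ≤⟨ *-monoʳ-≤ 2 (header-space σ r 1≤σ (N+2r≤8M r 1≤σ)) ⟩
      2 * (432 * (σ + r))         ≤⟨ *-monoʳ-≤ 2 (*-monoʳ-≤ 432 (+-mono-≤ σ≤S r≤S)) ⟩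
      2 * (432 * (S + S))         ≡⟨ solve₂ S ⟩
      1728 * S                    ∎
      where
      solve₂ : ∀ S → 2 * (432 * (S + S)) ≡ 1728 * S
      solve₂ = solve-∀
    low≤ : 2 * ℓ * (2 * r + 3) ≤ 30 * S
    low≤ = begin
      2 * ℓ * (2 * r + 3 * 1)               ≤⟨ *-monoʳ-≤ (2 * ℓ) (+-monoʳ-≤ (2 * r) (*-monoʳ-≤ 3 1≤r)) ⟩
      2 * ℓ * (2 * r + 3 * r)               ≡⟨ solve₂ r A B ⟩
      10 * (r * A + r * B + (r + r))        ≤⟨ *-monoʳ-≤ 10 (+-mono-≤ (m≤m+n (r * A + r * B) σ) (+-mono-≤ r≤S r≤S)) ⟩
      10 * (S + (S + S))                    ≡⟨ solve₃ S ⟩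
      30 * S                                ∎
      where
      solve₂ : ∀ r A B → 2 * (A + B + 2) * (2 * r + 3 * r) ≡ 10 * (r * A + r * B + (r + r))
      solve₂ = solve-∀
      solve₃ : ∀ S → 10 * (S + (S + S)) ≡ 30 * S
      solve₃ = solve-∀

-- Registers: 4 is the key, 5 and 6 the range of the binary search, 9 its
-- midpoint, 10 scratch, 7 and 8 the two ranks offset by σ n.

rankE : Expr → Expr
rankE e = entryE (op add e (op add rE (lit 1)))

midE probeE : Expr
midE   = op div (op add (var 5) (var 6)) (lit 2)
probeE = op lt (entryE (op add (var 9) (lit 1))) (var 4)

bisect : Program
bisect = 9 ≔ midE ⨾ ifThenElse probeE (5 ≔ op add (var 9) (lit 1)) (6 ≔ var 9)

openE nextRankE linearE : Expr
openE     = op lt (var 5) (var 6)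
nextRankE = rankE (op add (var 5) (lit 1))
linearE   = op add (rankE (var 5)) (op sub (var 4) (entryE (var 5)))

fromE toE : Expr
fromE = highE (var 0)
toE   = highE (op add (var 0) (lit 1))

-- Registers 10 and `d` receive the two arguments of the minimum in `rank-formula`.
rankInto : Reg → Program
rankInto d =
  5 ≔ fromE ⨾ 6 ≔ toE ⨾ whileDo openE bisect ⨾
  10 ≔ nextRankE ⨾ d ≔ linearE ⨾ ifThenElse (op lt (var 10) (var d)) (d ≔ var 10) skip

-- The 6 in `bisectCost` is the dearer branch, the assignment to register 5.
bisectCost searchCost rankCost : ℕ
bisectCost = (cost midE + 2) + (cost probeE + (1 + 6))
searchCost = 1 + (bisectCost + cost openE)
rankCost   = ((cost fromE + 2) + ((cost toE + 2) + ((cost openE + 1) + tailCost))) + searchCost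
  where tailCost = (cost nextRankE + 2) + ((cost linearE + 2) + (5 + (1 + 4)))

rankLimit : ℕ → ℕ
rankLimit k = (cost fromE + 2) + ((cost toE + 2) + ((cost openE + (k * searchCost + 1)) +
              ((cost nextRankE + 2) + ((cost linearE + 2) + (5 + (1 + 4))))))

rankLimit-≤ : ∀ k → 1 ≤ k → rankLimit k ≤ rankCost * k
rankLimit-≤ k 1≤k = linear (cost fromE + 2) (cost toE + 2) (cost openE) _ searchCost
  where
  linear : ∀ a b c t s → a + (b + ((c + (k * s + 1)) + t)) ≤ ((a + (b + ((c + 1) + t))) + s) * k
  linear a b c t s = begin
    a + (b + ((c + (k * s + 1)) + t))    ≡⟨ rearrange a b c t (k * s) ⟩
    x + k * s                            ≤⟨ +-mono-≤ (m≤m*n x k {{>-nonZero 1≤k}}) (≤-reflexive (*-comm k s)) ⟩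
    x * k + s * k                        ≡⟨ *-distribʳ-+ k x s ⟨
    (x + s) * k                          ∎
    where
    open ≤-Reasoning
    x = a + (b + ((c + 1) + t))
    rearrange : ∀ a b c t y → a + (b + ((c + (y + 1)) + t)) ≡ (a + (b + ((c + 1) + t))) + y
    rearrange = solve-∀

-- A terminator preceding a nonempty pattern occurs nowhere, although the BWT
-- may contain it inside the interval.
rejectE : Expr
rejectE = op mul (op eq (var 0) $E) (op lt (op add (var 3) (lit 1)) (op add nE (var 2)))

loE hiE leftE rightE : Expr
loE    = op add (op mul (var 0) nE) (var 2)
hiE    = op add (op mul (var 0) nE) (op add (var 3) (lit 1))
leftE  = op sub (var 7) (op mul σE nE)
rightE = op sub (op sub (var 8) (op mul σE nE)) (lit 1)

queryCost : ℕ
queryCost = (cost (var 1) + (1 + (cost rejectE + (1 + ((cost loE + 2) + ((cost hiE + 2) + tailCost)))))) + 2 * rankCost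
  where tailCost = 5 + (1 + ((cost leftE + 2) + (cost rightE + 2)))

queryLimit : ℕ → ℕ
queryLimit k = cost (var 1) + (1 + (cost rejectE + (1 + ((cost loE + 2) + (rankLimit k + ((cost hiE + 2) +
  (rankLimit k + (5 + (1 + ((cost leftE + 2) + (cost rightE + 2)))))))))))

queryLimit-≤ : ∀ k → 1 ≤ k → queryLimit k ≤ queryCost * k
queryLimit-≤ k 1≤k = linear (cost (var 1)) (cost rejectE) (cost loE + 2) (cost hiE + 2) _ (rankLimit k) rankCost (rankLimit-≤ k 1≤k)
  where
  linear : ∀ a b c d t R r → R ≤ r * k →
    a + (1 + (b + (1 + (c + (R + (d + (R + t))))))) ≤ ((a + (1 + (b + (1 + (c + (d + t)))))) + 2 * r) * k
  linear a b c d t R r R≤ = begin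
    a + (1 + (b + (1 + (c + (R + (d + (R + t)))))))  ≡⟨ rearrange a b c d t R ⟩
    x + 2 * R                                        ≤⟨ +-mono-≤ (m≤m*n x k {{>-nonZero 1≤k}}) (*-monoʳ-≤ 2 R≤) ⟩
    x * k + 2 * (r * k)                              ≡⟨ cong (x * k +_) (*-assoc 2 r k) ⟨
    x * k + 2 * r * k                                ≡⟨ *-distribʳ-+ k x (2 * r) ⟨
    (x + 2 * r) * k                                  ∎
    where
    open ≤-Reasoning
    x = a + (1 + (b + (1 + (c + (d + t)))))
    rearrange : ∀ a b c d t R → a + (1 + (b + (1 + (c + (R + (d + (R + t))))))) ≡ (a + (1 + (b + (1 + (c + (d + t)))))) + 2 * R
    rearrange = solve-∀

toBit-yes : ∀ {u v} → u < v → toBit (u <ᵇ v) ≡ 1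
toBit-yes {u} {v} u<v with u <ᵇ v in u<ᵇv
... | true  = refl
... | false = ⊥-elim (subst T u<ᵇv (<⇒<ᵇ u<v))

toBit-no : ∀ {u v} → v ≤ u → toBit (u <ᵇ v) ≡ 0
toBit-no {u} {v} v≤u with u <ᵇ v in u<ᵇv
... | false = refl
... | true  = ⊥-elim (<⇒≱ (<ᵇ⇒< u v (subst T (sym u<ᵇv) _)) v≤u)

-- One program for all texts and word sizes: `n`, `σ`, `r`, the terminator, `β` and the field widths
-- are read from the parameters in memory.
query : Program
query = ifThenElse (var 1)
  (ifThenElse rejectE (1 ≔ lit 0)
    (4 ≔ loE ⨾ rankInto 7 ⨾ 4 ≔ hiE ⨾ rankInto 8 ⨾
     ifThenElse (op lt (var 7) (var 8)) (2 ≔ leftE ⨾ 3 ≔ rightE) (1 ≔ lit 0)))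
  skip

-- Correctness of the binary search and of the query

module Midpoint {lo hi k : ℕ} (lo<hi : lo < hi) (range : hi ∸ lo < 2 ^ suc k) where

  mid d : ℕ
  mid = (lo + hi) / 2
  d = hi ∸ lo

  lo+d≡hi : lo + d ≡ hi
  lo+d≡hi = m+[n∸m]≡n (<⇒≤ lo<hi)

  mid≡ : mid ≡ lo + d / 2
  mid≡ = begin
    (lo + hi) / 2           ≡⟨ cong (λ h → (lo + h) / 2) lo+d≡hi ⟨
    (lo + (lo + d)) / 2     ≡⟨ cong (_/ 2) (+-assoc lo lo d) ⟨
    (lo + lo + d) / 2       ≡⟨ cong (λ x → (x + d) / 2) (trans (cong (lo +_) (sym (+-identityʳ lo))) (*-comm 2 lo)) ⟩
    (lo * 2 + d) / 2        ≡⟨ +-distrib-/-∣ˡ d (divides-refl lo) ⟩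
    lo * 2 / 2 + d / 2      ≡⟨ cong (_+ d / 2) (m*n/n≡m lo 2) ⟩
    lo + d / 2              ∎
    where open ≡-Reasoning

  d>0 : 0 < d
  d>0 = m<n⇒0<n∸m lo<hi

  mid<hi : mid < hi
  mid<hi = subst₂ _<_ (sym mid≡) lo+d≡hi (+-monoʳ-< lo (m/n<m d 2 {{>-nonZero d>0}} (s≤s (s≤s z≤n))))

  half< : d / 2 < 2 ^ k
  half< = m<n*o⇒m/o<n {d} {2 ^ k} (<-≤-trans range (≤-reflexive (*-comm 2 (2 ^ k))))

  left< : mid ∸ lo < 2 ^ k
  left< = subst (_< 2 ^ k) (sym (trans (cong (_∸ lo) mid≡) (m+n∸m≡n lo _))) half<

  -- Leaving out `mid` itself makes up for the rounding when `d` is odd.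
  right< : hi ∸ suc mid < 2 ^ k
  right< = ≤-<-trans (m≤n+o⇒m∸n≤o hi (suc mid) (begin
    hi                                ≡⟨ lo+d≡hi ⟨
    lo + d                            ≡⟨ cong (lo +_) (m≡m%n+[m/n]*n d 2) ⟩
    lo + (d % 2 + d / 2 * 2)          ≤⟨ +-monoʳ-≤ lo (+-monoˡ-≤ _ (s≤s⁻¹ (m%n<n d 2))) ⟩
    lo + (1 + d / 2 * 2)              ≡⟨ cong (λ x → lo + (1 + x)) (trans (*-comm (d / 2) 2) (cong (d / 2 +_) (+-identityʳ (d / 2)))) ⟩
    lo + (1 + (d / 2 + d / 2))        ≡⟨ +-suc lo _ ⟩
    suc (lo + (d / 2 + d / 2))        ≡⟨ cong suc (+-assoc lo (d / 2) (d / 2)) ⟨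
    suc (lo + d / 2 + d / 2)          ≡⟨ cong (λ x → suc (x + d / 2)) mid≡ ⟨
    suc mid + d / 2                   ∎)) half<
    where open ≤-Reasoning

module RankQuery {w b n σ r : ℕ} (sizes : Sizes w b n σ r) ($ : ℕ) ($<σ : $ < σ)
                 {B Start : ℕ → Set} (B? : ∀ x → Dec (B x)) (Start? : ∀ x → Dec (Start x))
                 (continue : ∀ x → B (suc x) → ¬ Start (suc x) → B x) where

  U : ℕ
  U = σ * n

  open RunRank B? Start? continue U

  module Answer (starts≤r : starts U ≤ r) (rank≤n : ∀ x → rank x ≤ n) where

    -- `Structure` asks for a bound at every `a`, whereas `starts` is known to be at most `r` only
    -- up to `U`. The minimum extends the bound.
    C : ℕ → ℕ
    C a = starts (a * n) ⊓ r

    C-step : ∀ a → C a ≤ C (suc a)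
    C-step a = ⊓-monoˡ-≤ r (starts-mono (m≤n+m (a * n) n))

    C≤r : ∀ a → C a ≤ r
    C≤r a = m⊓n≤n (starts (a * n)) r

    C≡ : ∀ {a} → a ≤ σ → C a ≡ starts (a * n)
    C≡ a≤ = m≤n⇒m⊓n≡m (≤-trans (starts-mono (*-monoˡ-≤ n a≤)) starts≤r)

    -- No start exceeds `U`, so adding `U` to the ranks keeps the sequence nondecreasing where the
    -- two halves meet.
    Z : ℕ → ℕ
    Z j with j ≤? r
    ... | yes _ = start j
    ... | no _  = U + rank (start (j ∸ suc r))

    Z-step : ∀ j → Z j ≤ Z (suc j)
    Z-step j with j ≤? r | suc j ≤? r
    ... | yes _ | yes _   = start-mono (n≤1+n j)
    ... | yes _ | no _    = ≤-trans (start-≤ j) (m≤m+n U _)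
    ... | no j≰ | yes sj≤ = ⊥-elim (j≰ (<⇒≤ sj≤))
    ... | no j≰ | no _    = +-monoʳ-≤ U (rank-mono {start (j ∸ suc r)} (start-mono (∸-monoˡ-≤ (suc r) (n≤1+n j))))

    Z≤ : ∀ j → Z j ≤ U + n
    Z≤ j with j ≤? r
    ... | yes _ = ≤-trans (start-≤ j) (m≤m+n U n)
    ... | no _  = +-monoʳ-≤ U (rank≤n (start (j ∸ suc r)))

    Z-start : ∀ {k} → k ≤ r → Z k ≡ start k
    Z-start {k} k≤ with k ≤? r
    ... | yes _ = refl
    ... | no k≰ = ⊥-elim (k≰ k≤)

    Z-rank : ∀ k → Z (k + (r + 1)) ≡ U + rank (start k)
    Z-rank k with k + (r + 1) ≤? r
    ... | yes ≤r = ⊥-elim (n≮n r (≤-trans (≤-reflexive (+-comm 1 r)) (≤-trans (m≤n+m (r + 1) k) ≤r)))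
    ... | no _   = cong (λ j → U + rank (start j)) (trans (cong (k + (r + 1) ∸_) (+-comm 1 r)) (m+n∸n≡m k (r + 1)))

    open Structure sizes $ $<σ C Z C-step C≤r Z-step Z≤ public

    val-from : ∀ {s e a} → a ≤ σ → Val 10 s e a → Val 4 s (highE e) (starts (a * n))
    val-from a≤ val = val-cast (C≡ a≤) (val-char a≤ val)

    val-start : ∀ {s e k} → k ≤ r → Val 8 s e k → Val 8 s (entryE e) (start k)
    val-start k≤ val = val-cast (Z-start k≤)
      (val-entry (≤-trans (s≤s k≤) (≤-trans (≤-reflexive (+-comm 1 r)) (+-mono-≤ (m≤m+n r _) (s≤s z≤n)))) val)

    val-rank : ∀ {s e k} → k ≤ suc r → Val 6 s e k → Val 8 s (rankE e) (U + rank (start k))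
    val-rank {k = k} k≤ val = val-cast (Z-rank k) (val-entry index< (raise (val-add val (val-add val-r (val-lit 1)))))
      where
      index< : k + (r + 1) < 2 * r + 3
      index< = ≤-trans (s≤s (+-monoˡ-≤ (r + 1) k≤)) (≤-reflexive (trans (cong (λ x → suc (suc (r + x))) (trans (+-comm r 1) (cong suc (sym (+-identityʳ r)))))
        (trans (cong (λ x → suc (suc x)) (+-suc r (r + 0))) (+-comm 3 (2 * r)))))

    ≤r-bound : ∀ {v} → v ≤ r → v < 2 ^ (1 * b)
    ≤r-bound v≤ = ≤-<-trans v≤ (bound (val-r {λ _ → 0}))

    ≤U-bound : ∀ {v} → v ≤ U → v < 2 ^ (2 * b)
    ≤U-bound v≤ = ≤-<-trans v≤ (bound (val-mul (val-σ {λ _ → 0}) val-n))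

    Kept : Registers → Registers → Set
    Kept s s′ = ∀ y → y ≢ 5 → y ≢ 6 → y ≢ 9 → s′ y ≡ s y

    Search : ℕ → ℕ → ℕ → Registers → Set
    Search k v x s = Σ[ s′ ∈ Registers ]
      ExecLoop openE bisect s v (k * searchCost + 1) s′ × s′ 5 ≡ starts x × Kept s s′

    iterate : ∀ k {u v s s₁} x → u ≢ 0 → Exec bisect s bisectCost s₁ → Eval s₁ openE v →
              Kept s s₁ → Search k v x s₁ → Search (suc k) u x s
    iterate k x u≢0 ex ev kept (s′ , rest , s′5 , kept′) = s′
      , (λ ρ ag same → let t , ρ′ , t≤ , run = loop-step {openE} {bisect} u≢0 ex ev rest ρ ag same in
           t , ρ′ , ≤-trans t≤ (≤-reflexive (sym (+-assoc searchCost (k * searchCost) 1))) , run)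
      , s′5 , λ y y≢5 y≢6 y≢9 → trans (kept′ y y≢5 y≢6 y≢9) (kept y y≢5 y≢6 y≢9)

    module _ {x : ℕ} (x≤U : x ≤ U) where

      val-open : ∀ {s lo hi} → s 5 ≡ lo → s 6 ≡ hi → lo ≤ r → hi ≤ r → Val 1 s openE (toBit (lo <ᵇ hi))
      val-open s5 s6 lo≤r hi≤r = val-lt (eval (val-var {1} s5 (≤r-bound lo≤r))) (eval (val-var {1} s6 (≤r-bound hi≤r)))

      -- The invariant is `lo ≤ starts x ≤ hi`. The probe `start (suc mid) < x` is equivalent to
      -- `mid < starts x`, and `k` is the number of halvings left.
      search : ∀ k {lo hi} → lo ≤ starts x → starts x ≤ hi → hi ≤ r → hi ∸ lo < 2 ^ k →
               ∀ s → s 4 ≡ x → s 5 ≡ lo → s 6 ≡ hi → Search k (toBit (lo <ᵇ hi)) x s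
      search k {lo} {hi} lo≤ ≤hi hi≤r range s s4 s5 s6 with lo <? hi
      ... | no lo≮hi = s
          , (λ ρ ag same → let t , ρ′ , t≤ , run = loop-stop {openE} {bisect} (toBit-no (≮⇒≥ lo≮hi)) ρ ag same in
               t , ρ′ , ≤-trans t≤ (m≤n+m 1 (k * searchCost)) , run)
          , trans s5 (≤-antisym lo≤ (≤-trans ≤hi (≮⇒≥ lo≮hi))) , λ _ _ _ _ → refl
      search zero {lo} {hi} lo≤ ≤hi hi≤r range s s4 s5 s6 | yes lo<hi =
        ⊥-elim (<⇒≱ range (m<n⇒0<n∸m lo<hi))
      search (suc k) {lo} {hi} lo≤ ≤hi hi≤r range s s4 s5 s6 | yes lo<hi = answer
        where
        open Midpoint {lo} {hi} {k} lo<hi range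
        mid≤r : suc mid ≤ r
        mid≤r = ≤-trans mid<hi hi≤r
        lo≤r : lo ≤ r
        lo≤r = ≤-trans lo≤ (≤-trans ≤hi hi≤r)
        s₁ : Registers
        s₁ = s [ 9 ↦ mid ]
        val-mid : Val 2 s midE mid
        val-mid = val-div (val-add (val-var {1} s5 (≤r-bound lo≤r)) (val-var {1} s6 (≤r-bound hi≤r))) (eval (val-lit 1))
        val-next : Val 2 s₁ (op add (var 9) (lit 1)) (suc mid)
        val-next = val-cast (+-comm mid 1) (val-add (val-var {1} refl (≤r-bound (≤-trans (n≤1+n mid) mid≤r))) (val-lit 1))
        probe : Eval s₁ probeE (toBit (start (suc mid) <ᵇ x))
        probe = eval (val-lt (eval (val-start mid≤r (raise val-next))) (eval (val-var {2} s4 (≤U-bound x≤U))))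
        open? : toBit (lo <ᵇ hi) ≢ 0
        open? ≡0 = 1+n≢0 (trans (sym (toBit-yes lo<hi)) ≡0)
        set-mid : Exec (9 ≔ midE) s (cost midE + 2) s₁
        set-mid = exec-assign (toWitness {a? = 9 <? stack} _) (eval val-mid)
        answer : Search (suc k) (toBit (lo <ᵇ hi)) x s
        answer with start (suc mid) <? x
        ... | yes start< = iterate k x open?
            (set-mid then exec-if≢0 (λ ≡0 → 1+n≢0 (trans (sym (toBit-yes start<)) ≡0)) probe
              (exec-assign (toWitness {a? = 5 <? stack} _) (eval val-next)))
            (eval (val-open refl s6 mid≤r hi≤r))
            (λ y y≢5 y≢6 y≢9 → trans (update-other s₁ _ y≢5) (update-other s _ y≢9))
            (search k (start<⇒ x≤U start<) ≤hi hi≤r right< (s₁ [ 5 ↦ suc mid ]) s4 refl s6)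
        ... | no start≮ = iterate k x open?
            (set-mid then exec-if≡0 (toBit-no (≮⇒≥ start≮)) probe
              (exec-weaken (m≤m+n 4 2) (λ _ _ → refl) (exec-assign (toWitness {a? = 6 <? stack} _)
                (eval (val-var {1} refl (≤r-bound (≤-trans (n≤1+n mid) mid≤r)))))))
            (eval (val-open s5 refl lo≤r (≤-trans (n≤1+n mid) mid≤r)))
            (λ y y≢5 y≢6 y≢9 → trans (update-other s₁ _ y≢6) (update-other s _ y≢9))
            (search k lo≤ (≮⇒≥ λ mid< → start≮ (start<⇐ mid<)) (≤-trans (n≤1+n mid) mid≤r) left<
              (s₁ [ 6 ↦ mid ]) s4 s5 refl)

    module _ {x : ℕ} (x≤U : x ≤ U) {a : ℕ} (a<σ : a < σ) (lower : a * n ≤ x) (upper : x ≤ suc a * n)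
             (k : ℕ) (range : starts (suc a * n) ∸ starts (a * n) < 2 ^ k) where

      -- If the interval ends at the last index, the key is `(a + 1) n` and belongs to the next row.
      -- The row counts still enclose `starts x`, which only counts positions before `x`.
      rank-exec : ∀ d → d < stack → d ≢ 10 → ∀ s → s 0 ≡ a → s 4 ≡ x →
        Σ[ s′ ∈ Registers ] Exec (rankInto d) s (rankLimit k) s′ × s′ d ≡ U + rank x
          × (∀ y → y ≢ 5 → y ≢ 6 → y ≢ 9 → y ≢ 10 → y ≢ d → s′ y ≡ s y)
      rank-exec d d< d≢10 s s0 s4 = outcome
        where
        t p q : ℕ
        t = starts x
        p = U + rank (start (suc t))
        q = (U + rank (start t)) + (x ∸ start t)
        u v : ℕ
        u = starts (a * n)
        v = starts (suc a * n)
        v≤r : v ≤ r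
        v≤r = ≤-trans (starts-mono (*-monoˡ-≤ n a<σ)) starts≤r
        t≤r : t ≤ r
        t≤r = ≤-trans (starts-mono x≤U) starts≤r
        a-bound : a < 2 ^ (1 * b)
        a-bound = <-trans a<σ (bound (val-σ {s}))
        s₁ s₂ : Registers
        s₁ = s [ 5 ↦ u ]
        s₂ = s₁ [ 6 ↦ v ]
        val-u : Val 4 s fromE u
        val-u = val-from (<⇒≤ a<σ) (raise (val-var {1} s0 a-bound))
        val-v : Val 4 s₁ toE v
        val-v = val-from a<σ (raise (val-cast (+-comm a 1) (val-add (val-var {1} s0 a-bound) (val-lit 1))))
        found : Search k (toBit (u <ᵇ v)) x s₂
        found = search x≤U k (starts-mono lower) (starts-mono upper) v≤r range s₂ s4 refl refl
        s₃ s₄ s₅ : Registers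
        s₃ = proj₁ found
        s₄ = s₃ [ 10 ↦ p ]
        s₅ = s₄ [ d ↦ q ]
        s₃5 : s₃ 5 ≡ t
        s₃5 = proj₁ (proj₂ (proj₂ found))
        kept : Kept s₂ s₃
        kept = proj₂ (proj₂ (proj₂ found))
        s₃4 : s₃ 4 ≡ x
        s₃4 = trans (kept 4 (λ ()) (λ ()) (λ ())) s4
        val-t : ∀ {s} → s 5 ≡ t → Val 1 s (var 5) t
        val-t s5 = val-var {1} s5 (≤r-bound t≤r)
        val-p : Val 8 s₃ nextRankE p
        val-p = val-rank (s≤s t≤r) (raise (val-cast (+-comm t 1) (val-add (val-t s₃5) (val-lit 1))))
        val-q : Val 9 s₄ linearE q
        val-q = val-add (val-rank (m≤n⇒m≤1+n t≤r) (raise (val-t s₃5)))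
          (val-sub (start-starts x) (raise {2} {8} (val-var {2} s₃4 (≤U-bound x≤U))) (eval (val-start t≤r (raise (val-t s₃5)))))
        minimum : p ⊓ q ≡ U + rank x
        minimum = begin
          p ⊓ q                                            ≡⟨ cong (p ⊓_) (+-assoc U _ _) ⟩
          p ⊓ (U + (rank (start t) + (x ∸ start t)))       ≡⟨ +-distribˡ-⊓ U _ _ ⟨
          U + rank (start (suc t)) ⊓ (rank (start t) + (x ∸ start t)) ≡⟨ cong (U +_) (rank-formula x≤U) ⟨
          U + rank x                                       ∎
          where open ≡-Reasoning
        frame : ∀ y → y ≢ 5 → y ≢ 6 → y ≢ 9 → y ≢ 10 → y ≢ d → s₅ y ≡ s y
        frame y y≢5 y≢6 y≢9 y≢10 y≢d = trans (update-other s₄ _ y≢d) (trans (update-other s₃ _ y≢10)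
          (trans (kept y y≢5 y≢6 y≢9) (trans (update-other s₁ _ y≢6) (update-other s _ y≢5))))
        s₅10 : s₅ 10 ≡ p
        s₅10 = update-other s₄ q (λ 10≡d → d≢10 (sym 10≡d))
        s₅d : s₅ d ≡ q
        s₅d = update-same s₄ d q
        val-10 : Val 8 s₅ (var 10) p
        val-10 = val-var {8} s₅10 (bound val-p)
        val-d : Eval s₅ (var d) q
        val-d = subst (Eval s₅ (var d)) s₅d (var d<)
        prologue : ∀ {T s′} → Exec (ifThenElse (op lt (var 10) (var d)) (d ≔ var 10) skip) s₅ T s′ →
                   Exec (rankInto d) s _ s′
        prologue {T} {s′} ex = exec-assign {x = 5} (toWitness {a? = 5 <? stack} _) (eval val-u) then
          exec-assign {x = 6} (toWitness {a? = 6 <? stack} _) (eval val-v) then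
          exec-while {e = openE} {p = bisect} (eval (val-open x≤U {s₂} refl refl (≤-trans (starts-mono (*-monoˡ-≤ n (n≤1+n a))) v≤r) v≤r)) (proj₁ (proj₂ found)) then
          exec-assign {x = 10} (toWitness {a? = 10 <? stack} _) (eval val-p) then
          exec-assign {x = d} d< (eval val-q) then ex
        outcome : Σ[ s′ ∈ Registers ] Exec (rankInto d) s (rankLimit k) s′ × s′ d ≡ U + rank x
          × (∀ y → y ≢ 5 → y ≢ 6 → y ≢ 9 → y ≢ 10 → y ≢ d → s′ y ≡ s y)
        outcome with p <? q
        ... | yes p<q = s₅ [ d ↦ p ]
          , prologue (exec-if≢0 (λ ≡0 → 1+n≢0 (trans (sym (toBit-yes p<q)) ≡0)) (eval (val-lt (eval val-10) val-d)) (exec-assign d< (eval val-10)))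
          , trans (update-same s₅ d p) (trans (sym (m≤n⇒m⊓n≡m (<⇒≤ p<q))) minimum)
          , λ y y≢5 y≢6 y≢9 y≢10 y≢d → trans (update-other s₅ p y≢d) (frame y y≢5 y≢6 y≢9 y≢10 y≢d)
        ... | no p≮q = s₅
          , prologue (exec-if≡0 (toBit-no (≮⇒≥ p≮q)) (eval (val-lt (eval val-10) val-d)) (exec-weaken (m≤m+n 1 3) (λ _ _ → refl) exec-skip))
          , trans s₅d (trans (sym (m≥n⇒m⊓n≡n (≮⇒≥ p≮q))) minimum)
          , frame

    exec-idle : ∀ {s} → s 1 ≡ 0 → Exec query s (queryLimit 1) s
    exec-idle {s} s1 = exec-weaken (+-monoʳ-≤ 2 (s≤s (m≤n⇒m≤o+n (cost rejectE) (s≤s z≤n)))) (λ _ _ → refl)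
      (exec-if≡0 {e = var 1} s1 (var (toWitness {a? = 1 <? stack} _)) exec-skip)

    module _ {a i j : ℕ} (a<σ : a < σ) (i<n : i < n) (j<n : j < n)
             {s : Registers} (s0 : s 0 ≡ a) (s1 : s 1 ≡ 1) (s2 : s 2 ≡ i) (s3 : s 3 ≡ j) where

      n-bound : ∀ {v} → v ≤ n → v < 2 ^ (1 * b)
      n-bound v≤ = ≤-<-trans v≤ (bound (val-n {s}))

      a-bound : a < 2 ^ (1 * b)
      a-bound = <-trans a<σ (bound (val-σ {s}))

      val-j+1 : ∀ {s} → s 3 ≡ j → Val 2 s (op add (var 3) (lit 1)) (j + 1)
      val-j+1 s3 = val-add (val-var {1} s3 (n-bound (<⇒≤ j<n))) (val-lit 1)

      val-reject : Eval s rejectE (toBit (a ≡ᵇ $) * toBit (j + 1 <ᵇ n + i))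
      val-reject = eval (val-mul (val-eq (eval (val-var {1} s0 a-bound)) (eval val-$))
        (val-lt (eval (val-j+1 s3)) (eval (val-add val-n (val-var {1} s2 (n-bound (<⇒≤ i<n)))))))

      val-flag : Eval s (var 1) 1
      val-flag = subst (Eval s (var 1)) s1 (var (toWitness {a? = 1 <? stack} _))

      exec-reject : toBit (a ≡ᵇ $) * toBit (j + 1 <ᵇ n + i) ≢ 0 →
                    Exec query s (queryLimit 1) (s [ 1 ↦ 0 ])
      exec-reject reject = exec-weaken (+-monoʳ-≤ 3 (+-monoʳ-≤ (cost rejectE) (s≤s (m≤m+n 3 _))))
        (λ _ _ → refl)
        (exec-if≢0 {e = var 1} (λ ()) val-flag
          (exec-if≢0 reject val-reject (exec-assign (toWitness {a? = 1 <? stack} _) (eval (val-lit 0 {v = 0})))))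

      lo hi : ℕ
      lo = a * n + i
      hi = a * n + (j + 1)

      Answers : Registers → Set
      Answers s′ = (rank lo < rank hi → s′ 1 ≡ 1 × s′ 2 ≡ rank lo × s′ 3 ≡ rank hi ∸ 1)
                 × (rank hi ≤ rank lo → s′ 1 ≡ 0)

      exec-query : toBit (a ≡ᵇ $) * toBit (j + 1 <ᵇ n + i) ≡ 0 →
                   ∀ k → starts (suc a * n) ∸ starts (a * n) < 2 ^ k →
                   Σ[ s′ ∈ Registers ] Exec query s (queryLimit k) s′ × Answers s′
      exec-query ¬reject k range = outcome
        where
        row : a * n + n ≤ suc a * n
        row = ≤-reflexive (+-comm (a * n) n)
        row≤U : a * n + n ≤ U
        row≤U = ≤-trans row (*-monoˡ-≤ n a<σ)
        j+1≤n : j + 1 ≤ n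
        j+1≤n = ≤-trans (≤-reflexive (+-comm j 1)) j<n
        lo≤ : lo ≤ a * n + n
        lo≤ = +-monoʳ-≤ (a * n) (<⇒≤ i<n)
        hi≤ : hi ≤ a * n + n
        hi≤ = +-monoʳ-≤ (a * n) j+1≤n
        s₁ = s [ 4 ↦ lo ]
        first = rank-exec (≤-trans lo≤ row≤U) a<σ (m≤m+n _ i) (≤-trans lo≤ row) k range
                  7 (toWitness {a? = 7 <? stack} _) (λ ()) s₁ s0 refl
        s₂ = proj₁ first
        kept₂ = proj₂ (proj₂ (proj₂ first))
        s₃ = s₂ [ 4 ↦ hi ]
        s₂0 : s₂ 0 ≡ a
        s₂0 = trans (kept₂ 0 (λ ()) (λ ()) (λ ()) (λ ()) (λ ())) s0
        s₂3 : s₂ 3 ≡ j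
        s₂3 = trans (kept₂ 3 (λ ()) (λ ()) (λ ()) (λ ()) (λ ())) s3
        second = rank-exec (≤-trans hi≤ row≤U) a<σ (m≤m+n _ (j + 1)) (≤-trans hi≤ row) k range
                   8 (toWitness {a? = 8 <? stack} _) (λ ()) s₃ s₂0 refl
        s₄ = proj₁ second
        kept₄ = proj₂ (proj₂ (proj₂ second))
        rank-bound : ∀ x → U + rank x < 2 ^ (3 * b)
        rank-bound x = ≤-<-trans (+-monoʳ-≤ U (rank≤n x)) (bound (val-add (val-mul (val-σ {s}) val-n) val-n))
        s₄7 : s₄ 7 ≡ U + rank lo
        s₄7 = trans (kept₄ 7 (λ ()) (λ ()) (λ ()) (λ ()) (λ ())) (proj₁ (proj₂ (proj₂ first)))
        s₄8 : s₄ 8 ≡ U + rank hi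
        s₄8 = proj₁ (proj₂ (proj₂ second))
        s₄1 : s₄ 1 ≡ 1
        s₄1 = trans (kept₄ 1 (λ ()) (λ ()) (λ ()) (λ ()) (λ ())) (trans (kept₂ 1 (λ ()) (λ ()) (λ ()) (λ ()) (λ ())) s1)
        val-key : Val 3 s loE lo
        val-key = val-add (val-mul (val-var {1} s0 a-bound) val-n) (val-var {1} s2 (n-bound (<⇒≤ i<n)))
        val-key′ : Val 3 s₂ hiE hi
        val-key′ = val-add (val-mul (val-var {1} s₂0 a-bound) val-n) (val-j+1 s₂3)
        val-7 : Val 3 s₄ (var 7) (U + rank lo)
        val-7 = val-var {3} s₄7 (rank-bound lo)
        val-8 : ∀ {s} → s 8 ≡ U + rank hi → Val 3 s (var 8) (U + rank hi)
        val-8 s8 = val-var {3} s8 (rank-bound hi)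
        val-compare : Eval s₄ (op lt (var 7) (var 8)) (toBit (U + rank lo <ᵇ U + rank hi))
        val-compare = eval (val-lt (eval val-7) (eval (val-8 s₄8)))
        val-left : Val 3 s₄ leftE (rank lo)
        val-left = val-cast (m+n∸m≡n U _) (val-sub (m≤m+n U _) val-7 (eval (val-mul val-σ val-n)))
        val-right : ∀ {s} → s 8 ≡ U + rank hi → 1 ≤ rank hi → Val 3 s rightE (rank hi ∸ 1)
        val-right s8 1≤ = val-sub 1≤
          (val-cast (m+n∸m≡n U _) (val-sub (m≤m+n U _) (val-8 s8) (eval (val-mul val-σ val-n)))) (eval (val-lit 1))
        prologue : ∀ {T s′} → Exec (ifThenElse (op lt (var 7) (var 8)) (2 ≔ leftE ⨾ 3 ≔ rightE) (1 ≔ lit 0)) s₄ T s′ →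
                   Exec query s _ s′
        prologue ex = exec-if≢0 {e = var 1} (λ ()) val-flag (exec-if≡0 ¬reject val-reject
          (exec-assign {x = 4} (toWitness {a? = 4 <? stack} _) (eval val-key) then proj₁ (proj₂ first) then
           exec-assign {x = 4} (toWitness {a? = 4 <? stack} _) (eval val-key′) then proj₁ (proj₂ second) then ex))
        outcome : Σ[ s′ ∈ Registers ] Exec query s (queryLimit k) s′ × Answers s′
        outcome with rank lo <? rank hi
        ... | yes lo<hi = s₄ [ 2 ↦ rank lo ] [ 3 ↦ rank hi ∸ 1 ]
            , prologue (exec-if≢0 (λ ≡0 → 1+n≢0 (trans (sym (toBit-yes (+-monoʳ-< U lo<hi))) ≡0)) val-compare
                (exec-assign {x = 2} (toWitness {a? = 2 <? stack} _) (eval val-left) then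
                 exec-assign {x = 3} (toWitness {a? = 3 <? stack} _) (eval (val-right s₄8 (≤-trans (s≤s z≤n) lo<hi)))))
            , (λ _ → s₄1 , refl , refl) , λ hi≤lo → ⊥-elim (<⇒≱ lo<hi hi≤lo)
        ... | no lo≮hi = s₄ [ 1 ↦ 0 ]
            , prologue (exec-if≡0 (toBit-no (+-monoʳ-≤ U (≮⇒≥ lo≮hi))) val-compare
                (exec-weaken (m≤m+n 3 _) (λ _ _ → refl)
                  (exec-assign {x = 1} (toWitness {a? = 1 <? stack} _) (eval (val-lit 0 {v = 0})))))
            , (λ lo<hi → ⊥-elim (lo≮hi lo<hi)) , λ _ → refl

-- Assembly for a given text

spaceFactor : ℕ → ℕ
spaceFactor κ = 16 * (1758 + 48 * κ)

toBit-≡ : ∀ x → toBit (x ≡ᵇ x) ≡ 1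
toBit-≡ x with x ≡ᵇ x in x≡ᵇx
... | true  = refl
... | false = ⊥-elim (subst T x≡ᵇx (≡⇒≡ᵇ x x refl))

toBit-≢ : ∀ {x y} → x ≢ y → toBit (x ≡ᵇ y) ≡ 0
toBit-≢ {x} {y} x≢y with x ≡ᵇ y in x≡ᵇy
... | false = refl
... | true  = ⊥-elim (x≢y (≡ᵇ⇒≡ x y (subst T (sym x≡ᵇy) _)))

module Construction {σ m : ℕ} (T : Vec (Fin σ) (suc m)) (term : Terminated T)
                    (SA : Permutation′ (suc m)) (isSA : IsSuffixArray T SA)
                    {κ w : ℕ} (ws : WordSize 128 κ (suc m) σ w) where

  open BackwardSearch T term SA isSA

  r : ℕ
  r = #runs T SA

  L-length : length (toList (bwt T SA)) ≡ n
  L-length = length-toList (bwt T SA)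

  1≤r : 1 ≤ r
  1≤r = nonempty (toList (bwt T SA)) L-length
    where
    nonempty : ∀ (xs : List (Fin σ)) → length xs ≡ n → 1 ≤ length (runs xs)
    nonempty (x ∷ xs) _ = subst (λ rs → 1 ≤ length rs) (sym (proj₂ (proj₂ (runs-head x xs)))) (s≤s z≤n)

  r≤n : r ≤ n
  r≤n = ≤-trans (length-runs (toList (bwt T SA))) (≤-reflexive L-length)

  1≤σ : 1 ≤ σ
  1≤σ = ≤-trans (s≤s z≤n) (Fin.toℕ<n $)

  -- If `n ≥ 2`, some character exceeds the terminator; then `σ ≥ 2` and `r * ⌊log₂ σ ⌋` covers `r`.
  -- If `n = 1`, then `r ≤ 1 ≤ σ`.
  r≤S : r ≤ spaceBound n r σ
  r≤S with 2 ≤? n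
  ... | no n<2 = ≤-trans r≤n (≤-trans (s≤s⁻¹ (≰⇒> n<2)) (≤-trans 1≤σ (m≤n+m σ _)))
  ... | yes 2≤n = begin
    r                     ≤⟨ m≤m*n r ⌊log₂ σ ⌋ {{>-nonZero (⌊log₂⌋-mono-≤ 2≤σ)}} ⟩
    r * ⌊log₂ σ ⌋         ≤⟨ m≤n+m _ _ ⟩
    r * ⌊log₂ n ÷ r ⌋ + r * ⌊log₂ σ ⌋ ≤⟨ m≤m+n _ σ ⟩
    spaceBound n r σ      ∎
    where
    open ≤-Reasoning
    zero≢last : zero ≢ last
    zero≢last z≡ = <⇒≢ (s≤s⁻¹ 2≤n) (trans (cong toℕ z≡) (suc-injective (proj₁ (proj₂ term))))
    2≤σ : 2 ≤ σ
    2≤σ = ≤-trans (s≤s (≤-trans (s≤s z≤n) (proj₂ (proj₂ term) zero zero≢last))) (Fin.toℕ<n (lookup T zero))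

  starts : ℕ → ℕ
  starts x = Σ< x (λ z → χ (Start? z))

  starts-suc : ∀ a → starts (suc a * n) ≡ starts (a * n) + countRuns a (bwtRuns T SA)
  starts-suc a = trans (starts-row a) (cong (starts (a * n) +_)
    (trans (cong (λ k → Σ< k (λ i → χ (rowStart? L a i))) (sym L-length)) (count-runs a (toList (bwt T SA)))))

  starts-sum : ∀ a → starts (a * n) ≡ Σ< a (λ c → countRuns c (bwtRuns T SA))
  starts-sum zero    = refl
  starts-sum (suc a) = trans (starts-suc a) (cong (_+ countRuns a (bwtRuns T SA)) (starts-sum a))

  starts≤r : starts (σ * n) ≤ r
  starts≤r = ≤-trans (≤-reflexive (starts-sum σ)) (Σ-countRuns σ (bwtRuns T SA))

  open Space {κ} {n} {σ} {r} {w} ws (s≤s z≤n) 1≤r r≤n 1≤σ r≤S public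
  rank≤n : ∀ x → rank x ≤ n
  rank≤n x = proj₁ (rank-threshold x)

  module Query = RankQuery.Answer sizes (toℕ $) (Fin.toℕ<n $) B? Start? continue starts≤r rank≤n

  Answer : Fin σ → List (Fin σ) → Interval n → Set
  Answer a P I = ∃[ K ] IsSAInterval T SA (a ∷ P) K ×
    AnswersWithin w query Query.memory (queryCost * timeBound (#runsOf T SA a)) a I K

  returned : ∀ limit s′ (a : Fin σ) (I K : Interval n) → Query.Exec query (input a I) limit s′ →
             (∀ ρ → Query.Agree s′ ρ → Returns ρ K) → limit ≤ queryCost * timeBound (#runsOf T SA a) →
             AnswersWithin w query Query.memory (queryCost * timeBound (#runsOf T SA a)) a I K
  returned limit s′ a I K ex returns limit≤ =
    let t , ρ , t≤ , run , ag = ex (input a I) (λ _ _ → refl)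
    in t , ρ , run , returns ρ ag , ≤-trans t≤ limit≤

  short : ∀ a → queryLimit 1 ≤ queryCost * timeBound (#runsOf T SA a)
  short a = ≤-trans (queryLimit-≤ 1 ≤-refl) (*-monoʳ-≤ queryCost (s≤s z≤n))

  -- The starts in row `a` are the runs of `a`, so the time bound allows for enough halvings.
  range : ∀ a → starts (suc (toℕ a) * n) ∸ starts (toℕ a * n) < 2 ^ timeBound (#runsOf T SA a)
  range a = begin-strict
    starts (suc (toℕ a) * n) ∸ starts (toℕ a * n) ≡⟨ cong (_∸ starts (toℕ a * n)) (starts-suc (toℕ a)) ⟩
    starts (toℕ a * n) + countRuns (toℕ a) (bwtRuns T SA) ∸ starts (toℕ a * n) ≡⟨ m+n∸m≡n (starts (toℕ a * n)) _ ⟩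
    countRuns (toℕ a) (bwtRuns T SA)              ≡⟨ countRuns-filter a (bwtRuns T SA) ⟩
    #runsOf T SA a                                ≤⟨ m≤m⊔n _ 1 ⟩
    #runsOf T SA a ⊔ 1                            <⟨ n<2^[1+log] _ ⟩
    2 ^ timeBound (#runsOf T SA a)                ∎
    where open ≤-Reasoning

  module _ (a : Fin σ) (P : List (Fin σ)) (s e : Fin n) (int : IsSAInterval T SA P (just (s , e)))
           (ok : a ≡ $ → P ≡ [])
           (¬reject : toBit (toℕ a ≡ᵇ toℕ $) * toBit (toℕ e + 1 <ᵇ n + toℕ s) ≡ 0) where

    from to to′ k : ℕ
    from = toℕ a * n + toℕ s
    to   = toℕ a * n + suc (toℕ e)
    to′  = toℕ a * n + (toℕ e + 1)
    k    = timeBound (#runsOf T SA a)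

    to≡ : to ≡ to′
    to≡ = cong (toℕ a * n +_) (+-comm 1 (toℕ e))

    run : Σ[ s′ ∈ Registers ] Query.Exec query (input a (just (s , e))) (queryLimit k) s′ ×
      (rank from < rank to′ → s′ 1 ≡ 1 × s′ 2 ≡ rank from × s′ 3 ≡ rank to′ ∸ 1) × (rank to′ ≤ rank from → s′ 1 ≡ 0)
    run = Query.exec-query (Fin.toℕ<n a) (Fin.toℕ<n s) (Fin.toℕ<n e) {s = input a (just (s , e))}
            refl refl refl refl ¬reject k (range a)

    accepted-present : rank from < rank to → Answer a P (just (s , e))
    accepted-present from<to =
      let s′ , e′ , s≡ , e≡ , int′ = present int ok from<to
          r1 , r2 , r3 = proj₁ (proj₂ (proj₂ run)) (subst (λ x → rank from < rank x) to≡ from<to)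
      in just (s′ , e′) , int′ , returned (queryLimit k) (proj₁ run) a (just (s , e)) (just (s′ , e′)) (proj₁ (proj₂ run))
           (λ ρ ag → trans (ag 1 (toWitness {a? = 1 <? stack} _)) r1
                   , trans (ag 2 (toWitness {a? = 2 <? stack} _)) (trans r2 (sym s≡))
                   , trans (ag 3 (toWitness {a? = 3 <? stack} _)) (trans r3 (trans (cong (λ x → rank x ∸ 1) (sym to≡)) (sym e≡))))
           (queryLimit-≤ k (s≤s z≤n))

    accepted-absent : rank to ≤ rank from → Answer a P (just (s , e))
    accepted-absent to≤from =
      nothing , none int ok to≤from , returned (queryLimit k) (proj₁ run) a (just (s , e)) nothing (proj₁ (proj₂ run))
        (λ ρ ag → trans (ag 1 (toWitness {a? = 1 <? stack} _))
          (proj₂ (proj₂ (proj₂ run)) (subst (λ x → rank x ≤ rank from) to≡ to≤from)))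
        (queryLimit-≤ k (s≤s z≤n))

    accepted : Answer a P (just (s , e))
    accepted = case rank from <? rank to of λ where
      (yes from<to) → accepted-present from<to
      (no from≮to)  → accepted-absent (≮⇒≥ from≮to)

  rejected : ∀ P (s e : Fin n) → IsSAInterval T SA P (just (s , e)) → suc (toℕ e) < n + toℕ s → Answer $ P (just (s , e))
  rejected P s e int e< = nothing , absent-$ int e<
    , returned (queryLimit 1) (input $ (just (s , e)) [ 1 ↦ 0 ]) $ (just (s , e)) nothing
        (Query.exec-reject (Fin.toℕ<n $) (Fin.toℕ<n s) (Fin.toℕ<n e) {s = input $ (just (s , e))} refl refl refl refl reject)
        (λ ρ ag → ag 1 (toWitness {a? = 1 <? stack} _)) (short $)
    where
    reject : toBit (toℕ $ ≡ᵇ toℕ $) * toBit (toℕ e + 1 <ᵇ n + toℕ s) ≢ 0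
    reject ≡0 = 1+n≢0 (trans (sym (cong₂ _*_ (toBit-≡ (toℕ $)) (toBit-yes (subst (_< n + toℕ s) (+-comm 1 (toℕ e)) e<)))) ≡0)

  -- The program cannot see `P` and tests whether the interval is full. `absent-$` justifies
  -- rejecting all other intervals, `full⇒empty` accepting the full one.
  answer-$ : ∀ P (s e : Fin n) → IsSAInterval T SA P (just (s , e)) → (toList T ≡ $ ∷ [] → P ≡ []) → Answer $ P (just (s , e))
  answer-$ P s e int single = case suc (toℕ e) <? n + toℕ s of λ where
    (yes e<) → rejected P s e int e<
    (no e≮)  → accepted $ P s e int (λ _ → full⇒empty int (≮⇒≥ e≮) single)
      (trans (cong (toBit (toℕ $ ≡ᵇ toℕ $) *_) (toBit-no (≤-trans (≮⇒≥ e≮) (≤-reflexive (+-comm 1 (toℕ e))))))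
             (*-zeroʳ (toBit (toℕ $ ≡ᵇ toℕ $))))

  answer : ∀ a P I → IsSAInterval T SA P I → (toList T ≡ a ∷ [] → P ≡ []) → Answer a P I
  answer a P nothing int _ = nothing , absent int
    , returned (queryLimit 1) idle a nothing nothing (Query.exec-idle {idle} refl)
        (λ ρ ag → ag 1 (toWitness {a? = 1 <? stack} _)) (short a)
    where
    idle : Registers
    idle = input {n = n} a nothing
  answer a P (just (s , e)) int single = case a Fin.≟ $ of λ where
    (no a≢$)   → accepted a P s e int (λ a≡$ → ⊥-elim (a≢$ a≡$))
      (cong (_* toBit (toℕ e + 1 <ᵇ n + toℕ s)) (toBit-≢ (λ a≡$ → a≢$ (Fin.toℕ-injective a≡$))))
    (yes refl) → answer-$ P s e int single

theorem7 : Σ[ κ₀ ∈ ℕ ] ∀ (κ : ℕ) →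
    Σ[ c ∈ ℕ ] Σ[ query ∈ Program ]
    ∀ {n σ : ℕ} (T : Vec (Fin σ) n) → Terminated T →
    ∀ (SA : Permutation′ n) → IsSuffixArray T SA →
    ∀ (w : ℕ) → WordSize κ₀ κ n σ w →
    Σ[ m ∈ ℕ ] Σ[ D ∈ Vec ℕ m ]
    All (_< 2 ^ w) D
    × m * w ≤ c * spaceBound n (#runs T SA) σ
    × (∀ (a : Fin σ) (P : List (Fin σ)) (I : Interval n) →
    IsSAInterval T SA P I →
    (toList T ≡ a ∷ [] → P ≡ []) →
    ∃[ J ] IsSAInterval T SA (a ∷ P) J
    × AnswersWithin w query D (c * timeBound (#runsOf T SA a)) a I J)
-- A single constant has to serve for time and space, hence the sum.
theorem7 = 128 , λ κ → queryCost + spaceFactor κ , query , structure κ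
  where
  structure : ∀ κ {n σ} (T : Vec (Fin σ) n) → Terminated T → (SA : Permutation′ n) → IsSuffixArray T SA →
    ∀ w → WordSize 128 κ n σ w →
    Σ[ m ∈ ℕ ] Σ[ D ∈ Vec ℕ m ]
    All (_< 2 ^ w) D
    × m * w ≤ (queryCost + spaceFactor κ) * spaceBound n (#runs T SA) σ
    × (∀ (a : Fin σ) (P : List (Fin σ)) (I : Interval n) →
    IsSAInterval T SA P I →
    (toList T ≡ a ∷ [] → P ≡ []) →
    ∃[ J ] IsSAInterval T SA (a ∷ P) J
    × AnswersWithin w query D ((queryCost + spaceFactor κ) * timeBound (#runsOf T SA a)) a I J)
  structure κ {zero}      T (() , _)
  structure κ {suc m} {σ} T term SA isSA w ws =
    _ , Query.memory , Query.memory-<2^w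
    , ≤-trans space (*-monoˡ-≤ (spaceBound (suc m) (#runs T SA) σ) (m≤n+m (spaceFactor κ) queryCost))
    , λ a P I int single →
        let K , int′ , t , ρ , run , returns , t≤ = answer a P I int single
        in K , int′ , t , ρ , run , returns , ≤-trans t≤ (*-monoˡ-≤ (timeBound (#runsOf T SA a)) (m≤m+n queryCost (spaceFactor κ)))
    where open Construction T term SA isSA ws
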